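{- There exists a constant $c>0$ such that for all sufficiently large $n\in\mathbb{N}$ there exists an $n$-vertex graph $G$ with $\chi_f(G)\ge c\,\frac{\log\log n}{\log\log\log n}$ such that $G$ contains no $4$-regular subgraph.
   Context: $\chi_f(G)$ denotes the fractional chromatic number of $G$: the minimum of $\sum_{I} x_I$ over nonnegative weights $x_I$ on the independent sets $I$ of $G$ subject to $\sum_{I\ni v} x_I\ge 1$ for every vertex $v$. A $4$-regular subgraph is a (not necessarily induced, nonempty) subgraph in which every vertex has degree exactly $4$. -}

module Defs where

open import Data.Bool using (Bool; true; false; T; if_then_else_; _∧_)
open import Data.Nat as ℕ using (ℕ; zero; suc)
open import Data.Nat.Logarithm using (⌊log₂_⌋)
open import Data.Fin using (Fin)
open import Data.Vec using (Vec; []; _∷_; lookup)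
open import Data.List using (List; []; _∷_; _++_; map; foldr; allFin; filterᵇ; length)
open import Data.List.Membership.Propositional using (_∈_)
open import Data.Integer using (+_)
open import Data.Rational using (ℚ; 0ℚ; 1ℚ; _+_; _*_; _≤_; _/_)
open import Data.Product using (Σ; ∃; _×_)
open import Relation.Binary.PropositionalEquality using (_≡_)

record Graph (n : ℕ) : Set where
  field
    adj   : Fin n → Fin n → Bool
    sym   : ∀ u v → adj u v ≡ adj v u
    irref : ∀ v → adj v v ≡ false
open Graph public

VSet : ℕ → Set
VSet n = Vec Bool n

_∈ᵥ_ : ∀ {n} → Fin n → VSet n → Bool
v ∈ᵥ S = lookup S v

allVSets : (n : ℕ) → List (VSet n)
allVSets zero    = [] ∷ []
allVSets (suc n) = map (true ∷_) (allVSets n) ++ map (false ∷_) (allVSets n)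

Independent : ∀ {n} → Graph n → VSet n → Set
Independent {n} G I = ∀ (u v : Fin n) → T (u ∈ᵥ I) → T (v ∈ᵥ I) → adj G u v ≡ false

allᵇ : ∀ {n} → (Fin n → Bool) → Bool
allᵇ {n} p = foldr (λ x b → p x ∧ b) true (allFin n)

independentᵇ : ∀ {n} → Graph n → VSet n → Bool
independentᵇ G I = allᵇ (λ u → allᵇ (λ v →
  if (u ∈ᵥ I) ∧ (v ∈ᵥ I) then (if adj G u v then false else true) else true))

indepSets : ∀ {n} → Graph n → List (VSet n)
indepSets {n} G = filterᵇ (independentᵇ G) (allVSets n)

sumℚ : List ℚ → ℚ
sumℚ = foldr _+_ 0ℚ

IsFractionalColouring : ∀ {n} → Graph n → (VSet n → ℚ) → Set
IsFractionalColouring {n} G x =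
  (∀ I → 0ℚ ≤ x I) ×
  (∀ (v : Fin n) → 1ℚ ≤ sumℚ (map x (filterᵇ (λ I → v ∈ᵥ I) (indepSets G))))

weight : ∀ {n} → Graph n → (VSet n → ℚ) → ℚ
weight G x = sumℚ (map x (indepSets G))

FracChromAtLeast : ∀ {n} → Graph n → ℚ → Set
FracChromAtLeast G t = ∀ x → IsFractionalColouring G x → t ≤ weight G x

record Subgraph {n : ℕ} (G : Graph n) : Set where
  field
    verts   : VSet n
    edge    : Fin n → Fin n → Bool
    esym    : ∀ u v → edge u v ≡ edge v u
    eInG    : ∀ u v → T (edge u v) → T (adj G u v)
    eInVert : ∀ u v → T (edge u v) → T (u ∈ᵥ verts)
open Subgraph public

degreeIn : ∀ {n} {G : Graph n} → Subgraph G → Fin n → ℕ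
degreeIn {n} H v = length (filterᵇ (edge H v) (allFin n))

Has4RegularSubgraph : ∀ {n} → Graph n → Set
Has4RegularSubgraph {n} G = Σ (Subgraph G) λ H →
  (Σ (Fin n) λ v → T (v ∈ᵥ verts H)) ×
  (∀ v → T (v ∈ᵥ verts H) → degreeIn H v ≡ 4)

loglog logloglog : ℕ → ℕ
loglog n = ⌊log₂ ⌊log₂ n ⌋ ⌋
logloglog n = ⌊log₂ loglog n ⌋

ℕtoℚ : ℕ → ℚ
ℕtoℚ k = + k / 1

-- a / b as a rational (only used with b > 0; value 0 when b = 0).
ratio : ℕ → ℕ → ℚ
ratio a zero    = 0ℚ
ratio a (suc b) = + a / suc b

{-# OPTIONS --safe #-}
module Submission where

-- The graph is a random layered one.  Layers 1, …, k have sizes 2 ^ Λ / 2 ^ D j with D growing like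
-- 16 ^ j, layer 0 is the rest, and every vertex sends one edge to a uniformly random vertex of each
-- later (smaller) layer.
--
-- Fractional chromatic number: give every layer 1, …, k total weight 1, spread uniformly.  If I has
-- density at least 1 / 2 ^ b in layer i and total density s in the later layers, a vertex of I in
-- layer i misses I with probability at most 2 ^ (- s / 2), and a union bound over all I excludes
-- s ≥ 4 (b + 1).  With k ≤ 2 ^ b every independent set has weight O(b), so χ_f ≥ k / O(b), where
-- k is of order log log n and b of order log log log n.
--
-- No 4-regular subgraph: by a Chernoff and a union bound, every set A of fewer than 2 ^ (l i + 5)
-- vertices, where 2 ^ l i is the size of layer i, spans at most 5/4 |A| edges in the layers before i.
-- In a 4-regular subgraph let A, B, C be the vertices before, in and after layer i.  Each vertex
-- of A has at most one neighbour in B, so 4 |A| ≤ 5/2 |A| + |A| + 4 |C| and 4 |B| ≤ |A| + 4 |C|; the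
-- subgraph has at most 12 |C| vertices, which is absurd for the first i (from the last layer
-- down) at which the sparsity bound applies.

-- The density 5/4 has to lie strictly between 1 and 3/2. If e is the density, the degree count in
-- `A` leaves (4 - 2e - 1)|A| against the later layers, which is positive only for e < 3/2; with
-- degree 3 this would force e < 1. On the other hand e > 1 is what lets the union bound win:
-- choosing h vertices costs about (n/h)^h, while e h hits in a layer of size L have probability
-- about (h/L)^(e h). For h near the size of layer i + 1 and L at least the size of layer i this
-- asks for 5/4 (D (i + 1) - D i) > D (i + 1), that is D (i + 1) > 5 D i. The ratio 16 leaves room,
-- and starting at 16 ^ k absorbs the factor 2 ^ (K h) for the choice of arcs. Since `D` must stay
-- below log n, the number of layers is of order log log n.
--
-- Probabilities are counts over a finite list with denominators cleared. In place of binomial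
-- coefficients the union bounds use product weights: a set x is charged M ^ (- |x|), and these
-- charges sum to (1 + 1/M)^n.

module Proof where

  open import Defs hiding (sym)
  open import Data.Bool using (Bool; true; false; T; T?; not; _∧_; _∨_; if_then_else_)
  open import Data.Bool.Properties using (T-∧; T-∨; ∧-zeroʳ; ∨-comm)
  open import Data.Empty using (⊥; ⊥-elim)
  open import Data.Fin using (Fin; toℕ)
  open import Data.Fin.Properties using (toℕ<n)
  import Data.Integer as ℤ
  import Data.Integer.Properties as ℤP
  open import Data.List using (List; []; _∷_; _++_; map; concatMap; applyUpTo; upTo; filterᵇ; foldr; tabulate; allFin; length)
  open import Data.List.Membership.Propositional using (_∈_)
  open import Data.List.Membership.Propositional.Properties using (∈-map⁺; ∈-concatMap⁺; ∈-allFin)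
  open import Data.List.Relation.Unary.All as All using (All; []; _∷_)
  open import Data.List.Relation.Unary.All.Properties using (all-filter)
  open import Data.List.Relation.Unary.Any using (Any; here; there)
  open import Data.Nat
  open import Data.Nat.DivMod
  open import Data.Nat.Logarithm
  open import Data.Nat.Properties
  open import Data.Nat.Tactic.RingSolver using (solve-∀)
  open import Data.Product using (Σ; ∃; _×_; _,_; proj₁; proj₂)
  open import Data.Rational using (ℚ; 0ℚ; 1ℚ; Positive; NonNegative)
  import Data.Rational as ℚ
  import Data.Rational.Properties as ℚP
  import Data.Rational.Unnormalised as ℚᵘ
  import Data.Rational.Unnormalised.Properties as ℚᵘP
  open import Data.Sum using (_⊎_; inj₁; inj₂)
  open import Data.Unit using (tt)
  open import Data.Vec using (lookup)
  open import Function using (_∘_; id)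
  open import Function.Bundles using (Equivalence)
  open import Relation.Nullary using (¬_; Dec; yes; no)
  open import Relation.Nullary.Decidable using (decidable-stable; from-yes)
  open import Relation.Binary.PropositionalEquality

  -- Linear arithmetic from a Farkas certificate.
  by-≤ : ∀ {m n P Q} d → P ≤ Q → m + Q + d ≡ n + P → m ≤ n
  by-≤ {m} {n} {P} {Q} d P≤Q eq = +-cancelʳ-≤ Q m n (begin
    m + Q      ≤⟨ m≤m+n (m + Q) d ⟩
    m + Q + d  ≡⟨ eq ⟩
    n + P      ≤⟨ +-monoʳ-≤ n P≤Q ⟩
    n + Q      ∎)
    where open ≤-Reasoning

  ⟦_⟧ : Bool → ℕ
  ⟦ true ⟧ = 1
  ⟦ false ⟧ = 0

  ⟦⟧≤1 : ∀ b → ⟦ b ⟧ ≤ 1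
  ⟦⟧≤1 true = ≤-refl
  ⟦⟧≤1 false = z≤n

  ⟦T⟧ : ∀ {b} → T b → ⟦ b ⟧ ≡ 1
  ⟦T⟧ {true} _ = refl

  T⇒≡ : ∀ {b} → T b → b ≡ true
  T⇒≡ {true} _ = refl

  ≡⇒T : ∀ {b} → b ≡ true → T b
  ≡⇒T refl = tt

  -- Sums and products

  sum< prod< : ℕ → (ℕ → ℕ) → ℕ
  sum< zero f = 0
  sum< (suc n) f = f 0 + sum< n (f ∘ suc)
  prod< zero f = 1
  prod< (suc n) f = f 0 * prod< n (f ∘ suc)

  sum<-cong : ∀ n {f g} → (∀ i → i < n → f i ≡ g i) → sum< n f ≡ sum< n g
  sum<-cong zero h = refl
  sum<-cong (suc n) h = cong₂ _+_ (h 0 z<s) (sum<-cong n (λ i p → h (suc i) (s<s p)))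

  sum<-mono : ∀ n {f g} → (∀ i → i < n → f i ≤ g i) → sum< n f ≤ sum< n g
  sum<-mono zero h = z≤n
  sum<-mono (suc n) h = +-mono-≤ (h 0 z<s) (sum<-mono n (λ i p → h (suc i) (s<s p)))

  sum<-const : ∀ n c → sum< n (λ _ → c) ≡ n * c
  sum<-const zero c = refl
  sum<-const (suc n) c = cong (c +_) (sum<-const n c)

  sum<-+ : ∀ n f g → sum< n (λ i → f i + g i) ≡ sum< n f + sum< n g
  sum<-+ zero f g = refl
  sum<-+ (suc n) f g rewrite sum<-+ n (f ∘ suc) (g ∘ suc) =
    interchange (f 0) (g 0) (sum< n (f ∘ suc)) (sum< n (g ∘ suc))
    where
    interchange : ∀ a b c d → a + b + (c + d) ≡ a + c + (b + d)
    interchange = solve-∀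

  sum<-* : ∀ n c f → sum< n (λ i → c * f i) ≡ c * sum< n f
  sum<-* zero c f = sym (*-zeroʳ c)
  sum<-* (suc n) c f rewrite sum<-* n c (f ∘ suc) = sym (*-distribˡ-+ c (f 0) _)

  sum<-swap : ∀ m n (f : ℕ → ℕ → ℕ) →
    sum< m (λ i → sum< n (f i)) ≡ sum< n (λ j → sum< m (λ i → f i j))
  sum<-swap zero n f = sym (trans (sum<-const n 0) (*-zeroʳ n))
  sum<-swap (suc m) n f rewrite sum<-swap m n (f ∘ suc) =
    sym (sum<-+ n (f 0) (λ j → sum< m (λ i → f (suc i) j)))

  sum<-split : ∀ m n f → sum< (m + n) f ≡ sum< m f + sum< n (λ i → f (m + i))
  sum<-split zero n f = refl
  sum<-split (suc m) n f rewrite sum<-split m n (f ∘ suc) = sym (+-assoc (f 0) _ _)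

  sum<-last : ∀ n f → sum< (suc n) f ≡ sum< n f + f n
  sum<-last zero f = +-comm (f 0) 0
  sum<-last (suc n) f = trans (cong (f 0 +_) (sum<-last n (f ∘ suc))) (sym (+-assoc (f 0) _ _))

  term≤sum< : ∀ n f i → i < n → f i ≤ sum< n f
  term≤sum< (suc n) f zero _ = m≤m+n (f 0) _
  term≤sum< (suc n) f (suc i) (s≤s p) = ≤-trans (term≤sum< n (f ∘ suc) i p) (m≤n+m _ (f 0))

  sum<≡0 : ∀ n f → sum< n f ≡ 0 → ∀ i → i < n → f i ≡ 0
  sum<≡0 n f eq i i<n = n≤0⇒n≡0 (≤-trans (term≤sum< n f i i<n) (≤-reflexive eq))

  sum<-δ : ∀ n a → sum< n (λ w → ⟦ a ≡ᵇ w ⟧) ≤ 1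
  sum<-δ zero a = z≤n
  sum<-δ (suc n) zero = s≤s (≤-reflexive (trans (sum<-const n 0) (*-zeroʳ n)))
  sum<-δ (suc n) (suc a) = sum<-δ n a

  prod<-cong : ∀ n {f g} → (∀ i → i < n → f i ≡ g i) → prod< n f ≡ prod< n g
  prod<-cong zero h = refl
  prod<-cong (suc n) h = cong₂ _*_ (h 0 z<s) (prod<-cong n (λ i p → h (suc i) (s<s p)))

  prod<-mono : ∀ n {f g} → (∀ i → i < n → f i ≤ g i) → prod< n f ≤ prod< n g
  prod<-mono zero h = ≤-refl
  prod<-mono (suc n) h = *-mono-≤ (h 0 z<s) (prod<-mono n (λ i p → h (suc i) (s<s p)))

  prod<-const : ∀ n c → prod< n (λ _ → c) ≡ c ^ n
  prod<-const zero c = refl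
  prod<-const (suc n) c = cong (c *_) (prod<-const n c)

  prod<-* : ∀ n f g → prod< n (λ i → f i * g i) ≡ prod< n f * prod< n g
  prod<-* zero f g = refl
  prod<-* (suc n) f g rewrite prod<-* n (f ∘ suc) (g ∘ suc) =
    interchange (f 0) (g 0) (prod< n (f ∘ suc)) (prod< n (g ∘ suc))
    where
    interchange : ∀ a b c d → a * b * (c * d) ≡ a * c * (b * d)
    interchange = solve-∀

  prod<-^ : ∀ n b f → prod< n (λ i → b ^ f i) ≡ b ^ sum< n f
  prod<-^ zero b f = refl
  prod<-^ (suc n) b f rewrite prod<-^ n b (f ∘ suc) = sym (^-distribˡ-+-* b (f 0) _)

  prod<≡0 : ∀ n f → prod< n f ≡ 0 → ∃ λ i → i < n × f i ≡ 0
  prod<≡0 (suc n) f eq with m*n≡0⇒m≡0∨n≡0 (f 0) eq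
  ... | inj₁ p = 0 , z<s , p
  ... | inj₂ p with prod<≡0 n (f ∘ suc) p
  ... | i , i<n , q = suc i , s<s i<n , q

  prod<-pos : ∀ n f → (∀ i → i < n → 0 < f i) → 0 < prod< n f
  prod<-pos zero f h = z<s
  prod<-pos (suc n) f h = *-mono-≤ (h 0 z<s) (prod<-pos n (f ∘ suc) (λ i p → h (suc i) (s<s p)))

  sumL : {A : Set} → List A → (A → ℕ) → ℕ
  sumL [] f = 0
  sumL (x ∷ xs) f = f x + sumL xs f

  module _ {A : Set} where

    sumL-cong : ∀ (xs : List A) {f g} → (∀ x → f x ≡ g x) → sumL xs f ≡ sumL xs g
    sumL-cong [] h = refl
    sumL-cong (x ∷ xs) h = cong₂ _+_ (h x) (sumL-cong xs h)

    sumL-mono : ∀ (xs : List A) {f g} → (∀ x → f x ≤ g x) → sumL xs f ≤ sumL xs g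
    sumL-mono [] h = z≤n
    sumL-mono (x ∷ xs) h = +-mono-≤ (h x) (sumL-mono xs h)

    sumL-* : ∀ (xs : List A) c f → sumL xs (λ x → c * f x) ≡ c * sumL xs f
    sumL-* [] c f = sym (*-zeroʳ c)
    sumL-* (x ∷ xs) c f rewrite sumL-* xs c f = sym (*-distribˡ-+ c (f x) _)

    sumL-*ʳ : ∀ (xs : List A) c f → sumL xs (λ x → f x * c) ≡ sumL xs f * c
    sumL-*ʳ [] c f = refl
    sumL-*ʳ (x ∷ xs) c f rewrite sumL-*ʳ xs c f = sym (*-distribʳ-+ c (f x) _)

    sumL-+ : ∀ (xs : List A) f g → sumL xs (λ x → f x + g x) ≡ sumL xs f + sumL xs g
    sumL-+ [] f g = refl
    sumL-+ (x ∷ xs) f g rewrite sumL-+ xs f g = interchange (f x) (g x) (sumL xs f) (sumL xs g)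
      where
      interchange : ∀ a b c d → a + b + (c + d) ≡ a + c + (b + d)
      interchange = solve-∀

    sumL-0 : ∀ (xs : List A) → sumL xs (λ _ → 0) ≡ 0
    sumL-0 [] = refl
    sumL-0 (x ∷ xs) = sumL-0 xs

    sumL-++ : ∀ (xs ys : List A) f → sumL (xs ++ ys) f ≡ sumL xs f + sumL ys f
    sumL-++ [] ys f = refl
    sumL-++ (x ∷ xs) ys f rewrite sumL-++ xs ys f = sym (+-assoc (f x) _ _)

    sumL-sum<-swap : ∀ (xs : List A) n (f : A → ℕ → ℕ) →
      sumL xs (λ x → sum< n (f x)) ≡ sum< n (λ i → sumL xs (λ x → f x i))
    sumL-sum<-swap [] n f = sym (trans (sum<-const n 0) (*-zeroʳ n))
    sumL-sum<-swap (x ∷ xs) n f rewrite sumL-sum<-swap xs n f =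
      sym (sum<-+ n (f x) (λ i → sumL xs (λ y → f y i)))

    sumL≡0 : ∀ (xs : List A) f → sumL xs f ≡ 0 → ∀ {x} → x ∈ xs → f x ≡ 0
    sumL≡0 (y ∷ xs) f eq (here refl) = m+n≡0⇒m≡0 (f y) eq
    sumL≡0 (y ∷ xs) f eq (there p) = sumL≡0 xs f (m+n≡0⇒n≡0 (f y) eq) p

    sumL-filter : ∀ (p : A → Bool) xs f → sumL (filterᵇ p xs) f ≡ sumL xs (λ x → ⟦ p x ⟧ * f x)
    sumL-filter p [] f = refl
    sumL-filter p (x ∷ xs) f with p x
    ... | true = cong₂ _+_ (sym (+-identityʳ (f x))) (sumL-filter p xs f)
    ... | false = sumL-filter p xs f

    -- The first-moment method: an average below 1 forces a zero. The witness comes without a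
    -- membership proof, so nothing later may assume that the chosen outcome lies in `Ω`.
    sumL-avg : ∀ (xs : List A) f → sumL xs f < sumL xs (λ _ → 1) → ∃ λ x → f x ≡ 0
    sumL-avg (x ∷ xs) f p with f x in eq
    ... | zero = x , eq
    ... | suc c = sumL-avg xs f (<-≤-trans (s<s (m≤n+m _ c)) (s≤s⁻¹ p))

  sumL-map : ∀ {A B : Set} (g : A → B) xs f → sumL (map g xs) f ≡ sumL xs (f ∘ g)
  sumL-map g [] f = refl
  sumL-map g (x ∷ xs) f = cong (f (g x) +_) (sumL-map g xs f)

  sumL-concatMap : ∀ {A B : Set} (g : A → List B) xs f →
    sumL (concatMap g xs) f ≡ sumL xs (λ x → sumL (g x) f)
  sumL-concatMap g [] f = refl
  sumL-concatMap g (x ∷ xs) f =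
    trans (sumL-++ (g x) (concatMap g xs) f) (cong (sumL (g x) f +_) (sumL-concatMap g xs f))

  sumL-swap : ∀ {A B : Set} (xs : List A) (ys : List B) (f : A → B → ℕ) →
    sumL xs (λ x → sumL ys (f x)) ≡ sumL ys (λ y → sumL xs (λ x → f x y))
  sumL-swap [] ys f = sym (sumL-0 ys)
  sumL-swap (x ∷ xs) ys f rewrite sumL-swap xs ys f =
    sym (sumL-+ ys (f x) (λ y → sumL xs (λ z → f z y)))

  sumL-applyUpTo : ∀ {A : Set} (g : ℕ → A) n f → sumL (applyUpTo g n) f ≡ sum< n (f ∘ g)
  sumL-applyUpTo g zero f = refl
  sumL-applyUpTo g (suc n) f = cong (f (g 0) +_) (sumL-applyUpTo (g ∘ suc) n f)

  -- Enumeration of product spaces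

  cons : {A : Set} → A → (ℕ → A) → ℕ → A
  cons a f zero = a
  cons a f (suc i) = f i

  -- The enumerated sequences are constantly d from index n on.
  funs : {A : Set} → A → (ℕ → List A) → ℕ → List (ℕ → A)
  funs d o zero = (λ _ → d) ∷ []
  funs d o (suc n) = concatMap (λ a → map (cons a) (funs d (o ∘ suc) n)) (o 0)

  -- Independence of the coordinates in counting form. It evaluates the sums over random outcomes as
  -- well as the weighted sums over subsets.
  sumL-funs : ∀ {A : Set} d (o : ℕ → List A) n (φ : ℕ → A → ℕ) →
    sumL (funs d o n) (λ f → prod< n (λ i → φ i (f i))) ≡ prod< n (λ i → sumL (o i) (φ i))
  sumL-funs d o zero φ = refl
  sumL-funs d o (suc n) φ = begin
    sumL (concatMap (λ a → map (cons a) fs) (o 0)) F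
      ≡⟨ sumL-concatMap (λ a → map (cons a) fs) (o 0) F ⟩
    sumL (o 0) (λ a → sumL (map (cons a) fs) F)
      ≡⟨ sumL-cong (o 0) (λ a → trans (sumL-map (cons a) fs F)
           (trans (sumL-* fs (φ 0 a) _) (cong (φ 0 a *_) (sumL-funs d (o ∘ suc) n (φ ∘ suc))))) ⟩
    sumL (o 0) (λ a → φ 0 a * R)
      ≡⟨ sumL-*ʳ (o 0) R (φ 0) ⟩
    sumL (o 0) (φ 0) * R ∎
    where
    open ≡-Reasoning
    fs = funs d (o ∘ suc) n
    F = λ f → prod< (suc n) (λ i → φ i (f i))
    R = prod< n (λ i → sumL (o (suc i)) (φ (suc i)))

  subsets : ℕ → List (ℕ → Bool)
  subsets n = funs false (λ _ → true ∷ false ∷ []) n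

  -- Functions are compared pointwise, so the listed `y` is a pointwise copy of `x`, and properties
  -- of `x` have to be carried along that equality.
  subsets-complete : ∀ n (x : ℕ → Bool) → (∀ v → n ≤ v → x v ≡ false) →
    ∃ λ y → y ∈ subsets n × (∀ v → y v ≡ x v)
  subsets-complete zero x h = _ , here refl , λ v → sym (h v z≤n)
  subsets-complete (suc n) x h with subsets-complete n (x ∘ suc) (λ v p → h (suc v) (s≤s p))
  ... | y , y∈ , y≗ = cons (x 0) y , ∈-concatMap⁺ (λ a → map (cons a) (subsets n)) (pick (x 0))
                    , λ { zero → refl ; (suc v) → y≗ v }
    where
    pick : ∀ b → Any (λ a → cons b y ∈ map (cons a) (subsets n)) (true ∷ false ∷ [])
    pick true = here (∈-map⁺ (cons true) y∈)
    pick false = there (here (∈-map⁺ (cons false) y∈))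

  sumL-subsets : ∀ n (w : ℕ → Bool → ℕ) →
    sumL (subsets n) (λ x → prod< n (λ v → w v (x v))) ≡ prod< n (λ v → w v true + w v false)
  sumL-subsets n w = trans (sumL-funs false (λ _ → true ∷ false ∷ []) n w)
    (prod<-cong n (λ v _ → cong (w v true +_) (+-identityʳ (w v false))))

  T-∧⁻ : ∀ {a b} → T (a ∧ b) → T a × T b
  T-∧⁻ = Equivalence.to T-∧

  T-∧⁺ : ∀ {a b} → T a → T b → T (a ∧ b)
  T-∧⁺ p q = Equivalence.from T-∧ (p , q)

  ⟦⟧*-≤ : ∀ b {c d} → (T b → c ≤ d) → ⟦ b ⟧ * c ≤ d
  ⟦⟧*-≤ true {c} h = ≤-trans (≤-reflexive (+-identityʳ c)) (h tt)
  ⟦⟧*-≤ false h = z≤n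

  -- (1 + 1/M)^m ≤ 1 + 2m/M for 2m ≤ M, cleared of denominators.
  bernoulli : ∀ M m → 2 * m ≤ M → suc M ^ m * M ≤ M ^ m * (M + 2 * m)
  bernoulli M zero _ = ≤-reflexive (cong (_+ 0) (sym (+-identityʳ M)))
  bernoulli M (suc m) 2m≤M = begin
    suc M * suc M ^ m * M            ≡⟨ *-assoc (suc M) (suc M ^ m) M ⟩
    suc M * (suc M ^ m * M)          ≤⟨ *-monoʳ-≤ (suc M) (bernoulli M m 2m≤M′) ⟩
    suc M * (M ^ m * (M + 2 * m))    ≡⟨ swap (suc M) (M ^ m) (M + 2 * m) ⟩
    M ^ m * (suc M * (M + 2 * m))    ≤⟨ *-monoʳ-≤ (M ^ m) (by-≤ 0 2m≤M′ (eq M m)) ⟩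
    M ^ m * (M * (M + 2 * suc m))    ≡⟨ swap′ M (M ^ m) (M + 2 * suc m) ⟩
    M * M ^ m * (M + 2 * suc m)      ∎
    where
    open ≤-Reasoning
    2m≤M′ : 2 * m ≤ M
    2m≤M′ = ≤-trans (*-monoʳ-≤ 2 (n≤1+n m)) 2m≤M
    swap : ∀ a b c → a * (b * c) ≡ b * (a * c)
    swap = solve-∀
    swap′ : ∀ a b c → b * (a * c) ≡ a * b * c
    swap′ = solve-∀
    eq : ∀ M m → suc M * (M + 2 * m) + M + 0 ≡ M * (M + 2 * suc m) + 2 * m
    eq = solve-∀

  -- The estimate (1 + 1/M)^M ≤ 4. Bernoulli's condition `2 * m ≤ M` admits half of the exponent,
  -- which gives a factor 2; squaring gives 4.
  [1+M]^M : ∀ μ → suc (2 ^ μ) ^ (2 ^ μ) ≤ (2 ^ μ) ^ (2 ^ μ) * 4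
  [1+M]^M zero = s≤s (s≤s z≤n)
  [1+M]^M (suc μ) = begin
    suc M ^ (2 * h)              ≡⟨ cong (suc M ^_) (*-comm 2 h) ⟩
    suc M ^ (h * 2)              ≡⟨ sym (^-*-assoc (suc M) h 2) ⟩
    (suc M ^ h) ^ 2              ≤⟨ ^-monoˡ-≤ 2 half ⟩
    (M ^ h * 2) ^ 2              ≡⟨ sq (M ^ h) ⟩
    (M ^ h) ^ 2 * 4              ≡⟨ cong (_* 4) (^-*-assoc M h 2) ⟩
    M ^ (h * 2) * 4              ≡⟨ cong (λ t → M ^ t * 4) (*-comm h 2) ⟩
    M ^ (2 * h) * 4              ∎
    where
    open ≤-Reasoning
    h = 2 ^ μ
    M = 2 ^ suc μ
    sq : ∀ a → (a * 2) * ((a * 2) * 1) ≡ a * (a * 1) * 4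
    sq = solve-∀
    double : M + 2 * h ≡ 2 * M
    double = cong (M +_) (sym (+-identityʳ M))
    half : suc M ^ h ≤ M ^ h * 2
    half = *-cancelʳ-≤ (suc M ^ h) (M ^ h * 2) M {{m^n≢0 2 (suc μ)}} (begin
      suc M ^ h * M        ≤⟨ bernoulli M h ≤-refl ⟩
      M ^ h * (M + 2 * h)  ≡⟨ cong (M ^ h *_) double ⟩
      M ^ h * (2 * M)      ≡⟨ sym (*-assoc (M ^ h) 2 M) ⟩
      M ^ h * 2 * M        ∎)

  -- The exponent is padded by `d` to the full multiple `M * c`, and the padding is cancelled by
  -- `M ^ d ≤ suc M ^ d`.
  [1+M]^n : ∀ μ c n → n ≤ 2 ^ μ * c → suc (2 ^ μ) ^ n ≤ (2 ^ μ) ^ n * 4 ^ c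
  [1+M]^n μ c n n≤ = *-cancelʳ-≤ _ _ (M ^ d) {{m^n≢0 M d {{m^n≢0 2 μ}}}} (begin
    suc M ^ n * M ^ d      ≤⟨ *-monoʳ-≤ (suc M ^ n) (^-monoˡ-≤ d (n≤1+n M)) ⟩
    suc M ^ n * suc M ^ d  ≡⟨ sym (^-distribˡ-+-* (suc M) n d) ⟩
    suc M ^ (n + d)        ≡⟨ cong (suc M ^_) (m+[n∸m]≡n n≤) ⟩
    suc M ^ (M * c)        ≡⟨ sym (^-*-assoc (suc M) M c) ⟩
    (suc M ^ M) ^ c        ≤⟨ ^-monoˡ-≤ c ([1+M]^M μ) ⟩
    (M ^ M * 4) ^ c        ≡⟨ ^-distribʳ-* c (M ^ M) 4 ⟩
    (M ^ M) ^ c * 4 ^ c    ≡⟨ cong (_* 4 ^ c) (^-*-assoc M M c) ⟩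
    M ^ (M * c) * 4 ^ c    ≡⟨ cong (λ t → M ^ t * 4 ^ c) (sym (m+[n∸m]≡n n≤)) ⟩
    M ^ (n + d) * 4 ^ c    ≡⟨ cong (_* 4 ^ c) (^-distribˡ-+-* M n d) ⟩
    M ^ n * M ^ d * 4 ^ c  ≡⟨ swap (M ^ n) (M ^ d) (4 ^ c) ⟩
    M ^ n * 4 ^ c * M ^ d  ∎)
    where
    open ≤-Reasoning
    M = 2 ^ μ
    d = M * c ∸ n
    swap : ∀ a b c → a * b * c ≡ a * c * b
    swap = solve-∀
    ^-distribʳ-* : ∀ c a b → (a * b) ^ c ≡ a ^ c * b ^ c
    ^-distribʳ-* zero a b = refl
    ^-distribʳ-* (suc c) a b rewrite ^-distribʳ-* c a b = inter a b (a ^ c) (b ^ c)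
      where
      inter : ∀ a b c d → a * b * (c * d) ≡ a * c * (b * d)
      inter = solve-∀

  -- Each case records all three Boolean tests, so that rewriting with them reduces every comparison
  -- of two layers.
  data Order (a b : ℕ) : Set where
    lt : (a <ᵇ b) ≡ true → (a ≡ᵇ b) ≡ false → (b <ᵇ a) ≡ false → Order a b
    eq : (a <ᵇ b) ≡ false → (a ≡ᵇ b) ≡ true → (b <ᵇ a) ≡ false → Order a b
    gt : (a <ᵇ b) ≡ false → (a ≡ᵇ b) ≡ false → (b <ᵇ a) ≡ true → Order a b

  order : ∀ a b → Order a b
  order zero zero = eq refl refl refl
  order zero (suc b) = lt refl refl refl
  order (suc a) zero = gt refl refl refl
  order (suc a) (suc b) with order a b
  ... | lt p q r = lt p q r
  ... | eq p q r = eq p q r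
  ... | gt p q r = gt p q r

  -- The random layered digraph as a counted product space.

  module RandomLayers (n K : ℕ) (lay : ℕ → ℕ) where

    card : (ℕ → Bool) → ℕ
    card x = sum< n (λ v → ⟦ x v ⟧)

    size tail : ℕ → ℕ
    size j = card (λ v → lay v ≡ᵇ j)
    tail i = card (λ v → i <ᵇ lay v)

    layer : ℕ → List ℕ
    layer j = filterᵇ (λ v → lay v ≡ᵇ j) (upTo n)

    sumL-layer : ∀ j f → sumL (layer j) f ≡ sum< n (λ v → ⟦ lay v ≡ᵇ j ⟧ * f v)
    sumL-layer j f = trans (sumL-filter (λ v → lay v ≡ᵇ j) (upTo n) f) (sumL-applyUpTo id n _)

    sumL-layer-1 : ∀ j → sumL (layer j) (λ _ → 1) ≡ size j
    sumL-layer-1 j = trans (sumL-layer j (λ _ → 1)) (sum<-cong n (λ v _ → *-identityʳ _))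

    -- ω v j is the out-neighbour of v in layer j; it is used only when lay v < j.
    Ω : List (ℕ → ℕ → ℕ)
    Ω = funs (λ _ → 0) (λ _ → funs 0 layer K) n

    Z total : ℕ
    Z = prod< K size
    total = Z ^ n

    sumL-Ω : ∀ (φ : ℕ → ℕ → ℕ → ℕ) →
      sumL Ω (λ ω → prod< n (λ v → prod< K (λ j → φ v j (ω v j))))
        ≡ prod< n (λ v → prod< K (λ j → sumL (layer j) (φ v j)))
    sumL-Ω φ = trans
      (sumL-funs (λ _ → 0) (λ _ → funs 0 layer K) n (λ v f → prod< K (λ j → φ v j (f j))))
      (prod<-cong n (λ v _ → sumL-funs 0 layer K (φ v)))

    sumL-Ω-1 : sumL Ω (λ _ → 1) ≡ total
    sumL-Ω-1 = begin
      sumL Ω (λ _ → 1)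
        ≡⟨ sumL-cong Ω (λ ω → sym (trans (prod<-cong n (λ v _ → ones K)) (ones n))) ⟩
      sumL Ω (λ ω → prod< n (λ v → prod< K (λ j → 1)))
        ≡⟨ sumL-Ω (λ _ _ _ → 1) ⟩
      prod< n (λ v → prod< K (λ j → sumL (layer j) (λ _ → 1)))
        ≡⟨ prod<-cong n (λ v _ → prod<-cong K (λ j _ → sumL-layer-1 j)) ⟩
      prod< n (λ v → Z)
        ≡⟨ prod<-const n Z ⟩
      total ∎
      where
      open ≡-Reasoning
      ones : ∀ m → prod< m (λ _ → 1) ≡ 1
      ones m = trans (prod<-const m 1) (^-zeroˡ m)

    -- Local sparsity

    arcᵇ : ℕ → (ℕ → Bool) → ℕ → ℕ → ℕ → Bool
    arcᵇ i x v j a = x v ∧ (lay v <ᵇ j) ∧ (j <ᵇ i) ∧ x a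

    edges : ℕ → (ℕ → Bool) → (ℕ → ℕ → ℕ) → ℕ
    edges i x ω = sum< n (λ v → sum< K (λ j → ⟦ arcᵇ i x v j (ω v j) ⟧))

    scale : ℕ → (ℕ → Bool) → Bool
    scale s x = (2 ^ s ≤ᵇ card x) ∧ (card x <ᵇ 2 ^ suc s)

    dense : ℕ → (ℕ → Bool) → (ℕ → ℕ → ℕ) → Bool
    dense i x ω = 5 * card x <ᵇ 4 * edges i x ω

    module _ (i s a : ℕ) (big : ∀ j → 1 ≤ j → j < i → 2 ^ (4 * a + suc s) ≤ size j) where

      -- The factor of the moment generating function that belongs to one arc choice. The choice
      -- hits `x` with probability at most card x / size j, which `big` makes at most 2 ^ (- 4 a),
      -- so the expectation of 2 ^ (4 a hit) is at most 1 + 1. For a vertex outside `x` it is 1,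
      -- whence the exponent `⟦ x v ⟧`.
      moment : ∀ x → card x < 2 ^ suc s → ∀ v j →
        sumL (layer j) (λ w → 2 ^ (4 * a * ⟦ arcᵇ i x v j w ⟧)) ≤ 2 ^ ⟦ x v ⟧ * size j
      moment x small v j with x v | lay v <ᵇ j in v<j | j <ᵇ i in j<i
      ... | false | _ | _ = ≤-reflexive (trans
              (sumL-cong (layer j) (λ _ → cong (2 ^_) (*-zeroʳ (4 * a))))
              (trans (sumL-layer-1 j) (sym (+-identityʳ (size j)))))
      ... | true | false | _ = ≤-trans (≤-reflexive (trans
              (sumL-cong (layer j) (λ _ → cong (2 ^_) (*-zeroʳ (4 * a)))) (sumL-layer-1 j)))
              (m≤m+n (size j) _)
      ... | true | true | false = ≤-trans (≤-reflexive (trans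
              (sumL-cong (layer j) (λ _ → cong (2 ^_) (*-zeroʳ (4 * a)))) (sumL-layer-1 j)))
              (m≤m+n (size j) _)
      ... | true | true | true = begin
        sumL (layer j) (λ w → 2 ^ (4 * a * ⟦ x w ⟧))
          ≡⟨ sumL-layer j _ ⟩
        sum< n (λ w → ⟦ lay w ≡ᵇ j ⟧ * 2 ^ (4 * a * ⟦ x w ⟧))
          ≤⟨ sum<-mono n (λ w _ → pointwise (lay w ≡ᵇ j) (x w)) ⟩
        sum< n (λ w → ⟦ lay w ≡ᵇ j ⟧ + θ * ⟦ x w ⟧)
          ≡⟨ sum<-+ n _ _ ⟩
        size j + sum< n (λ w → θ * ⟦ x w ⟧)
          ≡⟨ cong (size j +_) (sum<-* n θ _) ⟩
        size j + θ * card x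
          ≤⟨ +-monoʳ-≤ (size j) (*-monoʳ-≤ θ (<⇒≤ small)) ⟩
        size j + θ * 2 ^ suc s
          ≡⟨ cong (size j +_) (sym (^-distribˡ-+-* 2 (4 * a) (suc s))) ⟩
        size j + 2 ^ (4 * a + suc s)
          ≤⟨ +-monoʳ-≤ (size j) (big j (≤-trans z<s (<ᵇ⇒< (lay v) j (≡⇒T v<j))) (<ᵇ⇒< j i (≡⇒T j<i))) ⟩
        size j + size j
          ≡⟨ cong (size j +_) (sym (+-identityʳ (size j))) ⟩
        2 * size j ∎
        where
        open ≤-Reasoning
        θ = 2 ^ (4 * a)
        pointwise : ∀ b c → ⟦ b ⟧ * 2 ^ (4 * a * ⟦ c ⟧) ≤ ⟦ b ⟧ + θ * ⟦ c ⟧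
        pointwise false c = z≤n
        pointwise true true = begin
          2 ^ (4 * a * 1) + 0  ≡⟨ +-identityʳ _ ⟩
          2 ^ (4 * a * 1)      ≡⟨ cong (2 ^_) (*-identityʳ (4 * a)) ⟩
          θ                    ≡⟨ sym (*-identityʳ θ) ⟩
          θ * 1                ≤⟨ n≤1+n _ ⟩
          1 + θ * 1            ∎
        pointwise true false = begin
          2 ^ (4 * a * 0) + 0  ≡⟨ +-identityʳ _ ⟩
          2 ^ (4 * a * 0)      ≡⟨ cong (2 ^_) (*-zeroʳ (4 * a)) ⟩
          1                    ≤⟨ m≤m+n 1 _ ⟩
          1 + θ * 0            ∎

      -- Markov's inequality for 2 ^ (4 * a * edges).
      chernoff : ∀ x → card x < 2 ^ suc s →
        sumL Ω (λ ω → ⟦ dense i x ω ⟧) * 2 ^ (5 * a * card x) ≤ 2 ^ (K * card x) * total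
      chernoff x small = begin
        sumL Ω (λ ω → ⟦ dense i x ω ⟧) * 2 ^ (5 * a * card x)
          ≡⟨ sym (sumL-*ʳ Ω _ _) ⟩
        sumL Ω (λ ω → ⟦ dense i x ω ⟧ * 2 ^ (5 * a * card x))
          ≤⟨ sumL-mono Ω (λ ω → ⟦⟧*-≤ (dense i x ω) (λ d → ^-monoʳ-≤ 2 (exponent ω d))) ⟩
        sumL Ω (λ ω → 2 ^ (4 * a * edges i x ω))
          ≡⟨ sumL-cong Ω (λ ω → sym (as-product ω)) ⟩
        sumL Ω (λ ω → prod< n (λ v → prod< K (λ j → 2 ^ (4 * a * ⟦ arcᵇ i x v j (ω v j) ⟧))))
          ≡⟨ sumL-Ω (λ v j w → 2 ^ (4 * a * ⟦ arcᵇ i x v j w ⟧)) ⟩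
        prod< n (λ v → prod< K (λ j → sumL (layer j) (λ w → 2 ^ (4 * a * ⟦ arcᵇ i x v j w ⟧))))
          ≤⟨ prod<-mono n (λ v _ → prod<-mono K (λ j _ → moment x small v j)) ⟩
        prod< n (λ v → prod< K (λ j → 2 ^ ⟦ x v ⟧ * size j))
          ≡⟨ prod<-cong n (λ v _ → trans (prod<-* K (λ _ → 2 ^ ⟦ x v ⟧) size)
               (cong (_* Z) (trans (prod<-const K (2 ^ ⟦ x v ⟧)) (trans (^-*-assoc 2 ⟦ x v ⟧ K)
                 (cong (2 ^_) (*-comm ⟦ x v ⟧ K)))))) ⟩
        prod< n (λ v → 2 ^ (K * ⟦ x v ⟧) * Z)
          ≡⟨ prod<-* n _ _ ⟩
        prod< n (λ v → 2 ^ (K * ⟦ x v ⟧)) * prod< n (λ _ → Z)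
          ≡⟨ cong₂ _*_ (trans (prod<-^ n 2 _) (cong (2 ^_) (sum<-* n K _))) (prod<-const n Z) ⟩
        2 ^ (K * card x) * total ∎
        where
        open ≤-Reasoning
        exponent : ∀ ω → T (dense i x ω) → 5 * a * card x ≤ 4 * a * edges i x ω
        exponent ω d = begin
          5 * a * card x         ≡⟨ swap 5 a (card x) ⟩
          a * (5 * card x)       ≤⟨ *-monoʳ-≤ a (<⇒≤ (<ᵇ⇒< _ _ d)) ⟩
          a * (4 * edges i x ω)  ≡⟨ sym (swap 4 a (edges i x ω)) ⟩
          4 * a * edges i x ω    ∎
          where
          swap : ∀ c a b → c * a * b ≡ a * (c * b)
          swap = solve-∀
        as-product : ∀ ω → prod< n (λ v → prod< K (λ j → 2 ^ (4 * a * ⟦ arcᵇ i x v j (ω v j) ⟧)))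
          ≡ 2 ^ (4 * a * edges i x ω)
        as-product ω =
          trans (prod<-cong n (λ v _ → trans (prod<-^ K 2 _) (cong (2 ^_) (sum<-* K (4 * a) _))))
          (trans (prod<-^ n 2 _) (cong (2 ^_) (sum<-* n (4 * a) _)))

      module _ (μ g : ℕ) (n≤ : n ≤ 2 ^ μ * 2 ^ s) (5a≡ : 5 * a ≡ K + μ + (2 + g)) where

        private
          M = 2 ^ μ
          count : (ℕ → Bool) → ℕ
          count x = ⟦ scale s x ⟧ * sumL Ω (λ ω → ⟦ dense i x ω ⟧)
          w : ℕ → Bool → ℕ
          w _ b = if b then 1 else M

        -- The set `x` is charged the weight `W`, which is M ^ n / M ^ card x. This is a product
        -- over vertices, so its sum over all subsets is (1 + M) ^ n.
        weighted : ∀ x → count x * (M ^ n * 2 ^ ((2 + g) * 2 ^ s)) ≤ total * prod< n (λ v → w v (x v))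
        weighted x = begin
          ⟦ scale s x ⟧ * N * (M ^ n * 2 ^ ((2 + g) * 2 ^ s))
            ≡⟨ *-assoc ⟦ scale s x ⟧ N _ ⟩
          ⟦ scale s x ⟧ * (N * (M ^ n * 2 ^ ((2 + g) * 2 ^ s)))
            ≤⟨ ⟦⟧*-≤ (scale s x) (λ t → main (≤ᵇ⇒≤ _ _ (proj₁ (T-∧⁻ {2 ^ s ≤ᵇ h} t))) (<ᵇ⇒< _ _ (proj₂ (T-∧⁻ {2 ^ s ≤ᵇ h} t)))) ⟩
          total * W ∎
          where
          open ≤-Reasoning
          h = card x
          N = sumL Ω (λ ω → ⟦ dense i x ω ⟧)
          W = prod< n (λ v → w v (x v))
          M^n : M ^ n ≡ W * 2 ^ (μ * h)
          M^n = begin-equality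
            M ^ n                                     ≡⟨ sym (prod<-const n M) ⟩
            prod< n (λ _ → M)                         ≡⟨ prod<-cong n (λ v _ → pointwise (x v)) ⟩
            prod< n (λ v → w v (x v) * 2 ^ (μ * ⟦ x v ⟧)) ≡⟨ prod<-* n _ _ ⟩
            W * prod< n (λ v → 2 ^ (μ * ⟦ x v ⟧))     ≡⟨ cong (W *_) (trans (prod<-^ n 2 _) (cong (2 ^_) (sum<-* n μ _))) ⟩
            W * 2 ^ (μ * h)                           ∎
            where
            pointwise : ∀ b → M ≡ (if b then 1 else M) * 2 ^ (μ * ⟦ b ⟧)
            pointwise true = sym (trans (+-identityʳ _) (cong (2 ^_) (*-identityʳ μ)))
            pointwise false = sym (trans (cong (λ t → M * 2 ^ t) (*-zeroʳ μ)) (*-identityʳ M))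
          main : 2 ^ s ≤ h → h < 2 ^ suc s → N * (M ^ n * 2 ^ ((2 + g) * 2 ^ s)) ≤ total * W
          main lo hi = begin
            N * (M ^ n * 2 ^ ((2 + g) * 2 ^ s))
              ≤⟨ *-monoʳ-≤ N (*-monoʳ-≤ (M ^ n) (^-monoʳ-≤ 2 (*-monoʳ-≤ (2 + g) lo))) ⟩
            N * (M ^ n * 2 ^ ((2 + g) * h))
              ≡⟨ cong (λ t → N * (t * 2 ^ ((2 + g) * h))) M^n ⟩
            N * (W * 2 ^ (μ * h) * 2 ^ ((2 + g) * h))
              ≡⟨ regroup N W _ _ ⟩
            N * (2 ^ (μ * h) * 2 ^ ((2 + g) * h)) * W
              ≤⟨ *-monoˡ-≤ W (*-cancelˡ-≤ (2 ^ (K * h)) {{m^n≢0 2 (K * h)}} cancelled) ⟩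
            total * W ∎
            where
            regroup : ∀ a b c d → a * (b * c * d) ≡ a * (c * d) * b
            regroup = solve-∀
            regroup′ : ∀ a b c d → a * (b * (c * d)) ≡ b * (a * c * d)
            regroup′ = solve-∀
            exps : ∀ k m e h → (k + m + e) * h ≡ k * h + m * h + e * h
            exps = solve-∀
            cancelled : 2 ^ (K * h) * (N * (2 ^ (μ * h) * 2 ^ ((2 + g) * h))) ≤ 2 ^ (K * h) * total
            cancelled = begin
              2 ^ (K * h) * (N * (2 ^ (μ * h) * 2 ^ ((2 + g) * h)))
                ≡⟨ regroup′ (2 ^ (K * h)) N (2 ^ (μ * h)) (2 ^ ((2 + g) * h)) ⟩
              N * (2 ^ (K * h) * 2 ^ (μ * h) * 2 ^ ((2 + g) * h))
                ≡⟨ cong (λ t → N * (t * 2 ^ ((2 + g) * h))) (sym (^-distribˡ-+-* 2 (K * h) (μ * h))) ⟩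
              N * (2 ^ (K * h + μ * h) * 2 ^ ((2 + g) * h))
                ≡⟨ cong (N *_) (sym (^-distribˡ-+-* 2 (K * h + μ * h) ((2 + g) * h))) ⟩
              N * 2 ^ (K * h + μ * h + (2 + g) * h)
                ≡⟨ cong (λ t → N * 2 ^ t) (sym (exps K μ (2 + g) h)) ⟩
              N * 2 ^ ((K + μ + (2 + g)) * h)
                ≡⟨ cong (λ t → N * 2 ^ (t * h)) (sym 5a≡) ⟩
              N * 2 ^ (5 * a * h)
                ≤⟨ chernoff x hi ⟩
              2 ^ (K * h) * total ∎

        -- The exponent `5 * a` available per vertex of `x` is spent in four ways: `K` on the
        -- moments, `μ` on choosing `x`, 2 on the excess (1 + 1/M)^n ≤ 4 ^ (2 ^ s), and `g` is left
        -- over as the bound on the probability.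
        dense-rare : sumL (subsets n) count * 2 ^ (g * 2 ^ s) ≤ total
        dense-rare = *-cancelʳ-≤ _ _ (M ^ n * 4 ^ (2 ^ s))
          {{m*n≢0 _ _ {{m^n≢0 M n {{m^n≢0 2 μ}}}} {{m^n≢0 4 (2 ^ s)}}}} (begin
          S * 2 ^ (g * 2 ^ s) * (M ^ n * 4 ^ (2 ^ s))
            ≡⟨ regroup S (2 ^ (g * 2 ^ s)) (M ^ n) (4 ^ (2 ^ s)) ⟩
          S * (M ^ n * (4 ^ (2 ^ s) * 2 ^ (g * 2 ^ s)))
            ≡⟨ cong (λ t → S * (M ^ n * t)) four ⟩
          S * (M ^ n * 2 ^ ((2 + g) * 2 ^ s))
            ≡⟨ sym (sumL-*ʳ (subsets n) _ count) ⟩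
          sumL (subsets n) (λ x → count x * (M ^ n * 2 ^ ((2 + g) * 2 ^ s)))
            ≤⟨ sumL-mono (subsets n) weighted ⟩
          sumL (subsets n) (λ x → total * prod< n (λ v → w v (x v)))
            ≡⟨ sumL-* (subsets n) total _ ⟩
          total * sumL (subsets n) (λ x → prod< n (λ v → w v (x v)))
            ≡⟨ cong (total *_) (trans (sumL-subsets n w) (prod<-const n (suc M))) ⟩
          total * suc M ^ n
            ≤⟨ *-monoʳ-≤ total ([1+M]^n μ (2 ^ s) n n≤) ⟩
          total * (M ^ n * 4 ^ (2 ^ s)) ∎)
          where
          open ≤-Reasoning
          S = sumL (subsets n) count
          regroup : ∀ a b c d → a * b * (c * d) ≡ a * (c * (d * b))
          regroup = solve-∀
          four : 4 ^ (2 ^ s) * 2 ^ (g * 2 ^ s) ≡ 2 ^ ((2 + g) * 2 ^ s)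
          four = begin-equality
            4 ^ (2 ^ s) * 2 ^ (g * 2 ^ s)        ≡⟨ cong (_* 2 ^ (g * 2 ^ s)) (^-*-assoc 2 2 (2 ^ s)) ⟩
            2 ^ (2 * 2 ^ s) * 2 ^ (g * 2 ^ s)    ≡⟨ sym (^-distribˡ-+-* 2 (2 * 2 ^ s) (g * 2 ^ s)) ⟩
            2 ^ (2 * 2 ^ s + g * 2 ^ s)          ≡⟨ cong (2 ^_) (sym (*-distribʳ-+ (2 ^ s) 2 g)) ⟩
            2 ^ ((2 + g) * 2 ^ s)                ∎

    -- Independent sets

    below : ℕ → (ℕ → Bool) → ℕ
    below i x = card (λ v → x v ∧ (lay v <ᵇ i))

    at : ℕ → (ℕ → Bool) → ℕ
    at i x = card (λ v → x v ∧ (lay v ≡ᵇ i))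

    hitᵇ : ℕ → (ℕ → Bool) → ℕ → ℕ → Bool
    hitᵇ i x j a = (i <ᵇ j) ∧ x a ∧ (lay a ≡ᵇ j)

    -- The quotient of `prod< K (miss i x)` by `Z` is the probability that the arcs from one vertex
    -- of layer `i` all avoid `x`.
    miss : ℕ → (ℕ → Bool) → ℕ → ℕ
    miss i x j = sumL (layer j) (λ a → ⟦ not (hitᵇ i x j a) ⟧)

    -- Demanding nothing below layer `i` keeps the union bound to choices in layer `i` and its tail;
    -- an independent set is cut down to this form before use. The last test says that a vertex of
    -- layer `i` misses `x` with probability at most 2 ^ (- m).
    heavy : ℕ → ℕ → ℕ → (ℕ → Bool) → Bool
    heavy i A m x = (below i x ≡ᵇ 0) ∧ (A ≤ᵇ at i x) ∧ (prod< K (miss i x) * 2 ^ m ≤ᵇ Z)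

    missed : ℕ → (ℕ → Bool) → (ℕ → ℕ → ℕ) → ℕ
    missed i x ω = prod< n (λ v → prod< K (λ j →
      ⟦ not ((x v ∧ (lay v ≡ᵇ i)) ∧ hitᵇ i x j (ω v j)) ⟧))

    missed-rare : ∀ i m x → prod< K (miss i x) * 2 ^ m ≤ Z →
      sumL Ω (missed i x) * 2 ^ (m * at i x) ≤ total
    missed-rare i m x small = begin
      sumL Ω (missed i x) * 2 ^ (m * at i x)
        ≡⟨ cong (_* 2 ^ (m * at i x)) (sumL-Ω (λ v j a → ⟦ not (y v ∧ hitᵇ i x j a) ⟧)) ⟩
      prod< n P * 2 ^ (m * at i x)
        ≡⟨ cong (prod< n P *_) (sym (trans (prod<-^ n 2 _) (cong (2 ^_) (sum<-* n m _)))) ⟩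
      prod< n P * prod< n (λ v → 2 ^ (m * ⟦ y v ⟧))
        ≡⟨ sym (prod<-* n P _) ⟩
      prod< n (λ v → P v * 2 ^ (m * ⟦ y v ⟧))
        ≤⟨ prod<-mono n (λ v _ → pointwise (y v)) ⟩
      prod< n (λ _ → Z)
        ≡⟨ prod<-const n Z ⟩
      total ∎
      where
      open ≤-Reasoning
      y : ℕ → Bool
      y v = x v ∧ (lay v ≡ᵇ i)
      P : ℕ → ℕ
      P v = prod< K (λ j → sumL (layer j) (λ a → ⟦ not (y v ∧ hitᵇ i x j a) ⟧))
      pointwise : ∀ b → prod< K (λ j → sumL (layer j) (λ a → ⟦ not (b ∧ hitᵇ i x j a) ⟧)) * 2 ^ (m * ⟦ b ⟧) ≤ Z
      pointwise true = ≤-trans (≤-reflexive (cong (λ t → prod< K (miss i x) * 2 ^ t) (*-identityʳ m))) small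
      pointwise false = ≤-reflexive (trans (cong₂ (λ a t → a * 2 ^ t) (prod<-cong K (λ j _ → sumL-layer-1 j)) (*-zeroʳ m)) (*-identityʳ Z))

    module _ (i A m c : ℕ) (size≤ : size i ≤ 2 ^ m * c) where

      private
        M = 2 ^ m
        count : (ℕ → Bool) → ℕ
        count x = ⟦ heavy i A (2 * m) x ⟧ * sumL Ω (missed i x)
        u : ℕ → Bool → ℕ
        u v b = if lay v <ᵇ i then (if b then 0 else 1) else (if lay v ≡ᵇ i then (if b then 1 else M) else 1)

      -- The exponent `2 * m` is split evenly: one half pays for choosing `x` inside layer `i` at
      -- the price M = 2 ^ m per vertex, the other survives as 2 ^ (m A). The weight `u` vanishes on
      -- sets that meet the layers below `i`, and it is 1 on the tail, whose choice therefore costs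
      -- a factor 2 per vertex.
      weighted-heavy : ∀ x → count x * (M ^ size i * 2 ^ (m * A)) ≤ total * prod< n (λ v → u v (x v))
      weighted-heavy x = ≤-trans (≤-reflexive (*-assoc ⟦ heavy i A (2 * m) x ⟧ N _))
        (⟦⟧*-≤ (heavy i A (2 * m) x) λ t →
          let t₁ , t₂₃ = T-∧⁻ {below i x ≡ᵇ 0} t
              t₂ , t₃ = T-∧⁻ {A ≤ᵇ at i x} t₂₃
          in main (≡ᵇ⇒≡ _ _ t₁) (≤ᵇ⇒≤ _ _ t₂) (≤ᵇ⇒≤ _ _ t₃))
        where
        open ≤-Reasoning
        N = sumL Ω (missed i x)
        W = prod< n (λ v → u v (x v))
        h = at i x
        main : below i x ≡ 0 → A ≤ h → prod< K (miss i x) * 2 ^ (2 * m) ≤ Z →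
          N * (M ^ size i * 2 ^ (m * A)) ≤ total * W
        main none A≤h small = begin
          N * (M ^ size i * 2 ^ (m * A))
            ≤⟨ *-monoʳ-≤ N (*-monoʳ-≤ (M ^ size i) (^-monoʳ-≤ 2 (*-monoʳ-≤ m A≤h))) ⟩
          N * (M ^ size i * 2 ^ (m * h))
            ≡⟨ cong (λ t → N * (t * 2 ^ (m * h))) M^size ⟩
          N * (W * 2 ^ (m * h) * 2 ^ (m * h))
            ≡⟨ regroup N W (2 ^ (m * h)) ⟩
          N * (2 ^ (m * h) * 2 ^ (m * h)) * W
            ≡⟨ cong (λ t → N * t * W) (trans (sym (^-distribˡ-+-* 2 (m * h) (m * h))) (cong (2 ^_) (twice m h))) ⟩
          N * 2 ^ (2 * m * h) * W
            ≤⟨ *-monoˡ-≤ W (missed-rare i (2 * m) x small) ⟩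
          total * W ∎
          where
          regroup : ∀ a b c → a * (b * c * c) ≡ a * (c * c) * b
          regroup = solve-∀
          twice : ∀ a b → a * b + a * b ≡ 2 * a * b
          twice = solve-∀
          pointwise : ∀ v → v < n → M ^ ⟦ lay v ≡ᵇ i ⟧ ≡ u v (x v) * 2 ^ (m * ⟦ x v ∧ (lay v ≡ᵇ i) ⟧)
          pointwise v v<n with sum<≡0 n _ none v v<n
          ... | z with order (lay v) i
          ... | lt p q r rewrite p | q with x v
          ... | false = sym (trans (+-identityʳ _) (cong (2 ^_) (*-zeroʳ m)))
          pointwise v v<n | z | eq p q r rewrite p | q with x v
          ... | true = sym (trans (+-identityʳ _) (trans (cong (2 ^_) (*-identityʳ m)) (sym (*-identityʳ M))))
          ... | false = trans (*-identityʳ M) (sym (trans (cong (λ t → M * 2 ^ t) (*-zeroʳ m)) (*-identityʳ M)))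
          pointwise v v<n | z | gt p q r rewrite p | q with x v
          ... | true = sym (trans (+-identityʳ _) (cong (2 ^_) (*-zeroʳ m)))
          ... | false = sym (trans (+-identityʳ _) (cong (2 ^_) (*-zeroʳ m)))
          M^size : M ^ size i ≡ W * 2 ^ (m * h)
          M^size = begin-equality
            M ^ size i                                  ≡⟨ sym (prod<-^ n M _) ⟩
            prod< n (λ v → M ^ ⟦ lay v ≡ᵇ i ⟧)          ≡⟨ prod<-cong n pointwise ⟩
            prod< n (λ v → u v (x v) * 2 ^ (m * ⟦ x v ∧ (lay v ≡ᵇ i) ⟧)) ≡⟨ prod<-* n _ _ ⟩
            W * prod< n (λ v → 2 ^ (m * ⟦ x v ∧ (lay v ≡ᵇ i) ⟧)) ≡⟨ cong (W *_) (trans (prod<-^ n 2 _) (cong (2 ^_) (sum<-* n m _))) ⟩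
            W * 2 ^ (m * h)                             ∎

      heavy-rare : sumL (subsets n) count * 2 ^ (m * A) ≤ total * 2 ^ (2 * c + tail i)
      heavy-rare = *-cancelʳ-≤ _ _ (M ^ size i) {{m^n≢0 M (size i) {{m^n≢0 2 m}}}} (begin
        S * 2 ^ (m * A) * M ^ size i
          ≡⟨ regroup S (2 ^ (m * A)) (M ^ size i) ⟩
        S * (M ^ size i * 2 ^ (m * A))
          ≡⟨ sym (sumL-*ʳ (subsets n) _ count) ⟩
        sumL (subsets n) (λ x → count x * (M ^ size i * 2 ^ (m * A)))
          ≤⟨ sumL-mono (subsets n) weighted-heavy ⟩
        sumL (subsets n) (λ x → total * prod< n (λ v → u v (x v)))
          ≡⟨ sumL-* (subsets n) total _ ⟩
        total * sumL (subsets n) (λ x → prod< n (λ v → u v (x v)))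
          ≡⟨ cong (total *_) (sumL-subsets n u) ⟩
        total * prod< n (λ v → u v true + u v false)
          ≡⟨ cong (total *_) (prod<-cong n (λ v _ → pointwise v)) ⟩
        total * prod< n (λ v → suc M ^ ⟦ lay v ≡ᵇ i ⟧ * 2 ^ ⟦ i <ᵇ lay v ⟧)
          ≡⟨ cong (total *_) (trans (prod<-* n _ _) (cong₂ _*_ (prod<-^ n (suc M) _) (prod<-^ n 2 _))) ⟩
        total * (suc M ^ size i * 2 ^ tail i)
          ≤⟨ *-monoʳ-≤ total (*-monoˡ-≤ (2 ^ tail i) ([1+M]^n m c (size i) size≤)) ⟩
        total * (M ^ size i * 4 ^ c * 2 ^ tail i)
          ≡⟨ cong (λ t → total * (M ^ size i * t * 2 ^ tail i)) (^-*-assoc 2 2 c) ⟩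
        total * (M ^ size i * 2 ^ (2 * c) * 2 ^ tail i)
          ≡⟨ regroup′ total (M ^ size i) (2 ^ (2 * c)) (2 ^ tail i) ⟩
        total * (2 ^ (2 * c) * 2 ^ tail i) * M ^ size i
          ≡⟨ cong (λ t → total * t * M ^ size i) (sym (^-distribˡ-+-* 2 (2 * c) (tail i))) ⟩
        total * 2 ^ (2 * c + tail i) * M ^ size i ∎)
        where
        open ≤-Reasoning
        S = sumL (subsets n) count
        regroup : ∀ a b c → a * b * c ≡ a * (c * b)
        regroup = solve-∀
        regroup′ : ∀ a b c d → a * (b * c * d) ≡ a * (c * d) * b
        regroup′ = solve-∀
        pointwise : ∀ v → u v true + u v false ≡ suc M ^ ⟦ lay v ≡ᵇ i ⟧ * 2 ^ ⟦ i <ᵇ lay v ⟧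
        pointwise v with order (lay v) i
        ... | lt p q r rewrite p | q | r = refl
        ... | eq p q r rewrite p | q | r = sym (trans (*-identityʳ _) (*-identityʳ (suc M)))
        ... | gt p q r rewrite p | q | r = refl

    -- The entry is read at `lay v`, so a value `ω u j` lying outside layer `j` creates no arc, and
    -- `ω` may be an arbitrary function.
    arc : (ℕ → ℕ → ℕ) → ℕ → ℕ → Bool
    arc ω u v = (lay u <ᵇ lay v) ∧ (ω u (lay v) ≡ᵇ v)

    arc-intro : ∀ ω {u v i j} → lay u ≡ i → lay v ≡ j → T (i <ᵇ j) → T (ω u j ≡ᵇ v) → T (arc ω u v)
    arc-intro ω refl refl p q = T-∧⁺ p q

    miss+at : ∀ i x j → (i <ᵇ j) ≡ true → miss i x j + at j x ≡ size j
    miss+at i x j p = begin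
      miss i x j + at j x
        ≡⟨ cong (_+ at j x) (sumL-layer j _) ⟩
      sum< n (λ v → ⟦ lay v ≡ᵇ j ⟧ * ⟦ not (hitᵇ i x j v) ⟧) + at j x
        ≡⟨ sym (sum<-+ n _ _) ⟩
      sum< n (λ v → ⟦ lay v ≡ᵇ j ⟧ * ⟦ not (hitᵇ i x j v) ⟧ + ⟦ x v ∧ (lay v ≡ᵇ j) ⟧)
        ≡⟨ sum<-cong n (λ v _ → pointwise (x v) (lay v ≡ᵇ j)) ⟩
      size j ∎
      where
      open ≡-Reasoning
      pointwise : ∀ a b → ⟦ b ⟧ * ⟦ not ((i <ᵇ j) ∧ a ∧ b) ⟧ + ⟦ a ∧ b ⟧ ≡ ⟦ b ⟧
      pointwise a b rewrite p with a | b
      ... | true | true = refl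
      ... | true | false = refl
      ... | false | true = refl
      ... | false | false = refl

    -- Only vertices beyond layer `i` can be hit, so cutting away the layers below `i` changes
    -- nothing.
    miss-cong : ∀ i x y → (∀ v → y v ≡ (x v ∧ not (lay v <ᵇ i))) → ∀ j → miss i y j ≡ miss i x j
    miss-cong i x y h j = sumL-cong (layer j) pointwise
      where
      pointwise : ∀ a → ⟦ not (hitᵇ i y j a) ⟧ ≡ ⟦ not (hitᵇ i x j a) ⟧
      pointwise a rewrite h a with i <ᵇ j in i<j | x a | lay a ≡ᵇ j in a≡j
      ... | false | _ | _ = refl
      ... | true | false | _ = refl
      ... | true | true | false = cong (λ b → ⟦ not b ⟧) (∧-zeroʳ _)
      ... | true | true | true with order (lay a) i
      ... | lt p q r = ⊥-elim (<-asym (<ᵇ⇒< i j (≡⇒T i<j)) (subst (_< i) (≡ᵇ⇒≡ (lay a) j (≡⇒T a≡j)) (<ᵇ⇒< (lay a) i (≡⇒T p))))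
      ... | eq p q r rewrite p = refl
      ... | gt p q r rewrite p = refl

    -- Regular subgraphs

    module Regular (ω : ℕ → ℕ → ℕ) (E : ℕ → ℕ → Bool) (x : ℕ → Bool)
      (E-sym : ∀ u v → E u v ≡ E v u)
      (E-arc : ∀ u v → T (E u v) → T (arc ω u v) ⊎ T (arc ω v u))
      (E-x : ∀ u v → T (E u v) → T (x u))
      (deg : ∀ u → T (x u) → sum< n (λ v → ⟦ E u v ⟧) ≡ 4)
      (i : ℕ) (i<K : i < K) where

      A B C : ℕ → Bool
      A v = x v ∧ (lay v <ᵇ i)
      B v = x v ∧ (lay v ≡ᵇ i)
      C v = x v ∧ (i <ᵇ lay v)

      -- Pairs are ordered: an edge inside `p` counts twice in `D p p`, so that the sum of `D p`
      -- over the three parts is a degree sum.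
      D : (p q : ℕ → Bool) → ℕ
      D p q = sum< n (λ v → sum< n (λ w → ⟦ p v ⟧ * (⟦ q w ⟧ * ⟦ E v w ⟧)))

      D-sym : ∀ p q → D p q ≡ D q p
      D-sym p q = trans (sum<-swap n n _) (sum<-cong n (λ v _ → sum<-cong n (λ w _ → flip v w)))
        where
        swap : ∀ a b c → a * (b * c) ≡ b * (a * c)
        swap = solve-∀
        flip : ∀ v w → ⟦ p w ⟧ * (⟦ q v ⟧ * ⟦ E w v ⟧) ≡ ⟦ q v ⟧ * (⟦ p w ⟧ * ⟦ E v w ⟧)
        flip v w rewrite E-sym w v = swap ⟦ p w ⟧ ⟦ q v ⟧ ⟦ E v w ⟧

      parts : ∀ v → T (x v) → ⟦ A v ⟧ + ⟦ B v ⟧ + ⟦ C v ⟧ ≡ 1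
      parts v xv rewrite T⇒≡ xv with order (lay v) i
      ... | lt p q r rewrite p | q | r = refl
      ... | eq p q r rewrite p | q | r = refl
      ... | gt p q r rewrite p | q | r = refl

      D-total : ∀ p → (∀ v → T (p v) → T (x v)) → D p A + D p B + D p C ≡ 4 * card p
      D-total p p⊆x = begin
        D p A + D p B + D p C
          ≡⟨ cong (_+ D p C) (sym (sum<-+ n _ _)) ⟩
        sum< n (λ v → row v A + row v B) + D p C
          ≡⟨ sym (sum<-+ n _ _) ⟩
        sum< n (λ v → row v A + row v B + row v C)
          ≡⟨ sum<-cong n (λ v _ → pointwise v) ⟩
        sum< n (λ v → 4 * ⟦ p v ⟧)
          ≡⟨ sum<-* n 4 _ ⟩
        4 * card p ∎
        where
        open ≡-Reasoning
        row : ℕ → (ℕ → Bool) → ℕ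
        row v q = sum< n (λ w → ⟦ p v ⟧ * (⟦ q w ⟧ * ⟦ E v w ⟧))
        factor : ∀ p a b c e → p * (a * e) + p * (b * e) + p * (c * e) ≡ p * ((a + b + c) * e)
        factor = solve-∀
        entry : ∀ v w → (⟦ A w ⟧ + ⟦ B w ⟧ + ⟦ C w ⟧) * ⟦ E v w ⟧ ≡ ⟦ E v w ⟧
        entry v w with E v w in eq
        ... | false = *-zeroʳ (⟦ A w ⟧ + ⟦ B w ⟧ + ⟦ C w ⟧)
        ... | true = trans (*-identityʳ _) (parts w (E-x w v (≡⇒T (trans (E-sym w v) eq))))
        guarded : ∀ v b → (T b → T (x v)) → ⟦ b ⟧ * sum< n (λ w → ⟦ E v w ⟧) ≡ 4 * ⟦ b ⟧
        guarded v false _ = refl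
        guarded v true h = trans (+-identityʳ _) (deg v (h tt))
        pointwise : ∀ v → row v A + row v B + row v C ≡ 4 * ⟦ p v ⟧
        pointwise v = begin
          row v A + row v B + row v C
            ≡⟨ cong (_+ row v C) (sym (sum<-+ n _ _)) ⟩
          sum< n (λ w → ⟦ p v ⟧ * (⟦ A w ⟧ * ⟦ E v w ⟧) + ⟦ p v ⟧ * (⟦ B w ⟧ * ⟦ E v w ⟧)) + row v C
            ≡⟨ sym (sum<-+ n _ _) ⟩
          sum< n (λ w → ⟦ p v ⟧ * (⟦ A w ⟧ * ⟦ E v w ⟧) + ⟦ p v ⟧ * (⟦ B w ⟧ * ⟦ E v w ⟧) + ⟦ p v ⟧ * (⟦ C w ⟧ * ⟦ E v w ⟧))
            ≡⟨ sum<-cong n (λ w _ → trans (factor ⟦ p v ⟧ ⟦ A w ⟧ ⟦ B w ⟧ ⟦ C w ⟧ ⟦ E v w ⟧) (cong (⟦ p v ⟧ *_) (entry v w))) ⟩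
          sum< n (λ w → ⟦ p v ⟧ * ⟦ E v w ⟧)
            ≡⟨ sum<-* n ⟦ p v ⟧ _ ⟩
          ⟦ p v ⟧ * sum< n (λ w → ⟦ E v w ⟧)
            ≡⟨ guarded v (p v) (p⊆x v) ⟩
          4 * ⟦ p v ⟧ ∎

      A⊆x : ∀ v → T (A v) → T (x v)
      A⊆x v p = proj₁ (T-∧⁻ {x v} p)
      B⊆x : ∀ v → T (B v) → T (x v)
      B⊆x v p = proj₁ (T-∧⁻ {x v} p)
      C⊆x : ∀ v → T (C v) → T (x v)
      C⊆x v p = proj₁ (T-∧⁻ {x v} p)

      indicators : ∀ a b c {d} → (T a → T b → T c → 1 ≤ d) → ⟦ a ⟧ * (⟦ b ⟧ * ⟦ c ⟧) ≤ d
      indicators true true true h = h tt tt tt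
      indicators true true false h = z≤n
      indicators true false c h = z≤n
      indicators false b c h = z≤n

      arc-not-below : ∀ u v → lay v ≤ lay u → ¬ T (arc ω u v)
      arc-not-below u v v≤u p = <⇒≱ (<ᵇ⇒< (lay u) (lay v) (proj₁ (T-∧⁻ {lay u <ᵇ lay v} p))) v≤u

      -- Arcs point to later layers, so an edge between `A` and `B` is the single entry `ω v i` of
      -- its end in `A`.
      D-AB : D A B ≤ card A
      D-AB = sum<-mono n (λ v _ → row v)
        where
        row : ∀ v → sum< n (λ w → ⟦ A v ⟧ * (⟦ B w ⟧ * ⟦ E v w ⟧)) ≤ ⟦ A v ⟧
        row v = begin
          sum< n (λ w → ⟦ A v ⟧ * (⟦ B w ⟧ * ⟦ E v w ⟧))
            ≤⟨ sum<-mono n (λ w _ → indicators (A v) (B w) (E v w) (λ a b e → one w a b e)) ⟩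
          sum< n (λ w → ⟦ A v ⟧ * ⟦ ω v i ≡ᵇ w ⟧)
            ≡⟨ sum<-* n ⟦ A v ⟧ _ ⟩
          ⟦ A v ⟧ * sum< n (λ w → ⟦ ω v i ≡ᵇ w ⟧)
            ≤⟨ *-monoʳ-≤ ⟦ A v ⟧ (sum<-δ n (ω v i)) ⟩
          ⟦ A v ⟧ * 1
            ≡⟨ *-identityʳ _ ⟩
          ⟦ A v ⟧ ∎
          where
          open ≤-Reasoning
          one : ∀ w → T (A v) → T (B w) → T (E v w) → 1 ≤ ⟦ A v ⟧ * ⟦ ω v i ≡ᵇ w ⟧
          one w a b e with ≡ᵇ⇒≡ (lay w) i (proj₂ (T-∧⁻ {x w} b))
          ... | refl with E-arc v w e
          ... | inj₁ p = ≤-reflexive (sym (cong₂ _*_ (⟦T⟧ a) (⟦T⟧ (proj₂ (T-∧⁻ {lay v <ᵇ lay w} p)))))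
          ... | inj₂ p = ⊥-elim (arc-not-below w v (<⇒≤ (<ᵇ⇒< (lay v) (lay w) (proj₂ (T-∧⁻ {x v} a)))) p)

      D-BB : D B B ≡ 0
      D-BB = n≤0⇒n≡0 (≤-trans (sum<-mono n {g = λ _ → 0} (λ v _ →
        ≤-trans (sum<-mono n {g = λ _ → 0} (λ w _ → indicators (B v) (B w) (E v w) (λ a b e → ⊥-elim (none v w a b e))))
                (≤-reflexive zeros))) (≤-reflexive zeros))
        where
        zeros : sum< n (λ _ → 0) ≡ 0
        zeros = trans (sum<-const n 0) (*-zeroʳ n)
        none : ∀ v w → T (B v) → T (B w) → ¬ T (E v w)
        none v w a b e with ≡ᵇ⇒≡ (lay v) i (proj₂ (T-∧⁻ {x v} a)) | ≡ᵇ⇒≡ (lay w) i (proj₂ (T-∧⁻ {x w} b)) | E-arc v w e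
        ... | p | q | inj₁ r = arc-not-below v w (≤-reflexive (trans q (sym p))) r
        ... | p | q | inj₂ r = arc-not-below w v (≤-reflexive (trans p (sym q))) r

      -- Each pair is an arc one way or the other, hence the factor 2. The arc from `v` to `w` is
      -- charged to the index `lay w`, and `sum<-δ` allows one target per index.
      D-AA : D A A ≤ 2 * edges i A ω
      D-AA = begin
        D A A
          ≤⟨ sum<-mono n (λ v _ → sum<-mono n (λ w _ → indicators (A v) (A w) (E v w) (split v w))) ⟩
        sum< n (λ v → sum< n (λ w → h v w + h w v))
          ≡⟨ trans (sum<-cong n (λ v _ → sum<-+ n _ _)) (sum<-+ n _ _) ⟩
        F + sum< n (λ v → sum< n (λ w → h w v))
          ≡⟨ cong (F +_) (sum<-swap n n _) ⟩
        F + F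
          ≡⟨ cong (F +_) (sym (+-identityʳ F)) ⟩
        2 * F
          ≤⟨ *-monoʳ-≤ 2 (sum<-mono n (λ v _ → row v)) ⟩
        2 * edges i A ω ∎
        where
        open ≤-Reasoning
        h : ℕ → ℕ → ℕ
        h v w = ⟦ A v ⟧ * (⟦ A w ⟧ * ⟦ arc ω v w ⟧)
        F = sum< n (λ v → sum< n (λ w → h v w))
        split : ∀ v w → T (A v) → T (A w) → T (E v w) → 1 ≤ h v w + h w v
        split v w a b e with E-arc v w e
        ... | inj₁ p rewrite ⟦T⟧ a | ⟦T⟧ b | ⟦T⟧ p = s≤s z≤n
        ... | inj₂ p rewrite ⟦T⟧ a | ⟦T⟧ b | ⟦T⟧ p = m≤n+m 1 (⟦ arc ω v w ⟧ + 0 + 0)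
        row : ∀ v → sum< n (λ w → h v w) ≤ sum< K (λ j → ⟦ arcᵇ i A v j (ω v j) ⟧)
        row v = begin
          sum< n (λ w → h v w)
            ≤⟨ sum<-mono n (λ w _ → indicators (A v) (A w) (arc ω v w) (one w)) ⟩
          sum< n (λ w → sum< K (λ j → ⟦ arcᵇ i A v j (ω v j) ⟧ * ⟦ ω v j ≡ᵇ w ⟧))
            ≡⟨ sum<-swap n K _ ⟩
          sum< K (λ j → sum< n (λ w → ⟦ arcᵇ i A v j (ω v j) ⟧ * ⟦ ω v j ≡ᵇ w ⟧))
            ≡⟨ sum<-cong K (λ j _ → sum<-* n ⟦ arcᵇ i A v j (ω v j) ⟧ (λ w → ⟦ ω v j ≡ᵇ w ⟧)) ⟩
          sum< K (λ j → ⟦ arcᵇ i A v j (ω v j) ⟧ * sum< n (λ w → ⟦ ω v j ≡ᵇ w ⟧))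
            ≤⟨ sum<-mono K (λ j _ → ≤-trans (*-monoʳ-≤ ⟦ arcᵇ i A v j (ω v j) ⟧ (sum<-δ n (ω v j))) (≤-reflexive (*-identityʳ _))) ⟩
          sum< K (λ j → ⟦ arcᵇ i A v j (ω v j) ⟧) ∎
          where
          one : ∀ w → T (A v) → T (A w) → T (arc ω v w) →
            1 ≤ sum< K (λ j → ⟦ arcᵇ i A v j (ω v j) ⟧ * ⟦ ω v j ≡ᵇ w ⟧)
          one w a b p = ≤-trans (≤-reflexive (sym (cong₂ _*_ (⟦T⟧ isArc) (⟦T⟧ v→w))))
            (term≤sum< K (λ j → ⟦ arcᵇ i A v j (ω v j) ⟧ * ⟦ ω v j ≡ᵇ w ⟧) (lay w) (<-trans (<ᵇ⇒< (lay w) i w<i) i<K))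
            where
            w<i : T (lay w <ᵇ i)
            w<i = proj₂ (T-∧⁻ {x w} b)
            v<w : T (lay v <ᵇ lay w)
            v<w = proj₁ (T-∧⁻ {lay v <ᵇ lay w} p)
            v→w : T (ω v (lay w) ≡ᵇ w)
            v→w = proj₂ (T-∧⁻ {lay v <ᵇ lay w} p)
            isArc : T (arcᵇ i A v (lay w) (ω v (lay w)))
            isArc = T-∧⁺ {A v} a (T-∧⁺ {lay v <ᵇ lay w} v<w (T-∧⁺ {lay w <ᵇ i} w<i
              (subst (T ∘ A) (sym (≡ᵇ⇒≡ (ω v (lay w)) w v→w)) b)))

      -- Doubling the degree sum of `A` turns the hypothesis into 8|A| ≤ 5|A| + 2|A| + 8|C|, so |A|
      -- ≤ 8|C|. The degree sum of `B` then gives 4|B| ≤ 12|C|, and 12 = 8 + 3 + 1.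
      regular-bound : 4 * edges i A ω ≤ 5 * card A → card x ≤ 12 * tail i
      regular-bound sparse = begin
        card x                      ≤⟨ sum<-mono n (λ v _ → cover v) ⟩
        sum< n (λ v → ⟦ A v ⟧ + ⟦ B v ⟧ + ⟦ C v ⟧)
          ≡⟨ trans (sum<-+ n _ _) (cong (_+ card C) (sum<-+ n _ _)) ⟩
        card A + card B + card C    ≤⟨ +-monoˡ-≤ (card C) (+-mono-≤ A≤8C B≤3C) ⟩
        8 * card C + 3 * card C + card C  ≡⟨ sum12 (card C) ⟩
        12 * card C                 ≤⟨ *-monoʳ-≤ 12 (sum<-mono n (λ v _ → drop (x v) (i <ᵇ lay v))) ⟩
        12 * tail i                 ∎
        where
        open ≤-Reasoning
        sum12 : ∀ c → 8 * c + 3 * c + c ≡ 12 * c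
        sum12 = solve-∀
        drop : ∀ a b → ⟦ a ∧ b ⟧ ≤ ⟦ b ⟧
        drop true b = ≤-refl
        drop false b = z≤n
        cover : ∀ v → ⟦ x v ⟧ ≤ ⟦ A v ⟧ + ⟦ B v ⟧ + ⟦ C v ⟧
        cover v with x v in eq
        ... | false = z≤n
        ... | true = ≤-reflexive (trans (sym (parts v (≡⇒T eq))) (cong (λ b → ⟦ b ∧ (lay v <ᵇ i) ⟧ + ⟦ b ∧ (lay v ≡ᵇ i) ⟧ + ⟦ b ∧ (i <ᵇ lay v) ⟧) eq))
        C-A : D A C ≤ 4 * card C
        C-A = ≤-trans (≤-reflexive (D-sym A C)) (≤-trans (≤-trans (m≤m+n (D C A) (D C B)) (m≤m+n _ (D C C))) (≤-reflexive (D-total C C⊆x)))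
        C-B : D B C ≤ 4 * card C
        C-B = ≤-trans (≤-reflexive (D-sym B C)) (≤-trans (≤-trans (m≤n+m (D C B) (D C A)) (m≤m+n _ (D C C))) (≤-reflexive (D-total C C⊆x)))
        A≤8C : card A ≤ 8 * card C
        A≤8C = by-≤ 0 (+-mono-≤ (+-mono-≤ (+-mono-≤ sparse (*-monoʳ-≤ 2 D-AA)) (*-monoʳ-≤ 2 (+-mono-≤ D-AB C-A))) (*-monoʳ-≤ 2 (≤-reflexive (sym (D-total A A⊆x)))))
          (cert (card A) (card C) (edges i A ω) (D A A) (D A B) (D A C))
          where
          cert : ∀ a c e aa ab ac →
            a + (5 * a + 2 * (2 * e) + 2 * (a + 4 * c) + 2 * (aa + ab + ac)) + 0
              ≡ 8 * c + (4 * e + 2 * aa + 2 * (ab + ac) + 2 * (4 * a))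
          cert = solve-∀
        B≤3C : card B ≤ 3 * card C
        B≤3C = *-cancelˡ-≤ 4 (begin
          4 * card B               ≡⟨ sym (D-total B B⊆x) ⟩
          D B A + D B B + D B C    ≡⟨ cong₂ (λ a b → a + b + D B C) (D-sym B A) D-BB ⟩
          D A B + 0 + D B C        ≤⟨ +-mono-≤ (+-monoˡ-≤ 0 (≤-trans D-AB A≤8C)) C-B ⟩
          8 * card C + 0 + 4 * card C ≡⟨ sum34 (card C) ⟩
          4 * (3 * card C)         ∎)
          where
          sum34 : ∀ c → 8 * c + 0 + 4 * c ≡ 4 * (3 * c)
          sum34 = solve-∀

  -- The partial product P / Q of the current block is at most 1 / (1 + s / R), where s is its partial
  -- sum; as soon as s reaches R the block is closed and contributes a factor 1/2.
  prod<-blocks : ∀ R .{{_ : NonZero R}} r (p q c : ℕ → ℕ) →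
    (∀ j → j < r → c j ≤ R × p j * R + q j * c j ≤ q j * R) →
    ∀ m P Q s → s < R → P * (R + s) ≤ Q * R → 2 * m * R ≤ s + sum< r c →
    P * prod< r p * 2 ^ m ≤ Q * prod< r q
  prod<-blocks R zero p q c h zero P Q s s<R inv goal = begin
    P * 1 * 1  ≡⟨ *-identityʳ (P * 1) ⟩
    P * 1      ≤⟨ *-monoˡ-≤ 1 (*-cancelʳ-≤ P Q R (≤-trans (*-monoʳ-≤ P (m≤m+n R s)) inv)) ⟩
    Q * 1      ∎
    where open ≤-Reasoning
  prod<-blocks R zero p q c h (suc m) P Q s s<R inv goal = ⊥-elim (<⇒≱ s<R (begin
    R                ≤⟨ m≤m*n R (2 * suc m) ⟩
    R * (2 * suc m)  ≡⟨ *-comm R (2 * suc m) ⟩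
    2 * suc m * R    ≤⟨ goal ⟩
    s + 0            ≡⟨ +-identityʳ s ⟩
    s                ∎))
    where open ≤-Reasoning
  prod<-blocks R (suc r) p q c h m P Q s s<R inv goal = go m goal
    where
    open ≤-Reasoning
    p₀ = p 0
    q₀ = q 0
    c₀ = c 0
    c₀≤R = proj₁ (h 0 z<s)
    rest = sum< r (c ∘ suc)
    -- With x = c / R and y = s / R this is (1 - x)(1 + y + x) ≤ 1 + y. The slack is x (x + y),
    -- which is the summand `P * q * c * (c + s)` below.
    core : ∀ c d s p q P Q R → c + d ≡ R → p * R + q * c ≤ q * R → P * (R + s) ≤ Q * R →
      P * p * (R + (s + c)) * R ≤ Q * q * R * R
    core c d s p q P Q R refl h inv = begin
      P * p * (c + d + (s + c)) * (c + d)       ≡⟨ e₁ P p (c + d + (s + c)) (c + d) ⟩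
      P * (c + d + (s + c)) * (p * (c + d))     ≤⟨ *-monoʳ-≤ (P * (c + d + (s + c))) pR≤qd ⟩
      P * (c + d + (s + c)) * (q * d)           ≤⟨ m≤m+n _ _ ⟩
      P * (c + d + (s + c)) * (q * d) + P * q * c * (c + s) ≡⟨ e₂ P q c d s ⟩
      q * (c + d) * (P * (c + d + s))           ≤⟨ *-monoʳ-≤ (q * (c + d)) inv ⟩
      q * (c + d) * (Q * (c + d))               ≡⟨ e₃ q Q (c + d) ⟩
      Q * q * (c + d) * (c + d)                 ∎
      where
      e₁ : ∀ a b c d → a * b * c * d ≡ a * c * (b * d)
      e₁ = solve-∀
      e₂ : ∀ P q c d s → P * (c + d + (s + c)) * (q * d) + P * q * c * (c + s) ≡ q * (c + d) * (P * (c + d + s))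
      e₂ = solve-∀
      e₃ : ∀ q Q R → q * R * (Q * R) ≡ Q * q * R * R
      e₃ = solve-∀
      pR≤qd : p * (c + d) ≤ q * d
      pR≤qd = +-cancelʳ-≤ (q * c) _ _ (≤-trans h (≤-reflexive (trans (*-distribˡ-+ q c d) (+-comm (q * c) (q * d)))))
    inv′ : P * p₀ * (R + (s + c₀)) ≤ Q * q₀ * R
    inv′ = *-cancelʳ-≤ _ _ R (core c₀ (R ∸ c₀) s p₀ q₀ P Q R (m+[n∸m]≡n c₀≤R) (proj₂ (h 0 z<s)) inv)
    h′ : ∀ j → j < r → _
    h′ j j<r = h (suc j) (s<s j<r)
    assoc-l : ∀ P p x y → P * (p * x) * y ≡ P * p * x * y
    assoc-l = solve-∀
    go : ∀ m → 2 * m * R ≤ s + (c₀ + rest) → P * (p₀ * prod< r (p ∘ suc)) * 2 ^ m ≤ Q * (q₀ * prod< r (q ∘ suc))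
    go m goal with s + c₀ <? R
    ... | yes s′<R = begin
      P * (p₀ * prod< r (p ∘ suc)) * 2 ^ m  ≡⟨ assoc-l P p₀ _ _ ⟩
      P * p₀ * prod< r (p ∘ suc) * 2 ^ m
        ≤⟨ prod<-blocks R r (p ∘ suc) (q ∘ suc) (c ∘ suc) h′ m (P * p₀) (Q * q₀) (s + c₀) s′<R inv′
             (≤-trans goal (≤-reflexive (sym (+-assoc s c₀ rest)))) ⟩
      Q * q₀ * prod< r (q ∘ suc)            ≡⟨ *-assoc Q q₀ _ ⟩
      Q * (q₀ * prod< r (q ∘ suc))          ∎
    -- No halving is left to gain, but the block is restarted because the recursion demands `s < R`.
    go zero goal | no s′≮R = begin
      P * (p₀ * prod< r (p ∘ suc)) * 1  ≡⟨ assoc-l P p₀ _ _ ⟩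
      P * p₀ * prod< r (p ∘ suc) * 1
        ≤⟨ prod<-blocks R r (p ∘ suc) (q ∘ suc) (c ∘ suc) h′ 0 (P * p₀) (Q * q₀) 0 (>-nonZero⁻¹ R)
             (≤-trans (*-monoʳ-≤ (P * p₀) (+-monoʳ-≤ R z≤n)) inv′) z≤n ⟩
      Q * q₀ * prod< r (q ∘ suc)            ≡⟨ *-assoc Q q₀ _ ⟩
      Q * (q₀ * prod< r (q ∘ suc))          ∎
    go (suc m) goal | no s′≮R = begin
      P * (p₀ * prod< r (p ∘ suc)) * (2 * 2 ^ m)  ≡⟨ move P p₀ _ _ ⟩
      P * p₀ * 2 * prod< r (p ∘ suc) * 2 ^ m
        ≤⟨ prod<-blocks R r (p ∘ suc) (q ∘ suc) (c ∘ suc) h′ m (P * p₀ * 2) (Q * q₀) 0 (>-nonZero⁻¹ R) half goal′ ⟩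
      Q * q₀ * prod< r (q ∘ suc)            ≡⟨ *-assoc Q q₀ _ ⟩
      Q * (q₀ * prod< r (q ∘ suc))          ∎
      where
      move : ∀ P p x y → P * (p * x) * (2 * y) ≡ P * p * 2 * x * y
      move = solve-∀
      R≤ : R ≤ s + c₀
      R≤ = ≮⇒≥ s′≮R
      two : ∀ x R → x * 2 * (R + 0) ≡ x * (R + R)
      two = solve-∀
      half : P * p₀ * 2 * (R + 0) ≤ Q * q₀ * R
      half = ≤-trans (≤-reflexive (two (P * p₀) R)) (≤-trans (*-monoʳ-≤ (P * p₀) (+-monoʳ-≤ R R≤)) inv′)
      farkas : ∀ m R s c t → 2 * m * R + (s + (c + t) + (R + R)) + 0 ≡ t + (2 * suc m * R + (s + c))
      farkas = solve-∀
      -- A closed block has used `s + c₀`, which is less than R + R. This is why each halving is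
      -- budgeted at 2 R.
      goal′ : 2 * m * R ≤ 0 + rest
      goal′ = by-≤ 0 (+-mono-≤ goal (+-mono-≤ (<⇒≤ s<R) c₀≤R)) (farkas m R s c₀ rest)

  first : ∀ k (t : ℕ → ℕ) B → (∀ j → j < k → t j ≤ B) ⊎ ∃ λ i → i < k × (∀ j → j < i → t j ≤ B) × B < t i
  first zero t B = inj₁ λ _ ()
  first (suc k) t B with t 0 ≤? B
  ... | no t≰B = inj₂ (0 , z<s , (λ _ ()) , ≰⇒> t≰B)
  ... | yes t≤B with first k (t ∘ suc) B
  ... | inj₁ h = inj₁ λ { zero _ → t≤B ; (suc j) (s≤s p) → h j p }
  ... | inj₂ (i , i<k , h , b) = inj₂ (suc i , s<s i<k , (λ { zero _ → t≤B ; (suc j) (s≤s p) → h j p }) , b)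

  -- Weight of an independent set in a good outcome.

  module IndependentSets (n k : ℕ) (lay : ℕ → ℕ) where

    private
      K = suc k

    open RandomLayers n K lay

    module _ (ω : ℕ → ℕ → ℕ) (D A : ℕ → ℕ) (R B m : ℕ) .{{_ : NonZero R}}
      (sizes : ∀ j → 1 ≤ j → j ≤ k → size j * 2 ^ D j ≡ R)
      (AB : ∀ j → 1 ≤ j → j ≤ k → A j * 2 ^ D j ≤ B)
      (kB : k * B ≤ R)
      (good : ∀ i → i < k → ∀ {x} → x ∈ subsets n → ⟦ heavy (suc i) (A (suc i)) m x ⟧ * missed (suc i) x ω ≡ 0)
      (x : ℕ → Bool) (x<n : ∀ v → n ≤ v → x v ≡ false)
      (indep : ∀ u v → T (x u) → T (x v) → ¬ T (arc ω u v))
      where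

      private
        t : ℕ → ℕ
        t j = at j x * 2 ^ D j

      at≤size : ∀ j → at j x ≤ size j
      at≤size j = sum<-mono n (λ v _ → pointwise (x v) (lay v ≡ᵇ j))
        where
        pointwise : ∀ a b → ⟦ a ∧ b ⟧ ≤ ⟦ b ⟧
        pointwise true b = ≤-refl
        pointwise false b = z≤n

      t≤R : ∀ j → 1 ≤ j → j ≤ k → t j ≤ R
      t≤R j 1≤j j≤k = ≤-trans (*-monoˡ-≤ (2 ^ D j) (at≤size j)) (≤-reflexive (sizes j 1≤j j≤k))

      -- Were the product small, the part of `x` from layer `i` on would be heavy. By `good` it
      -- would then not be missed, so some vertex of `x` in layer `i` would send an arc into `x`.
      light : ∀ i → i < k → A (suc i) ≤ at (suc i) x → Z < prod< K (miss (suc i) x) * 2 ^ m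
      light i₀ i₀<k A≤ = ≰⇒> contra
        where
        i = suc i₀
        restrict : ℕ → Bool
        restrict v = x v ∧ not (lay v <ᵇ i)
        restrict<n : ∀ v → n ≤ v → restrict v ≡ false
        restrict<n v n≤v rewrite x<n v n≤v = refl
        contra : ¬ prod< K (miss i x) * 2 ^ m ≤ Z
        contra small with subsets-complete n restrict restrict<n
        ... | y , y∈ , y≗ = final
          where
          y⇒x : ∀ v → T (y v) → T (x v)
          y⇒x v p = proj₁ (T-∧⁻ {x v} (subst T (y≗ v) p))
          below≡0 : below i y ≡ 0
          below≡0 = trans (sum<-cong n {g = λ _ → 0} (λ v _ → pointwise v)) (trans (sum<-const n 0) (*-zeroʳ n))
            where
            pointwise : ∀ v → ⟦ y v ∧ (lay v <ᵇ i) ⟧ ≡ 0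
            pointwise v rewrite y≗ v with x v | lay v <ᵇ i
            ... | true | true = refl
            ... | true | false = refl
            ... | false | _ = refl
          at≡ : at i y ≡ at i x
          at≡ = sum<-cong n (λ v _ → pointwise v)
            where
            pointwise : ∀ v → ⟦ y v ∧ (lay v ≡ᵇ i) ⟧ ≡ ⟦ x v ∧ (lay v ≡ᵇ i) ⟧
            pointwise v rewrite y≗ v with order (lay v) i
            ... | lt p q r rewrite p | q = cong ⟦_⟧ (trans (∧-zeroʳ _) (sym (∧-zeroʳ (x v))))
            ... | eq p q r rewrite p | q with x v
            ... | true = refl
            ... | false = refl
            pointwise v | gt p q r rewrite p | q = cong ⟦_⟧ (trans (∧-zeroʳ _) (sym (∧-zeroʳ (x v))))
          isHeavy : T (heavy i (A i) m y)
          isHeavy = T-∧⁺ (≡⇒≡ᵇ _ 0 below≡0) (T-∧⁺ {A i ≤ᵇ at i y} (≤⇒≤ᵇ (≤-trans A≤ (≤-reflexive (sym at≡))))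
            (≤⇒≤ᵇ (≤-trans (≤-reflexive (cong (_* 2 ^ m) (prod<-cong K (λ j _ → miss-cong i x y y≗ j)))) small)))
          missed≡0 : missed i y ω ≡ 0
          missed≡0 = trans (sym (trans (cong (_* missed i y ω) (⟦T⟧ isHeavy)) (+-identityʳ _))) (good i₀ i₀<k y∈)
          final : ⊥
          final with prod<≡0 n _ missed≡0
          ... | v , v<n , z with prod<≡0 K _ z
          ... | j , j<K , z′ with ⟦not⟧≡0 _ z′
            where
            ⟦not⟧≡0 : ∀ b → ⟦ not b ⟧ ≡ 0 → T b
            ⟦not⟧≡0 true _ = tt
          ... | hit with T-∧⁻ {y v ∧ (lay v ≡ᵇ i)} hit
          ... | yv∧ , hit′ with T-∧⁻ {y v} yv∧ | T-∧⁻ {i <ᵇ j} hit′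
          ... | yv , v≡i | i<j , hit″ with T-∧⁻ {y (ω v j)} hit″
          ... | yw , w≡j = indep v (ω v j) (y⇒x v yv) (y⇒x (ω v j) yw) isArc
            where
            isArc : T (arc ω v (ω v j))
            isArc = arc-intro ω (≡ᵇ⇒≡ (lay v) i v≡i) (≡ᵇ⇒≡ (lay (ω v j)) j w≡j) i<j (≡⇒≡ᵇ (ω v j) (ω v j) refl)

      -- Take the first layer of weight above `B`. The layers before it weigh at most k B ≤ R
      -- together and the layer itself at most R. The later ones weigh less than 2 m R, since
      -- otherwise `prod<-blocks` contradicts `light`. If no such layer exists, the whole weight is
      -- at most k B.
      independent-bound : sum< k (λ j → t (suc j)) ≤ (2 * m + 2) * R
      independent-bound with first k (λ j → t (suc j)) B
      ... | inj₁ h = begin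
        sum< k (λ j → t (suc j))  ≤⟨ sum<-mono k h ⟩
        sum< k (λ _ → B)          ≡⟨ sum<-const k B ⟩
        k * B                     ≤⟨ kB ⟩
        R                         ≤⟨ m≤m+n R _ ⟩
        R + (2 * m + 1) * R       ≡⟨ e m R ⟩
        (2 * m + 2) * R           ∎
        where
        open ≤-Reasoning
        e : ∀ m R → R + (2 * m + 1) * R ≡ (2 * m + 2) * R
        e = solve-∀
      ... | inj₂ (i₀ , i₀<k , small , B<t) with sum< k (λ j → t (suc j)) ≤? (2 * m + 2) * R
      ... | yes ok = ok
      ... | no big = ⊥-elim (<⇒≱ (light i₀ i₀<k A≤at) product-small)
        where
        open ≤-Reasoning
        i = suc i₀
        A≤at : A i ≤ at i x
        A≤at = *-cancelʳ-≤ _ _ (2 ^ D i) {{m^n≢0 2 (D i)}} (≤-trans (AB i z<s i₀<k) (<⇒≤ B<t))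
        c : ℕ → ℕ
        c j = ⟦ i <ᵇ j ⟧ * t j
        bound : ∀ j → j < k → t (suc j) ≤ B + R * ⟦ i₀ ≡ᵇ j ⟧ + c (suc j)
        bound j j<k with order i₀ j
        ... | lt p q r rewrite p | q = ≤-trans (m≤n+m _ (B + R * 0)) (+-monoʳ-≤ (B + R * 0) (≤-reflexive (sym (+-identityʳ _))))
        ... | eq p q r rewrite p | q = begin
          t (suc j)       ≤⟨ t≤R (suc j) z<s j<k ⟩
          R               ≡⟨ sym (*-identityʳ R) ⟩
          R * 1           ≤⟨ m≤n+m (R * 1) B ⟩
          B + R * 1       ≤⟨ m≤m+n _ 0 ⟩
          B + R * 1 + 0   ∎
        ... | gt p q r rewrite p | q = ≤-trans (small j (<ᵇ⇒< j i₀ (≡⇒T r))) (≤-trans (m≤m+n B _) (m≤m+n _ 0))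
        total≤ : sum< k (λ j → t (suc j)) ≤ R + R + sum< K c
        total≤ = begin
          sum< k (λ j → t (suc j))
            ≤⟨ sum<-mono k bound ⟩
          sum< k (λ j → B + R * ⟦ i₀ ≡ᵇ j ⟧ + c (suc j))
            ≡⟨ trans (sum<-+ k _ _) (cong (_+ sum< k (c ∘ suc)) (trans (sum<-+ k _ _) (cong₂ _+_ (sum<-const k B) (sum<-* k R _)))) ⟩
          k * B + R * sum< k (λ j → ⟦ i₀ ≡ᵇ j ⟧) + sum< k (c ∘ suc)
            ≤⟨ +-monoˡ-≤ _ (+-mono-≤ kB (≤-trans (*-monoʳ-≤ R (sum<-δ k i₀)) (≤-reflexive (*-identityʳ R)))) ⟩
          R + R + sum< k (c ∘ suc)
            ≤⟨ +-monoʳ-≤ (R + R) (m≤n+m _ (c 0)) ⟩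
          R + R + sum< K c ∎
        c-big : 2 * m * R ≤ 0 + sum< K c
        c-big = by-≤ 0 (+-mono-≤ (<⇒≤ (≰⇒> big)) total≤) (e m R (sum< k (λ j → t (suc j))) (sum< K c))
          where
          e : ∀ m R S C → 2 * m * R + (S + (R + R + C)) + 0 ≡ 0 + C + ((2 * m + 2) * R + S)
          e = solve-∀
        miss-c : ∀ j → j < K → c j ≤ R × miss i x j * R + size j * c j ≤ size j * R
        miss-c j j<K = cases (i <ᵇ j) refl
          where
          e₁ : ∀ a R s h d → a * R + s * (h * d + 0) ≡ a * R + h * (s * d)
          e₁ = solve-∀
          cases : ∀ b → (i <ᵇ j) ≡ b → ⟦ b ⟧ * t j ≤ R × miss i x j * R + size j * (⟦ b ⟧ * t j) ≤ size j * R
          cases false i≮j = z≤n , (begin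
            miss i x j * R + size j * 0  ≡⟨ cong (miss i x j * R +_) (*-zeroʳ (size j)) ⟩
            miss i x j * R + 0           ≡⟨ +-identityʳ _ ⟩
            miss i x j * R               ≡⟨ cong (_* R) (trans (sumL-cong (layer j) (λ a →
                                              cong (λ b → ⟦ not (b ∧ x a ∧ (lay a ≡ᵇ j)) ⟧) i≮j)) (sumL-layer-1 j)) ⟩
            size j * R                   ∎)
          cases true i<j = ≤-trans (≤-reflexive (+-identityʳ (t j))) (t≤R j 1≤j j≤k) , ≤-reflexive (begin-equality
            miss i x j * R + size j * (at j x * 2 ^ D j + 0)
              ≡⟨ e₁ (miss i x j) R (size j) (at j x) (2 ^ D j) ⟩
            miss i x j * R + at j x * (size j * 2 ^ D j)
              ≡⟨ cong (λ z → miss i x j * R + at j x * z) (sizes j 1≤j j≤k) ⟩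
            miss i x j * R + at j x * R
              ≡⟨ sym (*-distribʳ-+ R (miss i x j) (at j x)) ⟩
            (miss i x j + at j x) * R
              ≡⟨ cong (_* R) (miss+at i x j i<j) ⟩
            size j * R ∎)
            where
            1≤j : 1 ≤ j
            1≤j = ≤-trans (s≤s z≤n) (<ᵇ⇒< i j (≡⇒T i<j))
            j≤k : j ≤ k
            j≤k = s≤s⁻¹ j<K
        product-small : prod< K (miss i x) * 2 ^ m ≤ Z
        product-small = begin
          prod< K (miss i x) * 2 ^ m      ≡⟨ cong (_* 2 ^ m) (sym (+-identityʳ (prod< K (miss i x)))) ⟩
          1 * prod< K (miss i x) * 2 ^ m
            ≤⟨ prod<-blocks R K (miss i x) size c miss-c m 1 1 0 (>-nonZero⁻¹ R)
                 (≤-reflexive (cong (_+ 0) (+-identityʳ R))) c-big ⟩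
          1 * prod< K size                ≡⟨ +-identityʳ _ ⟩
          Z                               ∎

  -- Logarithms

  dyadic : ∀ n → 1 ≤ n → ∃ λ s → 2 ^ s ≤ n × n < 2 ^ suc s
  dyadic (suc zero) _ = 0 , ≤-refl , s≤s (s≤s z≤n)
  dyadic (suc (suc n)) _ with dyadic (suc n) z<s
  ... | s , lo , hi with suc (suc n) <? 2 ^ suc s
  ... | yes p = s , ≤-trans lo (n≤1+n _) , p
  ... | no p = suc s , ≮⇒≥ p , <-≤-trans (s<s hi) (≤-trans (s≤s (m≤m+n _ 0)) (+-monoˡ-≤ _ (m^n>0 2 (suc s))))

  log₂-unique : ∀ s n → 2 ^ s ≤ n → n < 2 ^ suc s → ⌊log₂ n ⌋ ≡ s
  log₂-unique zero (suc zero) lo hi = refl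
  log₂-unique zero (suc (suc n)) lo (s≤s (s≤s ()))
  log₂-unique (suc s) n lo hi = ≤-antisym upper lower
    where
    lower : suc s ≤ ⌊log₂ n ⌋
    lower = subst (_≤ ⌊log₂ n ⌋) (⌊log₂[2^n]⌋≡n (suc s)) (⌊log₂⌋-mono-≤ lo)
    half : ∀ m → ⌊ 2 * m /2⌋ ≡ m
    half m = trans (cong (λ t → ⌊ m + t /2⌋) (+-identityʳ m)) (sym (n≡⌊n+n/2⌋ m))
    lo′ : 2 ^ s ≤ ⌊ n /2⌋
    lo′ = subst (_≤ ⌊ n /2⌋) (half (2 ^ s)) (⌊n/2⌋-mono lo)
    hi′ : ⌊ n /2⌋ < 2 ^ suc s
    hi′ = *-cancelˡ-< 2 _ _ (≤-<-trans (≤-trans (≤-reflexive (cong (⌊ n /2⌋ +_) (+-identityʳ _)))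
      (≤-trans (+-monoʳ-≤ ⌊ n /2⌋ (⌊n/2⌋≤⌈n/2⌉ n)) (≤-reflexive (⌊n/2⌋+⌈n/2⌉≡n n)))) hi)
    upper : ⌊log₂ n ⌋ ≤ suc s
    upper = ≤-trans (m≤n+m∸n ⌊log₂ n ⌋ 1) (s≤s (≤-reflexive (trans (sym (⌊log₂⌊n/2⌋⌋≡⌊log₂n⌋∸1 n)) (log₂-unique s ⌊ n /2⌋ lo′ hi′))))

  log₂-bounds : ∀ n → 1 ≤ n → 2 ^ ⌊log₂ n ⌋ ≤ n × n < 2 ^ suc ⌊log₂ n ⌋
  log₂-bounds n 1≤n with dyadic n 1≤n
  ... | s , lo , hi rewrite log₂-unique s n lo hi = lo , hi

  n<2^n : ∀ n → suc n ≤ 2 ^ n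
  n<2^n zero = ≤-refl
  n<2^n (suc n) = ≤-trans (+-mono-≤ (m^n>0 2 n) (n<2^n n)) (+-monoʳ-≤ (2 ^ n) (m≤m+n (2 ^ n) 0))

  c*[1+n]²≤2^n : ∀ c T₀ → 2 ≤ T₀ → c * (suc T₀ * suc T₀) ≤ 2 ^ T₀ → ∀ T → T₀ ≤ T → c * (suc T * suc T) ≤ 2 ^ T
  c*[1+n]²≤2^n c T₀ 2≤T₀ base T T₀≤T with m≤n⇒∃[o]m+o≡n T₀≤T
  ... | u , refl = go u
    where
    e : ∀ T → suc (suc T) * suc (suc T) + T * T + 0 ≡ 2 * (suc T * suc T) + 2 * 1
    e = solve-∀
    swap : ∀ c x → c * (2 * x) ≡ 2 * (c * x)
    swap = solve-∀
    go : ∀ u → c * (suc (T₀ + u) * suc (T₀ + u)) ≤ 2 ^ (T₀ + u)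
    go zero rewrite +-identityʳ T₀ = base
    go (suc u) rewrite +-suc T₀ u = begin
      c * (suc (suc t) * suc (suc t))  ≤⟨ *-monoʳ-≤ c (by-≤ 0 (*-mono-≤ 2≤t (≤-trans (s≤s z≤n) 2≤t)) (e t)) ⟩
      c * (2 * (suc t * suc t))        ≡⟨ swap c (suc t * suc t) ⟩
      2 * (c * (suc t * suc t))        ≤⟨ *-monoʳ-≤ 2 (go u) ⟩
      2 * 2 ^ t                        ∎
      where
      open ≤-Reasoning
      t = T₀ + u
      2≤t : 2 ≤ t
      2≤t = ≤-trans 2≤T₀ (m≤m+n T₀ u)

  -- Vertices are assigned to layers k, k - 1, …, 1 in consecutive intervals; layer 0 is the remainder.
  layerOf : (ℕ → ℕ) → ℕ → ℕ → ℕ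
  layerOf sz zero x = 0
  layerOf sz (suc j) x = if x <ᵇ sz (suc j) then suc j else layerOf sz j (x ∸ sz (suc j))

  -- With an indicator for `g` this yields both the sizes of the layers and the sizes of their
  -- tails.
  sum<-layerOf : ∀ sz k r (g : ℕ → ℕ) → sum< (sum< k (sz ∘ suc) + r) (λ x → g (layerOf sz k x))
    ≡ sum< k (λ j → sz (suc j) * g (suc j)) + r * g 0
  sum<-layerOf sz zero r g = sum<-const r (g 0)
  sum<-layerOf sz (suc k) r g = begin
    sum< (sum< (suc k) (sz ∘ suc) + r) G
      ≡⟨ cong (λ t → sum< t G) (trans (cong (_+ r) (sum<-last k (sz ∘ suc))) (rot (sum< k (sz ∘ suc)) s r)) ⟩
    sum< (s + (sum< k (sz ∘ suc) + r)) G
      ≡⟨ sum<-split s (sum< k (sz ∘ suc) + r) G ⟩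
    sum< s G + sum< (sum< k (sz ∘ suc) + r) (λ i → G (s + i))
      ≡⟨ cong₂ _+_ (trans (sum<-cong s inside) (sum<-const s (g (suc k))))
                   (sum<-cong (sum< k (sz ∘ suc) + r) (λ i _ → outside i)) ⟩
    s * g (suc k) + sum< (sum< k (sz ∘ suc) + r) (λ x → g (layerOf sz k x))
      ≡⟨ cong (s * g (suc k) +_) (sum<-layerOf sz k r g) ⟩
    s * g (suc k) + (sum< k f + r * g 0)
      ≡⟨ sym (rot (sum< k f) (s * g (suc k)) (r * g 0)) ⟩
    sum< k f + s * g (suc k) + r * g 0
      ≡⟨ cong (_+ r * g 0) (sym (sum<-last k f)) ⟩
    sum< (suc k) f + r * g 0 ∎
    where
    open ≡-Reasoning
    s = sz (suc k)
    G = λ x → g (layerOf sz (suc k) x)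
    f = λ j → sz (suc j) * g (suc j)
    rot : ∀ a b c → a + b + c ≡ b + (a + c)
    rot = solve-∀
    inside : ∀ i → i < s → G i ≡ g (suc k)
    inside i i<s rewrite T⇒≡ (<⇒<ᵇ i<s) = refl
    outside : ∀ i → G (s + i) ≡ g (layerOf sz k i)
    outside i with s + i <ᵇ s in eq
    ... | true = ⊥-elim (<⇒≱ (<ᵇ⇒< (s + i) s (≡⇒T eq)) (m≤m+n s i))
    ... | false = cong (λ t → g (layerOf sz k t)) (m+n∸m≡n s i)

  sum<-select : ∀ k (f : ℕ → ℕ) i → i < k → sum< k (λ j → f j * ⟦ j ≡ᵇ i ⟧) ≡ f i
  sum<-select (suc k) f zero _ = trans (cong₂ _+_ (*-identityʳ (f 0))
    (trans (sum<-cong k (λ j _ → *-zeroʳ (f (suc j)))) (trans (sum<-const k 0) (*-zeroʳ k)))) (+-identityʳ (f 0))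
  sum<-select (suc k) f (suc i) (s≤s p) = trans (cong (_+ sum< k (λ j → f (suc j) * ⟦ j ≡ᵇ i ⟧)) (*-zeroʳ (f 0)))
    (sum<-select k (f ∘ suc) i p)

  -- A geometric series without division. The induction keeps one extra copy of the last term, which
  -- pays for the next term together with its own extra copy.
  sum<-halving : ∀ k i (f : ℕ → ℕ) → i < k → (∀ j → suc j < k → 2 * f (suc j) ≤ f j) →
    sum< k (λ j → f j * ⟦ i <ᵇ suc j ⟧) ≤ 2 * f i
  sum<-halving k i f i<k half with m≤n⇒∃[o]m+o≡n i<k
  ... | o , refl = ≤-trans (m≤m+n _ (f (i + o))) (go o ≤-refl)
    where
    F = λ j → f j * ⟦ i <ᵇ suc j ⟧
    zeros : ∀ r → r ≤ i → sum< r F ≡ 0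
    zeros zero _ = refl
    zeros (suc r) r<i rewrite sum<-last r F | zeros r (<⇒≤ r<i) with i <ᵇ suc r in eq
    ... | true = ⊥-elim (<⇒≱ (<ᵇ⇒< i (suc r) (≡⇒T eq)) r<i)
    ... | false = *-zeroʳ (f r)
    last≤ : ∀ r → F r ≤ f r
    last≤ r = ≤-trans (*-monoʳ-≤ (f r) (⟦⟧≤1 _)) (≤-reflexive (*-identityʳ (f r)))
    go : ∀ p → p ≤ o → sum< (suc i + p) F + f (i + p) ≤ 2 * f i
    go zero _ rewrite +-identityʳ i | sum<-last i F | zeros i ≤-refl = +-mono-≤ (last≤ i) (≤-reflexive (sym (+-identityʳ (f i))))
    go (suc p) p<o = begin
      sum< (suc i + suc p) F + f (i + suc p)
        ≡⟨ cong₂ (λ a b → sum< a F + f b) (+-suc (suc i) p) (+-suc i p) ⟩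
      sum< (suc (suc i + p)) F + f (suc (i + p))
        ≡⟨ cong (_+ f (suc (i + p))) (sum<-last (suc i + p) F) ⟩
      sum< (suc i + p) F + F (suc i + p) + f (suc (i + p))
        ≤⟨ +-monoˡ-≤ _ (+-monoʳ-≤ (sum< (suc i + p) F) (last≤ (suc i + p))) ⟩
      sum< (suc i + p) F + f (suc (i + p)) + f (suc (i + p))
        ≡⟨ dbl (sum< (suc i + p) F) (f (suc (i + p))) ⟩
      sum< (suc i + p) F + 2 * f (suc (i + p))
        ≤⟨ +-monoʳ-≤ (sum< (suc i + p) F) (half (i + p) (s≤s (≤-trans (≤-reflexive (sym (+-suc i p))) (+-monoʳ-≤ i p<o)))) ⟩
      sum< (suc i + p) F + f (i + p)
        ≤⟨ go p (<⇒≤ p<o) ⟩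
      2 * f i ∎
      where
      open ≤-Reasoning
      dbl : ∀ a b → a + b + b ≡ a + 2 * b
      dbl = solve-∀

  -- The exponents in the Chernoff bound at scale s, where Λ - s = 4 q + r and q = g + r + 5 D′ + 8 + K.
  sparse-params : ∀ Λ T s D′ K → 8 * T ≤ Λ → s + 4 * (16 * D′) ≤ Λ + 4 → 13 + K ≤ 3 * D′ →
    ∃ λ g → ∃ λ r → Λ ≡ s + (r + (r + 5 * D′ + 8 + K + g) * 4) × T ≤ g * 2 ^ s
  sparse-params Λ T s D′ K 8T≤ s≤ K≤ with m≤n⇒∃[o]m+o≡n s≤Λ
    where
    s≤Λ : s ≤ Λ
    s≤Λ = +-cancelʳ-≤ 4 s Λ (≤-trans (+-monoʳ-≤ s (≤-trans (≤-trans (m≤m+n 4 (9 + K)) K≤)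
      (*-mono-≤ (n≤1+n 3) (m≤n*m D′ 16)))) s≤)
  ... | t , refl = found (m≤n⇒∃[o]m+o≡n X≤q)
    where
    q = t / 4
    r = t % 4
    X = r + 5 * D′ + 8 + K
    r≤3 : r ≤ 3
    r≤3 = s≤s⁻¹ (m%n<n t 4)
    t≡ : t ≡ r + q * 4
    t≡ = m≡m%n+[m/n]*n t 4
    -- The offset 4 and the remainder `r ≤ 3` together cost less than 8 = 4 * 2.
    q-big : 16 * D′ < q + 2
    q-big = *-cancelˡ-< 4 (16 * D′) (q + 2) (by-≤ 0 (+-mono-≤ s≤′ r≤3) (e s r q (4 * (16 * D′))))
      where
      s≤′ : s + 4 * (16 * D′) ≤ s + (r + q * 4) + 4
      s≤′ = subst (λ z → s + 4 * (16 * D′) ≤ s + z + 4) t≡ s≤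
      e : ∀ s r q D → suc D + (s + (r + q * 4) + 4 + 3) + 0 ≡ 4 * (q + 2) + (s + D + r)
      e = solve-∀
    X≤q : X ≤ q
    X≤q = by-≤ (1 + 8 * D′) (+-mono-≤ (+-mono-≤ q-big r≤3) K≤) (e r D′ K q)
      where
      e : ∀ r D′ K q → r + 5 * D′ + 8 + K + (q + 2 + 3 + 3 * D′) + (1 + 8 * D′) ≡ q + (suc (16 * D′) + r + (13 + K))
      e = solve-∀
    found : (∃ λ g → X + g ≡ q) → ∃ λ g → ∃ λ r → s + t ≡ s + (r + (r + 5 * D′ + 8 + K + g) * 4) × T ≤ g * 2 ^ s
    found (g , X+g≡q) = g , r , cong (s +_) (trans t≡ (cong (λ z → r + z * 4) (sym X+g≡q))) , T≤
      where
      open ≤-Reasoning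
      8g≥t : t ≤ 8 * g
      8g≥t = subst (_≤ 8 * g) (sym t≡) (by-≤ 9 (+-mono-≤ (+-mono-≤ (+-mono-≤ (*-monoʳ-≤ 4 q-big) (*-monoʳ-≤ 9 r≤3)) (*-monoʳ-≤ 8 K≤)) (*-monoʳ-≤ 8 (≤-reflexive (sym X+g≡q)))) (e r D′ K q g))
        where
        e : ∀ r D′ K q g → r + q * 4 + (4 * (q + 2) + 9 * 3 + 8 * (3 * D′) + 8 * (r + 5 * D′ + 8 + K + g)) + 9
          ≡ 8 * g + (4 * suc (16 * D′) + 9 * r + 8 * (13 + K) + 8 * q)
        e = solve-∀
      1≤g : 1 ≤ g
      1≤g = by-≤ (8 * D′) (+-mono-≤ (+-mono-≤ (+-mono-≤ q-big r≤3) K≤) (≤-reflexive (sym X+g≡q))) (e r D′ K q g)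
        where
        e : ∀ r D′ K q g → 1 + (q + 2 + 3 + 3 * D′ + (r + 5 * D′ + 8 + K + g)) + 8 * D′ ≡ g + (suc (16 * D′) + r + (13 + K) + q)
        e = solve-∀
      T≤ : T ≤ g * 2 ^ s
      -- Small scales rely on `g` and large ones on 2 ^ s: from t ≤ 8 g and 1 ≤ g follows s + t ≤ 8
      -- g (s + 1), and s + 1 ≤ 2 ^ s.
      T≤ = *-cancelˡ-≤ 8 (begin
        8 * T            ≤⟨ 8T≤ ⟩
        s + t            ≤⟨ +-mono-≤ (≤-trans (≤-trans (≤-reflexive (sym (+-identityʳ s))) (*-monoˡ-≤ s 1≤g)) (m≤n*m (g * s) 8)) 8g≥t ⟩
        8 * (g * s) + 8 * g  ≡⟨ e g s ⟩
        8 * (g * suc s)  ≤⟨ *-monoʳ-≤ 8 (*-monoʳ-≤ g (n<2^n s)) ⟩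
        8 * (g * 2 ^ s)  ∎)
        where
        e : ∀ g s → 8 * (g * s) + 8 * g ≡ 8 * (g * suc s)
        e = solve-∀

  sum<-*-≤ : ∀ N f c t → (∀ i → i < N → f i * c ≤ t) → sum< N f * c ≤ N * t
  sum<-*-≤ zero f c t h = z≤n
  sum<-*-≤ (suc N) f c t h = ≤-trans (≤-reflexive (*-distribʳ-+ c (f 0) _))
    (+-mono-≤ (h 0 z<s) (sum<-*-≤ N (f ∘ suc) c t (λ i p → h (suc i) (s<s p))))

  -- Concrete layer sizes and the probability of each bad event.

  module Construction (k b Λ n : ℕ) (2≤k : 2 ≤ k) (2≤b : 2 ≤ b) (b≤k : b ≤ k) (k≤2^b : k ≤ 2 ^ b)
    (large : 2 * 16 ^ (k + k) ≤ Λ) (n≥ : 2 ^ Λ ≤ n) (n< : n < 2 ^ suc Λ) where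

    -- `l j` is the binary logarithm of the size of layer `j`, and `A j` is the fraction 2 ^ (- b)
    -- of that size. With the offset `k` in the exponent every `D j` exceeds `16 * k`.
    D l sz A : ℕ → ℕ
    D j = 16 ^ (k + j)
    l j = Λ ∸ D j
    sz j = 2 ^ l j
    A j = 2 ^ (l j ∸ b)

    -- Each bad event is shown to have probability at most 2 ^ (- τ). A fixed fraction of `Λ` is far
    -- more than the logarithm of the number of events, and still below every `l j`.
    m τ : ℕ
    m = suc b
    τ = Λ / 8

    D-suc : ∀ j → D (suc j) ≡ 16 * D j
    D-suc j = cong (16 ^_) (+-suc k j)

    2D≤Λ : ∀ j → j ≤ k → 2 * D j ≤ Λ
    2D≤Λ j j≤k = ≤-trans (*-monoʳ-≤ 2 (^-monoʳ-≤ 16 (+-monoʳ-≤ k j≤k))) large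

    D≤Λ : ∀ j → j ≤ k → D j ≤ Λ
    D≤Λ j j≤k = ≤-trans (m≤m+n (D j) _) (2D≤Λ j j≤k)

    l+D : ∀ j → j ≤ k → l j + D j ≡ Λ
    l+D j j≤k = m∸n+n≡m (D≤Λ j j≤k)

    D′ : ℕ → ℕ
    D′ j = 4 * 16 ^ (pred k + j)

    D≡4D′ : ∀ j → D j ≡ 4 * D′ j
    D≡4D′ j = trans (cong (λ t → 16 ^ (t + j)) (sym (suc-pred k {{>-nonZero (≤-trans (s≤s z≤n) 2≤k)}}))) (*-assoc 4 4 (16 ^ (pred k + j)))

    k≤16^ : ∀ j → k ≤ 16 ^ (pred k + j)
    k≤16^ j = ≤-trans (≤-reflexive (sym (suc-pred k {{>-nonZero (≤-trans (s≤s z≤n) 2≤k)}})))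
      (≤-trans (n<2^n (pred k)) (≤-trans (^-monoˡ-≤ (pred k) (m≤m+n 2 14)) (^-monoʳ-≤ 16 (m≤m+n (pred k) j))))

    16≤16^ : ∀ j → 16 ≤ 16 ^ (pred k + j)
    16≤16^ j = ^-monoʳ-≤ 16 {1} (≤-trans (pred-mono-≤ 2≤k) (m≤m+n (pred k) j))

    K≤3D′ : ∀ j → 13 + suc k ≤ 3 * D′ j
    K≤3D′ j = begin
      13 + suc k                         ≤⟨ by-≤ 2 (+-mono-≤ (k≤16^ j) (16≤16^ j)) (e k (16 ^ (pred k + j))) ⟩
      2 * 16 ^ (pred k + j)              ≤⟨ *-monoˡ-≤ (16 ^ (pred k + j)) (m≤m+n 2 10) ⟩
      12 * 16 ^ (pred k + j)             ≡⟨ *-assoc 3 4 (16 ^ (pred k + j)) ⟩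
      3 * D′ j                           ∎
      where
      open ≤-Reasoning
      e : ∀ k P → 13 + suc k + (P + P) + 2 ≡ 2 * P + (k + 16)
      e = solve-∀

    16k≤D : ∀ j → 16 * k ≤ D j
    16k≤D j = ≤-trans (*-monoʳ-≤ 16 (k≤16^ j)) (≤-reflexive (sym (trans (D≡4D′ j) (sym (*-assoc 4 4 (16 ^ (pred k + j)))))))

    l-gap : ∀ j → j < k → l (suc j) + 15 * D j ≡ l j
    l-gap j j<k = +-cancelʳ-≡ (D j) _ _ (begin
      l (suc j) + 15 * D j + D j    ≡⟨ e (l (suc j)) (D j) ⟩
      l (suc j) + 16 * D j          ≡⟨ cong (l (suc j) +_) (sym (D-suc j)) ⟩
      l (suc j) + D (suc j)         ≡⟨ l+D (suc j) j<k ⟩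
      Λ                             ≡⟨ sym (l+D j (<⇒≤ j<k)) ⟩
      l j + D j                     ∎)
      where
      open ≡-Reasoning
      e : ∀ l D → l + 15 * D + D ≡ l + 16 * D
      e = solve-∀

    l-drop : ∀ j → j < k → l (suc j) + suc b ≤ l j
    l-drop j j<k = ≤-trans (+-monoʳ-≤ (l (suc j)) b<15D) (≤-reflexive (l-gap j j<k))
      where
      b<15D : suc b ≤ 15 * D j
      b<15D = begin
        suc b        ≤⟨ +-mono-≤ (≤-trans (s≤s z≤n) 2≤k) b≤k ⟩
        k + k        ≤⟨ +-monoʳ-≤ k (m≤m+n k (14 * k)) ⟩
        16 * k       ≤⟨ 16k≤D j ⟩
        D j          ≤⟨ m≤n*m (D j) 15 ⟩
        15 * D j     ∎
        where open ≤-Reasoning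

    l-anti : ∀ {i j} → i ≤ j → l j ≤ l i
    l-anti i≤j = ∸-monoʳ-≤ Λ (^-monoʳ-≤ 16 (+-monoʳ-≤ k i≤j))

    sz-half : ∀ j → suc j < k → 2 * sz (suc (suc j)) ≤ sz (suc j)
    sz-half j j<k = ^-monoʳ-≤ 2 (≤-trans (≤-trans (s≤s (m≤m+n _ b)) (≤-reflexive (sym (+-suc (l (suc (suc j))) b)))) (l-drop (suc j) j<k))

    8τ≤Λ : 8 * τ ≤ Λ
    8τ≤Λ = ≤-trans (≤-reflexive (*-comm 8 τ)) (m/n*n≤m Λ 8)

    Λ<8[1+τ] : Λ < 8 * suc τ
    Λ<8[1+τ] = begin-strict
      Λ                ≡⟨ m≡m%n+[m/n]*n Λ 8 ⟩
      Λ % 8 + τ * 8    <⟨ +-monoˡ-< (τ * 8) (m%n<n Λ 8) ⟩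
      8 + τ * 8        ≡⟨ *-comm (suc τ) 8 ⟩
      8 * suc τ        ∎
      where open ≤-Reasoning

    τ+b≤l : ∀ j → j ≤ k → τ + b ≤ l j
    τ+b≤l j j≤k = *-cancelˡ-≤ 8 (by-≤ (2 * Λ) (+-mono-≤ (+-mono-≤ (+-mono-≤ 8τ≤Λ (*-monoʳ-≤ 8 b≤k)) (≤-trans (≤-trans (*-monoˡ-≤ k (m≤m+n 8 8)) (16k≤D j)) (D≤Λ j j≤k)))
        (+-mono-≤ (*-monoʳ-≤ 4 (2D≤Λ j j≤k)) (*-monoʳ-≤ 8 (≤-reflexive (sym (l+D j j≤k)))))) (e τ b k Λ (l j) (D j)))
      where
      e : ∀ τ b k Λ l D → 8 * (τ + b) + (Λ + 8 * k + Λ + (4 * Λ + 8 * (l + D))) + 2 * Λ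
        ≡ 8 * l + (8 * τ + 8 * b + 8 * k + (4 * (2 * D) + 8 * Λ))
      e = solve-∀

    k≤Λ : k ≤ Λ
    k≤Λ = ≤-trans (≤-trans (m≤n*m k 16) (16k≤D k)) (D≤Λ k ≤-refl)

    -- A layer has `l + 5` scales and one event about heavy sets, at most Λ + 6 events in all. Both
    -- factors are bounded linearly in `suc τ`, so a quadratic is compared with 2 ^ τ, starting from
    -- τ = 20.
    few-events : k * (Λ + 6) < 2 ^ τ
    few-events = begin-strict
      k * (Λ + 6)                    ≤⟨ *-monoʳ-≤ k Λ+6≤ ⟩
      k * (16 * suc τ)               <⟨ *-monoˡ-< (16 * suc τ) (≤-<-trans k≤Λ Λ<8[1+τ]) ⟩
      8 * suc τ * (16 * suc τ)       ≡⟨ e (suc τ) 8 16 ⟩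
      128 * (suc τ * suc τ)          ≤⟨ c*[1+n]²≤2^n 128 20 (s≤s (s≤s z≤n)) (≤ᵇ⇒≤ (128 * (21 * 21)) (2 ^ 20) tt) τ 20≤τ ⟩
      2 ^ τ                          ∎
      where
      open ≤-Reasoning
      e : ∀ t a b → a * t * (b * t) ≡ a * b * (t * t)
      e = solve-∀
      Λ+6≤ : Λ + 6 ≤ 16 * suc τ
      Λ+6≤ = ≤-trans (+-mono-≤ (<⇒≤ Λ<8[1+τ]) (≤-trans (m≤m+n 6 2) (m≤m*n 8 (suc τ)))) (≤-reflexive (sym (*-distribʳ-+ (suc τ) 8 8)))
      160≤Λ : 160 ≤ Λ
      160≤Λ = ≤-trans (≤ᵇ⇒≤ 160 (2 * 16 ^ 4) tt) (≤-trans (*-monoʳ-≤ 2 (^-monoʳ-≤ 16 (+-mono-≤ 2≤k 2≤k))) large)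
      20≤τ : 20 ≤ τ
      20≤τ = /-monoˡ-≤ 8 160≤Λ

    S r : ℕ
    S = sum< k (sz ∘ suc)
    r = n ∸ S

    S<n : S < n
    S<n = <-≤-trans (≤-<-trans S≤ (^-monoʳ-< 2 (s≤s (s≤s z≤n)) 1+l<Λ)) n≥
      where
      S≤ : S ≤ 2 ^ suc (l 1)
      S≤ = ≤-trans (≤-reflexive (sum<-cong k (λ j _ → sym (*-identityʳ (sz (suc j))))))
        (sum<-halving k 0 (sz ∘ suc) (≤-trans (s≤s z≤n) 2≤k) sz-half)
      1+l<Λ : suc (l 1) < Λ
      1+l<Λ = ≤-trans (≤-reflexive (+-comm 2 (l 1))) (≤-trans (+-monoʳ-≤ (l 1) (≤-trans 2≤k (≤-trans (m≤n*m k 16) (16k≤D 1)))) (≤-reflexive (l+D 1 (≤-trans (s≤s z≤n) 2≤k))))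

    n≡S+r : n ≡ S + r
    n≡S+r = sym (m+[n∸m]≡n (<⇒≤ S<n))

    lay : ℕ → ℕ
    lay = layerOf sz k

    open RandomLayers n (suc k) lay public
    open IndependentSets n k lay using (independent-bound)

    sum<-lay : ∀ g → sum< n (g ∘ lay) ≡ sum< k (λ j → sz (suc j) * g (suc j)) + r * g 0
    sum<-lay g = trans (cong (λ t → sum< t (g ∘ lay)) n≡S+r) (sum<-layerOf sz k r g)

    size≡ : ∀ j → j < k → size (suc j) ≡ sz (suc j)
    size≡ j j<k = trans (sum<-lay (λ y → ⟦ y ≡ᵇ suc j ⟧)) (trans (cong (sum< k (λ i → sz (suc i) * ⟦ i ≡ᵇ j ⟧) +_) (*-zeroʳ r))
      (trans (+-identityʳ _) (sum<-select k (sz ∘ suc) j j<k)))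

    -- Layer 0 is a factor of `Z` like the others, so the remainder `r` has to be positive for
    -- `total` to be.
    size-pos : ∀ j → j < suc k → 0 < size j
    size-pos zero _ = ≤-trans (m<n⇒0<n∸m S<n) (≤-trans (≤-trans (≤-reflexive (sym (*-identityʳ r))) (m≤n+m (r * 1) (sum< k (λ j → sz (suc j) * 0))))
      (≤-reflexive (sym (sum<-lay (λ y → ⟦ y ≡ᵇ 0 ⟧)))))
    size-pos (suc j) (s≤s j<k) = subst (0 <_) (sym (size≡ j j<k)) (m^n>0 2 (l (suc j)))

    total-pos : 0 < total
    total-pos = m^n>0 Z {{>-nonZero (prod<-pos (suc k) size size-pos)}} n

    tail≤ : ∀ i → i < k → tail i ≤ 2 * sz (suc i)
    tail≤ i i<k = ≤-trans (≤-reflexive (trans (sum<-lay (λ y → ⟦ i <ᵇ y ⟧)) (trans (cong (sum< k (λ j → sz (suc j) * ⟦ i <ᵇ suc j ⟧) +_) (*-zeroʳ r)) (+-identityʳ _))))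
      (sum<-halving k i (sz ∘ suc) i<k sz-half)

    tail-k : tail k ≡ 0
    tail-k = trans (sum<-lay (λ y → ⟦ k <ᵇ y ⟧)) (trans (cong (sum< k (λ j → sz (suc j) * ⟦ k <ᵇ suc j ⟧) +_) (*-zeroʳ r)) (trans (+-identityʳ _)
      (trans (sum<-cong k zeros) (trans (sum<-const k 0) (*-zeroʳ k)))))
      where
      zeros : ∀ j → j < k → sz (suc j) * ⟦ k <ᵇ suc j ⟧ ≡ 0
      zeros j j<k with k <ᵇ suc j in eq
      ... | true = ⊥-elim (<⇒≱ j<k (s≤s⁻¹ (<ᵇ⇒< k (suc j) (≡⇒T eq))))
      ... | false = *-zeroʳ (sz (suc j))

    dense-unlikely : ∀ i s → i < k → s < l (suc i) + 5 →
      sumL (subsets n) (λ x → ⟦ scale s x ⟧ * sumL Ω (λ ω → ⟦ dense (suc i) x ω ⟧)) * 2 ^ τ ≤ total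
    dense-unlikely i s i<k s< = finish (sparse-params Λ τ s (D′ i) (suc k) 8τ≤Λ s+D≤ (K≤3D′ i))
      where
      N = sumL (subsets n) (λ x → ⟦ scale s x ⟧ * sumL Ω (λ ω → ⟦ dense (suc i) x ω ⟧))
      s+D≤ : s + 4 * (16 * D′ i) ≤ Λ + 4
      s+D≤ = begin
        s + 4 * (16 * D′ i)        ≤⟨ +-monoˡ-≤ _ (s≤s⁻¹ (≤-trans s< (≤-reflexive (+-suc (l (suc i)) 4)))) ⟩
        l (suc i) + 4 + 4 * (16 * D′ i) ≡⟨ e (l (suc i)) 4 16 (D′ i) ⟩
        l (suc i) + 16 * (4 * D′ i) + 4 ≡⟨ cong (λ t → l (suc i) + 16 * t + 4) (sym (D≡4D′ i)) ⟩
        l (suc i) + 16 * D i + 4        ≡⟨ cong (λ t → l (suc i) + t + 4) (sym (D-suc i)) ⟩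
        l (suc i) + D (suc i) + 4       ≡⟨ cong (_+ 4) (l+D (suc i) i<k) ⟩
        Λ + 4                           ∎
        where
        open ≤-Reasoning
        e : ∀ l a c d → l + a + a * (c * d) ≡ l + c * (a * d) + a
        e = solve-∀
      finish : (∃ λ g → ∃ λ r → Λ ≡ s + (r + (r + 5 * D′ i + 8 + suc k + g) * 4) × τ ≤ g * 2 ^ s) → N * 2 ^ τ ≤ total
      finish (g , r , Λ≡ , τ≤) = ≤-trans (*-monoʳ-≤ N (^-monoʳ-≤ 2 τ≤)) (dense-rare (suc i) s a targets μ g n≤ 5a≡)
        where
        -- With q = (Λ - s) / 4 rounded down this is q - D′ i - 1. Then 4 a + s + 1 = l i - (3 + r),
        -- so that even layer `i`, the smallest possible target, satisfies the moment condition. The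
        -- value of `μ` is Λ - s + 1, because n < 2 ^ (Λ + 1).
        a = g + (r + 4 * D′ i + 7 + suc k)
        μ = suc (r + (r + 5 * D′ i + 8 + suc k + g) * 4)
        5a≡ : 5 * a ≡ suc k + μ + (2 + g)
        5a≡ = e g r (D′ i) (suc k)
          where
          e : ∀ g r d K → 5 * (g + (r + 4 * d + 7 + K)) ≡ K + suc (r + (r + 5 * d + 8 + K + g) * 4) + (2 + g)
          e = solve-∀
        n≤ : n ≤ 2 ^ μ * 2 ^ s
        n≤ = ≤-trans (<⇒≤ n<) (≤-reflexive (trans (cong (λ t → 2 ^ suc t) (trans Λ≡ (+-comm s _))) (^-distribˡ-+-* 2 μ s)))
        targets : ∀ j → 1 ≤ j → j < suc i → 2 ^ (4 * a + suc s) ≤ size j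
        targets (suc j) _ (s≤s j<i) = ≤-trans (^-monoʳ-≤ 2 (≤-trans exponent (l-anti j<i))) (≤-reflexive (sym (size≡ j (<-trans j<i i<k))))
          where
          exponent : 4 * a + suc s ≤ l i
          exponent = +-cancelʳ-≤ (4 * D′ i) _ _ (begin
            4 * a + suc s + 4 * D′ i              ≤⟨ m≤m+n _ (3 + r) ⟩
            4 * a + suc s + 4 * D′ i + (3 + r)    ≡⟨ e g r (D′ i) (suc k) s ⟩
            s + (r + (r + 5 * D′ i + 8 + suc k + g) * 4) ≡⟨ sym Λ≡ ⟩
            Λ                                     ≡⟨ sym (l+D i (<⇒≤ i<k)) ⟩
            l i + D i                             ≡⟨ cong (l i +_) (D≡4D′ i) ⟩
            l i + 4 * D′ i                        ∎)
            where
            open ≤-Reasoning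
            e : ∀ g r d K s → 4 * (g + (r + 4 * d + 7 + K)) + suc s + 4 * d + (3 + r) ≡ s + (r + (r + 5 * d + 8 + K + g) * 4)
            e = solve-∀

    -- The choice of the set costs 2 c = A₀ in layer `suc i` and at most A₀ in the tail, against a
    -- gain of m A₀ ≥ 3 A₀, where `2 ≤ b` enters. The A₀ left over is at least τ.
    heavy-unlikely : ∀ i → i < k →
      sumL (subsets n) (λ x → ⟦ heavy (suc i) (A (suc i)) (2 * m) x ⟧ * sumL Ω (missed (suc i) x)) * 2 ^ τ ≤ total
    heavy-unlikely i i<k = *-cancelʳ-≤ _ _ (2 ^ (A₀ + A₀)) {{m^n≢0 2 (A₀ + A₀)}} (begin
      N * 2 ^ τ * 2 ^ (A₀ + A₀)     ≡⟨ *-assoc N _ _ ⟩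
      N * (2 ^ τ * 2 ^ (A₀ + A₀))   ≡⟨ cong (N *_) (sym (^-distribˡ-+-* 2 τ (A₀ + A₀))) ⟩
      N * 2 ^ (τ + (A₀ + A₀))       ≤⟨ *-monoʳ-≤ N (^-monoʳ-≤ 2 τ+2A≤) ⟩
      N * 2 ^ (m * A₀)              ≤⟨ heavy-rare (suc i) A₀ m c size≤ ⟩
      total * 2 ^ (2 * c + tail (suc i)) ≤⟨ *-monoʳ-≤ total (^-monoʳ-≤ 2 (+-mono-≤ (≤-reflexive 2c≡A) tail≤A)) ⟩
      total * 2 ^ (A₀ + A₀)         ∎)
      where
      open ≤-Reasoning
      A₀ = A (suc i)
      N = sumL (subsets n) (λ x → ⟦ heavy (suc i) A₀ (2 * m) x ⟧ * sumL Ω (missed (suc i) x))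
      c = 2 ^ (l (suc i) ∸ m)
      m≤l : m ≤ l (suc i)
      m≤l = ≤-trans (+-monoˡ-≤ b (≤-trans (s≤s z≤n) 1≤τ)) (τ+b≤l (suc i) i<k)
        where
        1≤τ : 1 ≤ τ
        1≤τ = >-nonZero⁻¹ τ {{≢-nonZero (λ T≡0 → <⇒≱ few-events (subst (λ t → 2 ^ t ≤ k * (Λ + 6)) (sym T≡0)
          (*-mono-≤ (≤-trans (s≤s z≤n) 2≤k) (≤-trans (s≤s z≤n) (m≤n+m 6 Λ)))))}}
      size≤ : size (suc i) ≤ 2 ^ m * c
      size≤ = ≤-reflexive (trans (size≡ i i<k) (trans (cong (2 ^_) (sym (m+[n∸m]≡n m≤l))) (^-distribˡ-+-* 2 m (l (suc i) ∸ m))))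
      2c≡A : 2 * c ≡ A₀
      2c≡A = cong (2 ^_) (sym (trans (cong (_∸ b) (sym (m+[n∸m]≡n m≤l))) (trans (cong (_∸ b) (sym (+-suc b _))) (m+n∸m≡n b _))))
      τ≤A : τ ≤ A₀
      τ≤A = ≤-trans (m+n≤o⇒m≤o∸n τ (τ+b≤l (suc i) i<k)) (≤-trans (n≤1+n _) (n<2^n (l (suc i) ∸ b)))
      τ+2A≤ : τ + (A₀ + A₀) ≤ m * A₀
      τ+2A≤ = ≤-trans (+-monoˡ-≤ (A₀ + A₀) τ≤A) (≤-trans (≤-reflexive (e A₀)) (*-monoˡ-≤ A₀ (s≤s 2≤b)))
        where
        e : ∀ a → a + (a + a) ≡ 3 * a
        e = solve-∀
      tail≤A : tail (suc i) ≤ A₀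
      tail≤A = cases (suc i <? k)
        where
        cases : Dec (suc i < k) → tail (suc i) ≤ A₀
        cases (yes p) = ≤-trans (tail≤ (suc i) p) (^-monoʳ-≤ 2 (m+n≤o⇒m≤o∸n (suc (l (suc (suc i))))
                      (≤-trans (≤-reflexive (sym (+-suc (l (suc (suc i))) b))) (l-drop (suc i) p))))
        cases (no p) = ≤-trans (≤-reflexive (trans (cong tail (≤-antisym i<k (≮⇒≥ p))) tail-k)) z≤n

    -- First moment over all bad events.

    bad-dense : (ℕ → ℕ → ℕ) → ℕ → ℕ → ℕ
    bad-dense ω i s = sumL (subsets n) (λ x → ⟦ scale s x ⟧ * ⟦ dense (suc i) x ω ⟧)

    bad-heavy : (ℕ → ℕ → ℕ) → ℕ → ℕ
    bad-heavy ω i = sumL (subsets n) (λ x → ⟦ heavy (suc i) (A (suc i)) (2 * m) x ⟧ * missed (suc i) x ω)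

    bad : (ℕ → ℕ → ℕ) → ℕ → ℕ
    bad ω i = sum< (l (suc i) + 5) (bad-dense ω i) + bad-heavy ω i

    sumL-Ω-subsets : ∀ (c : (ℕ → Bool) → ℕ) (d : (ℕ → Bool) → (ℕ → ℕ → ℕ) → ℕ) →
      sumL Ω (λ ω → sumL (subsets n) (λ x → c x * d x ω)) ≡ sumL (subsets n) (λ x → c x * sumL Ω (d x))
    sumL-Ω-subsets c d = trans (sumL-swap Ω (subsets n) (λ ω x → c x * d x ω)) (sumL-cong (subsets n) (λ x → sumL-* Ω (c x) (d x)))

    bad-unlikely : ∀ i → i < k → sumL Ω (λ ω → bad ω i) * 2 ^ τ ≤ (Λ + 6) * total
    bad-unlikely i i<k = begin
      sumL Ω (λ ω → bad ω i) * 2 ^ τ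
        ≡⟨ cong (_* 2 ^ τ) (trans (sumL-+ Ω _ _) (cong (_+ sumL Ω (λ ω → bad-heavy ω i)) (sumL-sum<-swap Ω (l (suc i) + 5) (λ ω → bad-dense ω i)))) ⟩
      (sum< (l (suc i) + 5) (λ s → sumL Ω (λ ω → bad-dense ω i s)) + sumL Ω (λ ω → bad-heavy ω i)) * 2 ^ τ
        ≡⟨ *-distribʳ-+ (2 ^ τ) (sum< (l (suc i) + 5) (λ s → sumL Ω (λ ω → bad-dense ω i s))) _ ⟩
      sum< (l (suc i) + 5) (λ s → sumL Ω (λ ω → bad-dense ω i s)) * 2 ^ τ + sumL Ω (λ ω → bad-heavy ω i) * 2 ^ τ
        ≤⟨ +-mono-≤
             (sum<-*-≤ (l (suc i) + 5) _ (2 ^ τ) total (λ s s< → ≤-trans (≤-reflexive (cong (_* 2 ^ τ)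
               (sumL-Ω-subsets (λ x → ⟦ scale s x ⟧) (λ x ω → ⟦ dense (suc i) x ω ⟧)))) (dense-unlikely i s i<k s<)))
             (≤-trans (≤-reflexive (cong (_* 2 ^ τ) (sumL-Ω-subsets (λ x → ⟦ heavy (suc i) (A (suc i)) (2 * m) x ⟧) (missed (suc i))))) (heavy-unlikely i i<k)) ⟩
      (l (suc i) + 5) * total + total
        ≡⟨ e (l (suc i)) total ⟩
      (l (suc i) + 6) * total
        ≤⟨ *-monoˡ-≤ total (+-monoˡ-≤ 6 (m∸n≤m Λ (D (suc i)))) ⟩
      (Λ + 6) * total ∎
      where
      open ≤-Reasoning
      e : ∀ l t → (l + 5) * t + t ≡ (l + 6) * t
      e = solve-∀

    -- The expected number of violations is at most k (Λ + 6) / 2 ^ τ, which is below 1.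
    outcome : ∃ λ ω → sum< k (bad ω) ≡ 0
    outcome = sumL-avg Ω (λ ω → sum< k (bad ω)) (subst (sumL Ω (λ ω → sum< k (bad ω)) <_) (sym sumL-Ω-1)
      (*-cancelʳ-< (2 ^ τ) _ _ (begin-strict
        sumL Ω (λ ω → sum< k (bad ω)) * 2 ^ τ
          ≡⟨ cong (_* 2 ^ τ) (sumL-sum<-swap Ω k bad) ⟩
        sum< k (λ i → sumL Ω (λ ω → bad ω i)) * 2 ^ τ
          ≤⟨ sum<-*-≤ k _ (2 ^ τ) ((Λ + 6) * total) bad-unlikely ⟩
        k * ((Λ + 6) * total)
          ≡⟨ sym (*-assoc k (Λ + 6) total) ⟩
        k * (Λ + 6) * total
          <⟨ *-monoˡ-< total {{>-nonZero total-pos}} few-events ⟩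
        2 ^ τ * total
          ≡⟨ *-comm (2 ^ τ) total ⟩
        total * 2 ^ τ ∎)))
      where open ≤-Reasoning

    -- The dual weights, uniform on each layer and scaled by 2 ^ Λ so that they are natural numbers;
    -- they vanish on layer 0.
    weightAt : ℕ → ℕ
    weightAt v = sum< k (λ j → 2 ^ D (suc j) * ⟦ lay v ≡ᵇ suc j ⟧)

    size*2^D : ∀ j → j < k → size (suc j) * 2 ^ D (suc j) ≡ 2 ^ Λ
    size*2^D j j<k = trans (cong (_* 2 ^ D (suc j)) (size≡ j j<k))
      (trans (sym (^-distribˡ-+-* 2 (l (suc j)) (D (suc j)))) (cong (2 ^_) (l+D (suc j) j<k)))

    weightAt-total : sum< n weightAt ≡ k * 2 ^ Λ
    weightAt-total = begin
      sum< n weightAt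
        ≡⟨ sum<-swap n k _ ⟩
      sum< k (λ j → sum< n (λ v → 2 ^ D (suc j) * ⟦ lay v ≡ᵇ suc j ⟧))
        ≡⟨ sum<-cong k (λ j j<k → trans (sum<-* n (2 ^ D (suc j)) _) (trans (*-comm (2 ^ D (suc j)) _) (size*2^D j j<k))) ⟩
      sum< k (λ _ → 2 ^ Λ)
        ≡⟨ sum<-const k (2 ^ Λ) ⟩
      k * 2 ^ Λ ∎
      where open ≡-Reasoning

    -- Properties of an outcome without violations.

    module _ (ω : ℕ → ℕ → ℕ) (not-bad : ∀ i → i < k → bad ω i ≡ 0) where

      Supported : (ℕ → Bool) → Set
      Supported x = ∀ v → n ≤ v → x v ≡ false

      -- The scale of a nonempty `x` is the dyadic interval containing its size, and the size
      -- hypothesis puts it among the scales covered by `bad`. The empty set has no scale and is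
      -- treated apart.
      sparse-subset : ∀ i → i < k → ∀ {x} → x ∈ subsets n → card x < 2 ^ (l (suc i) + 5) →
        4 * edges (suc i) x ω ≤ 5 * card x
      sparse-subset i i<k {x} x∈ small = cases (card x ≟ 0)
        where
        drop : ∀ a b → ⟦ a ∧ b ⟧ ≤ ⟦ a ⟧
        drop true b = ⟦⟧≤1 b
        drop false b = z≤n
        edges≤ : edges (suc i) x ω ≤ suc k * card x
        edges≤ = ≤-trans (sum<-mono n (λ v _ → ≤-trans (sum<-mono (suc k) (λ j _ → drop (x v) ((lay v <ᵇ j) ∧ (j <ᵇ suc i) ∧ x (ω v j)))) (≤-reflexive (sum<-const (suc k) ⟦ x v ⟧))))
          (≤-reflexive (sum<-* n (suc k) _))
        at-scale : ∀ s → 2 ^ s ≤ card x → card x < 2 ^ suc s → ∀ d → dense (suc i) x ω ≡ d → 4 * edges (suc i) x ω ≤ 5 * card x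
        at-scale s lo hi false dense≡ = ≮⇒≥ λ p → subst T dense≡ (<⇒<ᵇ p)
        at-scale s lo hi true dense≡ = ⊥-elim (1≢0 (trans (sym (cong₂ _*_ (⟦T⟧ inScale) (cong ⟦_⟧ dense≡))) term≡0))
          where
          1≢0 : 1 * 1 ≢ 0
          1≢0 ()
          s< : s < l (suc i) + 5
          s< = ≰⇒> λ p → <⇒≱ small (≤-trans (^-monoʳ-≤ 2 p) lo)
          inScale : T (scale s x)
          inScale = T-∧⁺ (≤⇒≤ᵇ lo) (<⇒<ᵇ hi)
          term≡0 : ⟦ scale s x ⟧ * ⟦ dense (suc i) x ω ⟧ ≡ 0
          term≡0 = sumL≡0 (subsets n) (λ x → ⟦ scale s x ⟧ * ⟦ dense (suc i) x ω ⟧)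
            (sum<≡0 (l (suc i) + 5) (bad-dense ω i) (m+n≡0⇒m≡0 _ (not-bad i i<k)) s s<) x∈
        cases : Dec (card x ≡ 0) → 4 * edges (suc i) x ω ≤ 5 * card x
        cases (yes card≡0) = ≤-trans (*-monoʳ-≤ 4 (≤-trans edges≤ (≤-reflexive (trans (cong (suc k *_) card≡0) (*-zeroʳ (suc k)))))) z≤n
        cases (no card≢0) = let s , lo , hi = dyadic (card x) (n≢0⇒n>0 card≢0) in at-scale s lo hi (dense (suc i) x ω) refl

      sparse : ∀ i → i < k → ∀ x → Supported x → card x < 2 ^ (l (suc i) + 5) → 4 * edges (suc i) x ω ≤ 5 * card x
      sparse i i<k x supp small = transfer (subsets-complete n x supp)
        where
        transfer : (∃ λ y → y ∈ subsets n × (∀ v → y v ≡ x v)) → 4 * edges (suc i) x ω ≤ 5 * card x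
        transfer (y , y∈ , y≗x) = subst₂ (λ e c → 4 * e ≤ 5 * c) edges≡ card≡
          (sparse-subset i i<k y∈ (subst (_< 2 ^ (l (suc i) + 5)) (sym card≡) small))
          where
          card≡ : card y ≡ card x
          card≡ = sum<-cong n (λ v _ → cong ⟦_⟧ (y≗x v))
          edges≡ : edges (suc i) y ω ≡ edges (suc i) x ω
          edges≡ = sum<-cong n (λ v _ → sum<-cong (suc k) (λ j _ →
            cong₂ (λ a b → ⟦ a ∧ (lay v <ᵇ j) ∧ (j <ᵇ suc i) ∧ b ⟧) (y≗x v) (y≗x (ω v j))))

      -- Heavy sets were excluded for the product bound 2 ^ (- 2 m), so `2 * m` is the value passed
      -- on. The threshold 2 ^ (Λ - b) satisfies `kB` because k ≤ 2 ^ b.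
      independent-light : ∀ x → Supported x → (∀ u v → T (x u) → T (x v) → ¬ T (arc ω u v)) →
        sum< n (λ v → ⟦ x v ⟧ * weightAt v) ≤ (2 * (2 * m) + 2) * 2 ^ Λ
      independent-light x supp indep = ≤-trans (≤-reflexive regroup)
        (independent-bound ω D A (2 ^ Λ) (2 ^ (Λ ∸ b)) (2 * m) {{m^n≢0 2 Λ}} sizes AB kB
          (λ i i<k x∈ → sumL≡0 (subsets n) _ (m+n≡0⇒n≡0 _ (not-bad i i<k)) x∈) x supp indep)
        where
        open ≡-Reasoning
        and : ∀ a b c → ⟦ a ⟧ * (c * ⟦ b ⟧) ≡ c * ⟦ a ∧ b ⟧
        and true b c = +-identityʳ _
        and false b c = sym (*-zeroʳ c)
        regroup : sum< n (λ v → ⟦ x v ⟧ * weightAt v) ≡ sum< k (λ j → at (suc j) x * 2 ^ D (suc j))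
        regroup = begin
          sum< n (λ v → ⟦ x v ⟧ * weightAt v)
            ≡⟨ sum<-cong n (λ v _ → trans (sym (sum<-* k ⟦ x v ⟧ _))
                 (sum<-cong k (λ j _ → and (x v) (lay v ≡ᵇ suc j) (2 ^ D (suc j))))) ⟩
          sum< n (λ v → sum< k (λ j → 2 ^ D (suc j) * ⟦ x v ∧ (lay v ≡ᵇ suc j) ⟧))
            ≡⟨ sum<-swap n k _ ⟩
          sum< k (λ j → sum< n (λ v → 2 ^ D (suc j) * ⟦ x v ∧ (lay v ≡ᵇ suc j) ⟧))
            ≡⟨ sum<-cong k (λ j _ → trans (sum<-* n (2 ^ D (suc j)) _) (*-comm (2 ^ D (suc j)) _)) ⟩
          sum< k (λ j → at (suc j) x * 2 ^ D (suc j)) ∎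
        sizes : ∀ j → 1 ≤ j → j ≤ k → size j * 2 ^ D j ≡ 2 ^ Λ
        sizes (suc j) _ j<k = size*2^D j j<k
        b≤l : ∀ j → j ≤ k → b ≤ l j
        b≤l j j≤k = ≤-trans (m≤n+m b τ) (τ+b≤l j j≤k)
        AB : ∀ j → 1 ≤ j → j ≤ k → A j * 2 ^ D j ≤ 2 ^ (Λ ∸ b)
        AB j _ j≤k = ≤-reflexive (trans (sym (^-distribˡ-+-* 2 (l j ∸ b) (D j))) (cong (2 ^_)
          (trans (sym (+-∸-comm (D j) (b≤l j j≤k))) (cong (_∸ b) (l+D j j≤k)))))
        kB : k * 2 ^ (Λ ∸ b) ≤ 2 ^ Λ
        kB = ≤-trans (*-monoˡ-≤ (2 ^ (Λ ∸ b)) k≤2^b) (≤-reflexive (trans (sym (^-distribˡ-+-* 2 b (Λ ∸ b)))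
          (cong (2 ^_) (m+[n∸m]≡n (≤-trans b≤k k≤Λ)))))

      no-regular : ∀ (E : ℕ → ℕ → Bool) (x : ℕ → Bool) → Supported x →
        (∀ u v → E u v ≡ E v u) → (∀ u v → T (E u v) → T (arc ω u v) ⊎ T (arc ω v u)) →
        (∀ u v → T (E u v) → T (x u)) → (∀ u → T (x u) → sum< n (λ v → ⟦ E u v ⟧) ≡ 4) →
        card x ≡ 0
      no-regular E x supp E-sym E-arc E-x deg = decidable-stable (card x ≟ 0) λ nonempty →
        descend (pred k) (≤-reflexive suc-pred-k)
          (subst (λ t → 12 * t < card x) (sym (trans (cong tail suc-pred-k) tail-k)) (n≢0⇒n>0 nonempty))
        where
        suc-pred-k : suc (pred k) ≡ k
        suc-pred-k = suc-pred k {{>-nonZero (≤-trans (s≤s z≤n) 2≤k)}}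
        module R i = Regular ω E x E-sym E-arc E-x deg i
        A⊆ : ∀ i i<K → card (R.A i i<K) ≤ card x
        A⊆ i i<K = sum<-mono n (λ v _ → drop (x v) (lay v <ᵇ i))
          where
          drop : ∀ a b → ⟦ a ∧ b ⟧ ≤ ⟦ a ⟧
          drop true b = ⟦⟧≤1 b
          drop false b = z≤n
        A-supp : ∀ i i<K → Supported (R.A i i<K)
        A-supp i i<K v n≤v = cong (_∧ (lay v <ᵇ i)) (supp v n≤v)
        small-case : ∀ i → i < k → card x < 2 ^ (l (suc i) + 5) → card x ≤ 12 * tail (suc i)
        small-case i i<k small = R.regular-bound (suc i) (s<s i<k)
          (sparse i i<k (R.A (suc i) (s<s i<k)) (A-supp (suc i) (s<s i<k)) (≤-<-trans (A⊆ (suc i) (s<s i<k)) small))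
        edges-1 : ∀ y → edges 1 y ω ≡ 0
        edges-1 y = trans (sum<-cong n {g = λ _ → 0} (λ v _ → trans (sum<-cong (suc k) {g = λ _ → 0} (λ j _ → cong ⟦_⟧ (none v j)))
            (trans (sum<-const (suc k) 0) (*-zeroʳ k)))) (trans (sum<-const n 0) (*-zeroʳ n))
          where
          none : ∀ v j → arcᵇ 1 y v j (ω v j) ≡ false
          none v zero = ∧-zeroʳ (y v)
          none v (suc j) = trans (cong (y v ∧_) (∧-zeroʳ (lay v <ᵇ suc j))) (∧-zeroʳ (y v))
        -- The invariant contradicts `regular-bound` at layer `suc i` as soon as sparsity holds
        -- there. It starts at layer `k`, whose tail is empty. A set too big for sparsity at layer i
        -- + 2 has at least 32 sz (i + 2) vertices, more than 24 sz (i + 2) ≥ 12 tail (i + 1); the 5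
        -- in the size bound is there because 2 ^ 5 > 24.
        descend : ∀ i → i < k → ¬ 12 * tail (suc i) < card x
        -- Only layer 0 precedes layer 1, so no arcs are counted and sparsity holds for sets of any
        -- size.
        descend zero 0<k many = <⇒≱ many (R.regular-bound 1 (s<s 0<k)
          (≤-trans (≤-reflexive (cong (4 *_) (edges-1 (R.A 1 (s<s 0<k))))) z≤n))
        descend (suc i) i<k many = cases (card x <? 2 ^ (l (suc (suc i)) + 5))
          where
          open ≤-Reasoning
          cases : Dec (card x < 2 ^ (l (suc (suc i)) + 5)) → ⊥
          cases (yes small) = <⇒≱ many (small-case (suc i) i<k small)
          cases (no big) = descend i (<-trans (n<1+n i) i<k) (begin-strict
            12 * tail (suc i)                ≤⟨ *-monoʳ-≤ 12 (tail≤ (suc i) i<k) ⟩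
            12 * (2 * sz (suc (suc i)))      ≡⟨ sym (*-assoc 12 2 (sz (suc (suc i)))) ⟩
            24 * sz (suc (suc i))            <⟨ *-monoˡ-< (sz (suc (suc i))) {{m^n≢0 2 (l (suc (suc i)))}} (m≤m+n 25 7) ⟩
            32 * sz (suc (suc i))            ≡⟨ *-comm 32 (sz (suc (suc i))) ⟩
            sz (suc (suc i)) * 2 ^ 5         ≡⟨ sym (^-distribˡ-+-* 2 (l (suc (suc i))) 5) ⟩
            2 ^ (l (suc (suc i)) + 5)        ≤⟨ ≮⇒≥ big ⟩
            card x                           ∎)

  -- Natural numbers as rationals

  toℚᵘ-/ : ∀ i d → ℚ.toℚᵘ (i ℚ./ suc d) ℚᵘ.≃ ℚᵘ.mkℚᵘ i d
  toℚᵘ-/ i d = ℚP.toℚᵘ-fromℚᵘ (ℚᵘ.mkℚᵘ i d)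

  ℕtoℚ-+ : ∀ a b → ℕtoℚ (a + b) ≡ ℕtoℚ a ℚ.+ ℕtoℚ b
  ℕtoℚ-+ a b = ℚP.toℚᵘ-injective (begin
    ℚ.toℚᵘ (ℕtoℚ (a + b))                     ≈⟨ toℚᵘ-/ (ℤ.+ (a + b)) 0 ⟩
    ℚᵘ.mkℚᵘ (ℤ.+ (a + b)) 0                      ≈⟨ ℚᵘ.*≡* (cong (ℤ._* ℤ.+ 1) (sym (cong₂ ℤ._+_ (ℤP.*-identityʳ (ℤ.+ a)) (ℤP.*-identityʳ (ℤ.+ b))))) ⟩
    ℚᵘ.mkℚᵘ (ℤ.+ a) 0 ℚᵘ.+ ℚᵘ.mkℚᵘ (ℤ.+ b) 0        ≈⟨ ℚᵘP.+-cong (ℚᵘP.≃-sym (toℚᵘ-/ (ℤ.+ a) 0)) (ℚᵘP.≃-sym (toℚᵘ-/ (ℤ.+ b) 0)) ⟩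
    ℚ.toℚᵘ (ℕtoℚ a) ℚᵘ.+ ℚ.toℚᵘ (ℕtoℚ b)      ≈⟨ ℚᵘP.≃-sym (ℚP.toℚᵘ-homo-+ (ℕtoℚ a) (ℕtoℚ b)) ⟩
    ℚ.toℚᵘ (ℕtoℚ a ℚ.+ ℕtoℚ b)                ∎)
    where open ℚᵘP.≃-Reasoning

  ℕtoℚ-* : ∀ a b → ℕtoℚ (a * b) ≡ ℕtoℚ a ℚ.* ℕtoℚ b
  ℕtoℚ-* a b = ℚP.toℚᵘ-injective (begin
    ℚ.toℚᵘ (ℕtoℚ (a * b))                     ≈⟨ toℚᵘ-/ (ℤ.+ (a * b)) 0 ⟩
    ℚᵘ.mkℚᵘ (ℤ.+ (a * b)) 0                      ≈⟨ ℚᵘ.*≡* (cong (ℤ._* ℤ.+ 1) (ℤP.pos-* a b)) ⟩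
    ℚᵘ.mkℚᵘ (ℤ.+ a) 0 ℚᵘ.* ℚᵘ.mkℚᵘ (ℤ.+ b) 0        ≈⟨ ℚᵘP.*-cong (ℚᵘP.≃-sym (toℚᵘ-/ (ℤ.+ a) 0)) (ℚᵘP.≃-sym (toℚᵘ-/ (ℤ.+ b) 0)) ⟩
    ℚ.toℚᵘ (ℕtoℚ a) ℚᵘ.* ℚ.toℚᵘ (ℕtoℚ b)      ≈⟨ ℚᵘP.≃-sym (ℚP.toℚᵘ-homo-* (ℕtoℚ a) (ℕtoℚ b)) ⟩
    ℚ.toℚᵘ (ℕtoℚ a ℚ.* ℕtoℚ b)                ∎)
    where open ℚᵘP.≃-Reasoning

  ℕtoℚ-mono : ∀ {a b} → a ≤ b → ℕtoℚ a ℚ.≤ ℕtoℚ b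
  ℕtoℚ-mono {a} {b} a≤b = ℚP.toℚᵘ-cancel-≤ (begin
    ℚ.toℚᵘ (ℕtoℚ a)   ≃⟨ toℚᵘ-/ (ℤ.+ a) 0 ⟩
    ℚᵘ.mkℚᵘ (ℤ.+ a) 0    ≤⟨ ℚᵘ.*≤* (ℤP.*-monoʳ-≤-nonNeg (ℤ.+ 1) (ℤ.+≤+ a≤b)) ⟩
    ℚᵘ.mkℚᵘ (ℤ.+ b) 0    ≃⟨ ℚᵘP.≃-sym (toℚᵘ-/ (ℤ.+ b) 0) ⟩
    ℚ.toℚᵘ (ℕtoℚ b)   ∎)
    where open ℚᵘP.≤-Reasoning

  ℕtoℚ-nonNeg : ∀ a → NonNegative (ℕtoℚ a)
  ℕtoℚ-nonNeg a = ℚP.normalize-nonNeg a 1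

  ℕtoℚ-pos : ∀ a .{{_ : NonZero a}} → Positive (ℕtoℚ a)
  ℕtoℚ-pos a = ℚP.normalize-pos a 1

  ratio-scaled : ∀ d a e → (ℤ.+ 1 ℚ./ suc d) ℚ.* (ℤ.+ a ℚ./ suc e) ℚ.* ℕtoℚ (suc d * suc e) ≡ ℕtoℚ a
  ratio-scaled d a e = ℚP.toℚᵘ-injective (begin
    ℚ.toℚᵘ ((ℤ.+ 1 ℚ./ suc d) ℚ.* (ℤ.+ a ℚ./ suc e) ℚ.* ℕtoℚ N)
      ≈⟨ ℚP.toℚᵘ-homo-* ((ℤ.+ 1 ℚ./ suc d) ℚ.* (ℤ.+ a ℚ./ suc e)) (ℕtoℚ N) ⟩
    ℚ.toℚᵘ ((ℤ.+ 1 ℚ./ suc d) ℚ.* (ℤ.+ a ℚ./ suc e)) ℚᵘ.* ℚ.toℚᵘ (ℕtoℚ N)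
      ≈⟨ ℚᵘP.*-cong (ℚᵘP.≃-trans (ℚP.toℚᵘ-homo-* (ℤ.+ 1 ℚ./ suc d) (ℤ.+ a ℚ./ suc e))
           (ℚᵘP.*-cong (toℚᵘ-/ (ℤ.+ 1) d) (toℚᵘ-/ (ℤ.+ a) e))) (toℚᵘ-/ (ℤ.+ N) 0) ⟩
    ℚᵘ.mkℚᵘ (ℤ.+ 1) d ℚᵘ.* ℚᵘ.mkℚᵘ (ℤ.+ a) e ℚᵘ.* ℚᵘ.mkℚᵘ (ℤ.+ N) 0
      ≈⟨ ℚᵘ.*≡* integers ⟩
    ℚᵘ.mkℚᵘ (ℤ.+ a) 0
      ≈⟨ ℚᵘP.≃-sym (toℚᵘ-/ (ℤ.+ a) 0) ⟩
    ℚ.toℚᵘ (ℕtoℚ a) ∎)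
    where
    open ℚᵘP.≃-Reasoning
    N = suc d * suc e
    integers : (ℤ.+ 1 ℤ.* ℤ.+ a ℤ.* ℤ.+ N) ℤ.* ℤ.+ 1 ≡ ℤ.+ a ℤ.* ℤ.+ (N * 1)
    integers = trans (ℤP.*-identityʳ _) (cong₂ ℤ._*_ (ℤP.*-identityˡ (ℤ.+ a)) (cong ℤ.+_ (sym (*-identityʳ N))))

  -- Weak linear programming duality

  sumFin : ∀ n → (Fin n → ℕ) → ℕ
  sumFin zero f = 0
  sumFin (suc n) f = f Fin.zero + sumFin n (f ∘ Fin.suc)

  sumFin-toℕ : ∀ n f → sumFin n (f ∘ toℕ) ≡ sum< n f
  sumFin-toℕ zero f = refl
  sumFin-toℕ (suc n) f = cong (f 0 +_) (sumFin-toℕ n (f ∘ suc))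

  sumFinℚ : ∀ n → (Fin n → ℚ) → ℚ
  sumFinℚ zero f = 0ℚ
  sumFinℚ (suc n) f = f Fin.zero ℚ.+ sumFinℚ n (f ∘ Fin.suc)

  sumFinℚ-cong : ∀ n {f g} → (∀ v → f v ≡ g v) → sumFinℚ n f ≡ sumFinℚ n g
  sumFinℚ-cong zero h = refl
  sumFinℚ-cong (suc n) h = cong₂ ℚ._+_ (h Fin.zero) (sumFinℚ-cong n (h ∘ Fin.suc))

  sumFinℚ-mono : ∀ n {f g} → (∀ v → f v ℚ.≤ g v) → sumFinℚ n f ℚ.≤ sumFinℚ n g
  sumFinℚ-mono zero h = ℚP.≤-refl
  sumFinℚ-mono (suc n) h = ℚP.+-mono-≤ (h Fin.zero) (sumFinℚ-mono n (h ∘ Fin.suc))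

  sumFinℚ-+ : ∀ n f g → sumFinℚ n (λ v → f v ℚ.+ g v) ≡ sumFinℚ n f ℚ.+ sumFinℚ n g
  sumFinℚ-+ zero f g = sym (ℚP.+-identityˡ 0ℚ)
  sumFinℚ-+ (suc n) f g = begin
    f Fin.zero ℚ.+ g Fin.zero ℚ.+ sumFinℚ n (λ v → f (Fin.suc v) ℚ.+ g (Fin.suc v))
      ≡⟨ cong (f Fin.zero ℚ.+ g Fin.zero ℚ.+_) (sumFinℚ-+ n (f ∘ Fin.suc) (g ∘ Fin.suc)) ⟩
    f Fin.zero ℚ.+ g Fin.zero ℚ.+ (F ℚ.+ G)
      ≡⟨ ℚP.+-assoc (f Fin.zero) (g Fin.zero) (F ℚ.+ G) ⟩
    f Fin.zero ℚ.+ (g Fin.zero ℚ.+ (F ℚ.+ G))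
      ≡⟨ cong (f Fin.zero ℚ.+_) (trans (sym (ℚP.+-assoc (g Fin.zero) F G)) (trans (cong (ℚ._+ G) (ℚP.+-comm (g Fin.zero) F)) (ℚP.+-assoc F (g Fin.zero) G))) ⟩
    f Fin.zero ℚ.+ (F ℚ.+ (g Fin.zero ℚ.+ G))
      ≡⟨ sym (ℚP.+-assoc (f Fin.zero) F (g Fin.zero ℚ.+ G)) ⟩
    f Fin.zero ℚ.+ F ℚ.+ (g Fin.zero ℚ.+ G) ∎
    where
    open ≡-Reasoning
    F = sumFinℚ n (f ∘ Fin.suc)
    G = sumFinℚ n (g ∘ Fin.suc)

  sumFinℚ-*ʳ : ∀ n (f : Fin n → ℕ) c → sumFinℚ n (λ v → ℕtoℚ (f v) ℚ.* c) ≡ ℕtoℚ (sumFin n f) ℚ.* c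
  sumFinℚ-*ʳ zero f c = sym (ℚP.*-zeroˡ c)
  sumFinℚ-*ʳ (suc n) f c = trans (cong (ℕtoℚ (f Fin.zero) ℚ.* c ℚ.+_) (sumFinℚ-*ʳ n (f ∘ Fin.suc) c))
    (trans (sym (ℚP.*-distribʳ-+ c (ℕtoℚ (f Fin.zero)) (ℕtoℚ (sumFin n (f ∘ Fin.suc)))))
      (cong (ℚ._* c) (sym (ℕtoℚ-+ (f Fin.zero) (sumFin n (f ∘ Fin.suc))))))

  module _ {n : ℕ} (y : Fin n → ℕ) (x : VSet n → ℚ) (x≥0 : ∀ I → 0ℚ ℚ.≤ x I) (B : ℕ) where

    cover : List (VSet n) → Fin n → ℚ
    cover Is v = sumℚ (map x (filterᵇ (λ I → v ∈ᵥ I) Is))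

    -- Double counting along the list: a further set `I` raises the left side by `x I` times the
    -- `y`-weight of `I`, and that weight is at most `B`.
    duality : ∀ Is → All (λ I → sumFin n (λ v → ⟦ v ∈ᵥ I ⟧ * y v) ≤ B) Is →
      sumFinℚ n (λ v → ℕtoℚ (y v) ℚ.* cover Is v) ℚ.≤ ℕtoℚ B ℚ.* sumℚ (map x Is)
    duality [] [] = ℚP.≤-reflexive (trans (sumFinℚ-*ʳ n y 0ℚ) (trans (ℚP.*-zeroʳ (ℕtoℚ (sumFin n y))) (sym (ℚP.*-zeroʳ (ℕtoℚ B)))))
    duality (I ∷ Is) (h ∷ hs) = begin
      sumFinℚ n (λ v → ℕtoℚ (y v) ℚ.* cover (I ∷ Is) v)
        ≡⟨ sumFinℚ-cong n split ⟩
      sumFinℚ n (λ v → ℕtoℚ (⟦ v ∈ᵥ I ⟧ * y v) ℚ.* x I ℚ.+ ℕtoℚ (y v) ℚ.* cover Is v)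
        ≡⟨ sumFinℚ-+ n _ _ ⟩
      sumFinℚ n (λ v → ℕtoℚ (⟦ v ∈ᵥ I ⟧ * y v) ℚ.* x I) ℚ.+ sumFinℚ n (λ v → ℕtoℚ (y v) ℚ.* cover Is v)
        ≤⟨ ℚP.+-mono-≤ (ℚP.≤-trans (ℚP.≤-reflexive (sumFinℚ-*ʳ n (λ v → ⟦ v ∈ᵥ I ⟧ * y v) (x I)))
             (ℚP.*-monoʳ-≤-nonNeg (x I) {{ℚ.nonNegative (x≥0 I)}} (ℕtoℚ-mono h))) (duality Is hs) ⟩
      ℕtoℚ B ℚ.* x I ℚ.+ ℕtoℚ B ℚ.* sumℚ (map x Is)
        ≡⟨ sym (ℚP.*-distribˡ-+ (ℕtoℚ B) (x I) (sumℚ (map x Is))) ⟩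
      ℕtoℚ B ℚ.* (x I ℚ.+ sumℚ (map x Is)) ∎
      where
      open ℚP.≤-Reasoning
      split : ∀ v → ℕtoℚ (y v) ℚ.* cover (I ∷ Is) v ≡ ℕtoℚ (⟦ v ∈ᵥ I ⟧ * y v) ℚ.* x I ℚ.+ ℕtoℚ (y v) ℚ.* cover Is v
      split v with v ∈ᵥ I
      ... | true = trans (ℚP.*-distribˡ-+ (ℕtoℚ (y v)) (x I) (cover Is v))
                    (cong (λ t → ℕtoℚ t ℚ.* x I ℚ.+ ℕtoℚ (y v) ℚ.* cover Is v) (sym (+-identityʳ (y v))))
      ... | false = sym (trans (cong (ℚ._+ ℕtoℚ (y v) ℚ.* cover Is v) (ℚP.*-zeroˡ (x I))) (ℚP.+-identityˡ _))

  frac-chrom-bound : ∀ {n} (G : Graph n) (y : Fin n → ℕ) B →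
    (∀ I → T (independentᵇ G I) → sumFin n (λ v → ⟦ v ∈ᵥ I ⟧ * y v) ≤ B) →
    ∀ x → IsFractionalColouring G x → ℕtoℚ (sumFin n y) ℚ.≤ ℕtoℚ B ℚ.* weight G x
  frac-chrom-bound {n} G y B light x (x≥0 , covers) = begin
    ℕtoℚ (sumFin n y)
      ≡⟨ sym (ℚP.*-identityʳ _) ⟩
    ℕtoℚ (sumFin n y) ℚ.* 1ℚ
      ≡⟨ sym (sumFinℚ-*ʳ n y 1ℚ) ⟩
    sumFinℚ n (λ v → ℕtoℚ (y v) ℚ.* 1ℚ)
      ≤⟨ sumFinℚ-mono n (λ v → ℚP.*-monoˡ-≤-nonNeg (ℕtoℚ (y v)) {{ℕtoℚ-nonNeg (y v)}} (covers v)) ⟩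
    sumFinℚ n (λ v → ℕtoℚ (y v) ℚ.* cover y x x≥0 B (indepSets G) v)
      ≤⟨ duality y x x≥0 B (indepSets G) (All.map (λ {I} → light I) (all-filter (T? ∘ independentᵇ G) (allVSets n))) ⟩
    ℕtoℚ B ℚ.* weight G x ∎
    where
    open ℚP.≤-Reasoning

  weight≥0 : ∀ {n} (G : Graph n) x → IsFractionalColouring G x → 0ℚ ℚ.≤ weight G x
  weight≥0 G x (x≥0 , _) = go (indepSets G)
    where
    go : ∀ Is → 0ℚ ℚ.≤ sumℚ (map x Is)
    go [] = ℚP.≤-refl
    go (I ∷ Is) = ℚP.+-mono-≤ (x≥0 I) (go Is)

  -- Finite functions extended to ℕ

  ext : ∀ {A : Set} {n} → A → (Fin n → A) → ℕ → A
  ext {n = zero} d f _ = d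
  ext {n = suc n} d f zero = f Fin.zero
  ext {n = suc n} d f (suc v) = ext d (f ∘ Fin.suc) v

  ext-toℕ : ∀ {A : Set} {n} d (f : Fin n → A) i → ext d f (toℕ i) ≡ f i
  ext-toℕ d f Fin.zero = refl
  ext-toℕ d f (Fin.suc i) = ext-toℕ d (f ∘ Fin.suc) i

  ext-out : ∀ {A : Set} {n} d (f : Fin n → A) v → n ≤ v → ext d f v ≡ d
  ext-out {n = zero} d f v _ = refl
  ext-out {n = suc n} d f (suc v) (s≤s p) = ext-out d (f ∘ Fin.suc) v p

  ext-true : ∀ {n} (f : Fin n → Bool) v → T (ext false f v) → ∃ λ i → toℕ i ≡ v × T (f i)
  ext-true {suc n} f zero p = Fin.zero , refl , p
  ext-true {suc n} f (suc v) p with ext-true (f ∘ Fin.suc) v p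
  ... | i , refl , q = Fin.suc i , refl , q

  length-filter : ∀ {A : Set} n (g : Fin n → A) (p : A → Bool) →
    length (filterᵇ p (tabulate g)) ≡ sum< n (λ v → ⟦ ext false (p ∘ g) v ⟧)
  length-filter zero g p = refl
  length-filter (suc n) g p with p (g Fin.zero)
  ... | true = cong suc (length-filter n (g ∘ Fin.suc) p)
  ... | false = length-filter n (g ∘ Fin.suc) p

  allᵇ-elim : ∀ {n} (p : Fin n → Bool) → T (allᵇ p) → ∀ v → T (p v)
  allᵇ-elim {n} p h v = go (allFin n) h (∈-allFin v)
    where
    go : ∀ xs → T (foldr (λ x b → p x ∧ b) true xs) → v ∈ xs → T (p v)
    go (x ∷ xs) h (here refl) = proj₁ (T-∧⁻ {p x} h)
    go (x ∷ xs) h (there q) = go xs (proj₂ (T-∧⁻ {p x} h)) q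

  independentᵇ-elim : ∀ {n} (G : Graph n) I → T (independentᵇ G I) →
    ∀ u v → T (u ∈ᵥ I) → T (v ∈ᵥ I) → ¬ T (adj G u v)
  independentᵇ-elim G I h u v u∈ v∈ uv with allᵇ-elim _ (allᵇ-elim _ h u) v
  ... | q rewrite T⇒≡ u∈ | T⇒≡ v∈ | T⇒≡ uv = q

  -- From arcs between natural numbers to `Graph` and `Subgraph`.

  module LayeredGraph (n : ℕ) (arc : ℕ → ℕ → Bool) (arc-irrefl : ∀ v → arc v v ≡ false) where

    graph : Graph n
    graph = record
      { adj = λ u v → arc (toℕ u) (toℕ v) ∨ arc (toℕ v) (toℕ u)
      ; sym = λ u v → ∨-comm (arc (toℕ u) (toℕ v)) (arc (toℕ v) (toℕ u))
      ; irref = λ v → cong₂ _∨_ (arc-irrefl (toℕ v)) (arc-irrefl (toℕ v))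
      }

    members : VSet n → ℕ → Bool
    members I = ext false (lookup I)

    members-supported : ∀ I v → n ≤ v → members I v ≡ false
    members-supported I = ext-out false (lookup I)

    members-independent : ∀ I → T (independentᵇ graph I) → ∀ u v → T (members I u) → T (members I v) → ¬ T (arc u v)
    members-independent I ind u v u∈ v∈ uv with ext-true (lookup I) u u∈ | ext-true (lookup I) v v∈
    ... | i , refl , i∈ | j , refl , j∈ = independentᵇ-elim graph I ind i j i∈ j∈ (Equivalence.from T-∨ (inj₁ uv))

    sumFin-members : ∀ I (w : ℕ → ℕ) →
      sumFin n (λ v → ⟦ v ∈ᵥ I ⟧ * w (toℕ v)) ≡ sum< n (λ v → ⟦ members I v ⟧ * w v)
    sumFin-members I w = trans (sumFin-cong n (λ v → cong (λ b → ⟦ b ⟧ * w (toℕ v)) (sym (ext-toℕ false (lookup I) v))))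
      (sumFin-toℕ n (λ v → ⟦ members I v ⟧ * w v))
      where
      sumFin-cong : ∀ n {f g : Fin n → ℕ} → (∀ v → f v ≡ g v) → sumFin n f ≡ sumFin n g
      sumFin-cong zero h = refl
      sumFin-cong (suc n) h = cong₂ _+_ (h Fin.zero) (sumFin-cong n (h ∘ Fin.suc))

    module _ (H : Subgraph graph) where

      edgesOf : ℕ → ℕ → Bool
      edgesOf u v = ext false (λ i → ext false (edge H i) v) u

      edges-true : ∀ u v → T (edgesOf u v) → ∃ λ i → ∃ λ j → toℕ i ≡ u × toℕ j ≡ v × T (edge H i j)
      edges-true u v uv with ext-true (λ i → ext false (edge H i) v) u uv
      ... | i , i≡u , p with ext-true (edge H i) v p
      ... | j , j≡v , q = i , j , i≡u , j≡v , q

      edges-toℕ : ∀ i j → edgesOf (toℕ i) (toℕ j) ≡ edge H i j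
      edges-toℕ i j = trans (ext-toℕ false (λ i → ext false (edge H i) (toℕ j)) i) (ext-toℕ false (edge H i) j)

      edges-swap : ∀ u v → T (edgesOf u v) → T (edgesOf v u)
      edges-swap u v uv with edges-true u v uv
      ... | i , j , refl , refl , ij = subst T (sym (trans (edges-toℕ j i) (esym H j i))) ij

      edges-sym : ∀ u v → edgesOf u v ≡ edgesOf v u
      edges-sym u v = T-ext (edgesOf u v) (edgesOf v u) (edges-swap u v) (edges-swap v u)
        where
        T-ext : ∀ a b → (T a → T b) → (T b → T a) → a ≡ b
        T-ext true true _ _ = refl
        T-ext true false f _ = ⊥-elim (f tt)
        T-ext false true _ g = ⊥-elim (g tt)
        T-ext false false _ _ = refl

      edges-arc : ∀ u v → T (edgesOf u v) → T (arc u v) ⊎ T (arc v u)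
      edges-arc u v uv with edges-true u v uv
      ... | i , j , refl , refl , ij = Equivalence.to T-∨ (eInG H i j ij)

      edges-members : ∀ u v → T (edgesOf u v) → T (members (verts H) u)
      edges-members u v uv with edges-true u v uv
      ... | i , j , refl , refl , ij = subst T (sym (ext-toℕ false (lookup (verts H)) i)) (eInVert H i j ij)

      edges-degree : (∀ v → T (v ∈ᵥ verts H) → degreeIn H v ≡ 4) →
        ∀ u → T (members (verts H) u) → sum< n (λ v → ⟦ edgesOf u v ⟧) ≡ 4
      edges-degree deg u u∈ with ext-true (lookup (verts H)) u u∈
      ... | i , refl , i∈ = trans (sum<-cong n (λ v _ → cong ⟦_⟧ (ext-toℕ false (λ i → ext false (edge H i) v) i)))
        (trans (sym (length-filter n id (edge H i))) (deg i i∈))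

  -- The constant comes from 128 = 16 * 8, with 16 from `a ≤ 16 * k` and 8 from `S ≤ 8 * suc b`.
  -- Multiplying by `N` and `R` clears the denominators and the scaling of the dual weights.
  scaled-bound : ∀ a b k S R .{{_ : NonZero R}} W → 0ℚ ℚ.≤ W → a ≤ 16 * k → S ≤ 8 * suc b →
    ℕtoℚ (k * R) ℚ.≤ ℕtoℚ (S * R) ℚ.* W → (ℤ.+ 1 ℚ./ 128) ℚ.* (ℤ.+ a ℚ./ suc b) ℚ.≤ W
  scaled-bound a b k S R W W≥0 a≤ S≤ h =
    ℚP.*-cancelʳ-≤-pos (ℕtoℚ N) {{ℕtoℚ-pos N}} (ℚP.*-cancelʳ-≤-pos (ℕtoℚ R) {{ℕtoℚ-pos R}} (begin
      (ℤ.+ 1 ℚ./ 128) ℚ.* (ℤ.+ a ℚ./ suc b) ℚ.* ℕtoℚ N ℚ.* ℕtoℚ R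
        ≡⟨ cong (ℚ._* ℕtoℚ R) (ratio-scaled 127 a b) ⟩
      ℕtoℚ a ℚ.* ℕtoℚ R
        ≡⟨ sym (ℕtoℚ-* a R) ⟩
      ℕtoℚ (a * R)
        ≤⟨ ℕtoℚ-mono (≤-trans (*-monoˡ-≤ R a≤) (≤-reflexive (*-assoc 16 k R))) ⟩
      ℕtoℚ (16 * (k * R))
        ≡⟨ ℕtoℚ-* 16 (k * R) ⟩
      ℕtoℚ 16 ℚ.* ℕtoℚ (k * R)
        ≤⟨ ℚP.*-monoˡ-≤-nonNeg (ℕtoℚ 16) h ⟩
      ℕtoℚ 16 ℚ.* (ℕtoℚ (S * R) ℚ.* W)
        ≡⟨ sym (ℚP.*-assoc (ℕtoℚ 16) (ℕtoℚ (S * R)) W) ⟩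
      ℕtoℚ 16 ℚ.* ℕtoℚ (S * R) ℚ.* W
        ≡⟨ cong (ℚ._* W) (sym (ℕtoℚ-* 16 (S * R))) ⟩
      ℕtoℚ (16 * (S * R)) ℚ.* W
        ≤⟨ ℚP.*-monoʳ-≤-nonNeg W {{ℚ.nonNegative W≥0}} (ℕtoℚ-mono 16SR≤NR) ⟩
      ℕtoℚ (N * R) ℚ.* W
        ≡⟨ trans (cong (ℚ._* W) (ℕtoℚ-* N R)) (trans (ℚP.*-comm _ W) (sym (ℚP.*-assoc W (ℕtoℚ N) (ℕtoℚ R)))) ⟩
      W ℚ.* ℕtoℚ N ℚ.* ℕtoℚ R ∎))
    where
    open ℚP.≤-Reasoning
    N = 128 * suc b
    16SR≤NR : 16 * (S * R) ≤ N * R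
    16SR≤NR = ≤-trans (≤-reflexive (sym (*-assoc 16 S R))) (*-monoˡ-≤ R (≤-trans (*-monoʳ-≤ 16 S≤) (≤-reflexive (sym (*-assoc 16 8 (suc b))))))

  -- Parameters in terms of n.

  module ParameterChoice (n a : ℕ) (a≡ : loglog n ≡ a) (64≤a : 64 ≤ a) where

    Λ b k : ℕ
    Λ = ⌊log₂ n ⌋
    b = ⌊log₂ a ⌋
    -- The largest `k` with 8 k + 1 ≤ a: the requirement `large` reads 2 ^ (8 k + 1) ≤ Λ, and Λ is
    -- known to be at least 2 ^ a.
    k = pred a / 8

    1≤a : 1 ≤ a
    1≤a = ≤-trans (s≤s z≤n) 64≤a

    -- Otherwise loglog n would be ⌊log₂ 0⌋ = 0.
    1≤Λ : 1 ≤ Λ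
    1≤Λ = n≢0⇒n>0 λ Λ≡0 → <⇒≢ 1≤a (trans (sym (cong ⌊log₂_⌋ Λ≡0)) a≡)

    1≤n : 1 ≤ n
    1≤n = n≢0⇒n>0 λ n≡0 → <⇒≢ 1≤Λ (sym (cong ⌊log₂_⌋ n≡0))

    2^a≤Λ : 2 ^ a ≤ Λ
    2^a≤Λ = subst (λ t → 2 ^ t ≤ Λ) a≡ (proj₁ (log₂-bounds Λ 1≤Λ))

    8k<a : suc (8 * k) ≤ a
    8k<a = ≤-trans (s≤s (≤-trans (≤-reflexive (*-comm 8 k)) (m/n*n≤m (pred a) 8))) (≤-reflexive (suc-pred a {{>-nonZero 1≤a}}))

    a≤8[1+k] : a ≤ 8 * suc k
    a≤8[1+k] = begin
      a                            ≡⟨ sym (suc-pred a {{>-nonZero 1≤a}}) ⟩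
      suc (pred a)                 ≡⟨ cong suc (m≡m%n+[m/n]*n (pred a) 8) ⟩
      suc (pred a % 8 + k * 8)     ≤⟨ +-monoˡ-≤ (k * 8) (m%n<n (pred a) 8) ⟩
      8 + k * 8                    ≡⟨ *-comm (suc k) 8 ⟩
      8 * suc k                    ∎
      where open ≤-Reasoning

    7≤k : 7 ≤ k
    7≤k = /-monoˡ-≤ 8 (≤-trans (m≤m+n 56 7) (pred-mono-≤ 64≤a))

    a≤16k : a ≤ 16 * k
    a≤16k = ≤-trans a≤8[1+k] (≤-trans (*-monoʳ-≤ 8 (+-monoˡ-≤ k (≤-trans (s≤s z≤n) 7≤k))) (≤-reflexive (e k)))
      where
      e : ∀ k → 8 * (k + k) ≡ 16 * k
      e = solve-∀

    2≤b : 2 ≤ b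
    2≤b = ⌊log₂⌋-mono-≤ (≤-trans (m≤m+n 4 60) 64≤a)

    large : 2 * 16 ^ (k + k) ≤ Λ
    large = ≤-trans (≤-trans (≤-reflexive power) (^-monoʳ-≤ 2 8k<a)) 2^a≤Λ
      where
      e : ∀ k → 4 * (k + k) ≡ 8 * k
      e = solve-∀
      power : 2 * 16 ^ (k + k) ≡ 2 ^ suc (8 * k)
      power = cong (2 *_) (trans (^-*-assoc 2 4 (k + k)) (cong (2 ^_) (e k)))

    k≤2^b : k ≤ 2 ^ b
    k≤2^b = *-cancelˡ-≤ 2 (≤-trans (≤-trans (*-monoˡ-≤ k (m≤m+n 2 6)) (<⇒≤ 8k<a)) (<⇒≤ (proj₂ (log₂-bounds a 1≤a))))

    -- Otherwise 2 ^ (k + 1) ≤ a ≤ 8 (k + 1), which is false for k ≥ 7. The threshold 64 on `a`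
    -- provides k ≥ 7.
    b≤k : b ≤ k
    b≤k = ≮⇒≥ λ k<b → <⇒≱ 8[1+k]<2^[1+k] (≤-trans (^-monoʳ-≤ 2 k<b) (≤-trans (proj₁ (log₂-bounds a 1≤a)) a≤8[1+k]))
      where
      8[1+k]<2^[1+k] : 8 * suc k < 2 ^ suc k
      8[1+k]<2^[1+k] = begin-strict
        8 * suc k                ≤⟨ *-monoˡ-≤ (suc k) (s≤s 7≤k) ⟩
        suc k * suc k            <⟨ m<m+n (suc k * suc k) z<s ⟩
        suc k * suc k + suc k * suc k ≡⟨ e (suc k * suc k) ⟩
        2 * (1 * (suc k * suc k)) ≤⟨ *-monoʳ-≤ 2 (c*[1+n]²≤2^n 1 6 (s≤s (s≤s z≤n)) (≤ᵇ⇒≤ 49 64 tt) k (≤-trans (n≤1+n 6) 7≤k)) ⟩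
        2 * 2 ^ k                ∎
        where
        open ≤-Reasoning
        e : ∀ x → x + x ≡ 2 * (1 * x)
        e = solve-∀

    open Construction k b Λ n (≤-trans (m≤m+n 2 5) 7≤k) 2≤b b≤k k≤2^b large
      (proj₁ (log₂-bounds n 1≤n)) (proj₂ (log₂-bounds n 1≤n))

    witness : (∃ λ ω → sum< k (bad ω) ≡ 0) → Σ (Graph n) λ G →
      FracChromAtLeast G ((ℤ.+ 1 ℚ./ 128) ℚ.* ratio a b) × ¬ Has4RegularSubgraph G
    witness (ω , bad≡0) = graph , fractional , no4
      where
      not-bad : ∀ i → i < k → bad ω i ≡ 0
      not-bad = sum<≡0 k (bad ω) bad≡0
      arc-irrefl : ∀ v → arc ω v v ≡ false
      arc-irrefl v = cong (_∧ (ω v (lay v) ≡ᵇ v)) (n≮ᵇn (lay v))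
        where
        n≮ᵇn : ∀ n → (n <ᵇ n) ≡ false
        n≮ᵇn zero = refl
        n≮ᵇn (suc n) = n≮ᵇn n
      open LayeredGraph n (arc ω) arc-irrefl
      fractional : FracChromAtLeast graph ((ℤ.+ 1 ℚ./ 128) ℚ.* ratio a b)
      fractional x col = bound b refl
        where
        Q = 2 * (2 * suc b) + 2
        R = 2 ^ Λ
        h : ℕtoℚ (k * R) ℚ.≤ ℕtoℚ (Q * R) ℚ.* weight graph x
        h = subst (λ t → ℕtoℚ t ℚ.≤ ℕtoℚ (Q * R) ℚ.* weight graph x)
          (trans (sumFin-toℕ n (weightAt)) weightAt-total)
          (frac-chrom-bound graph (weightAt ∘ toℕ) (Q * R)
            (λ I ind → ≤-trans (≤-reflexive (sumFin-members I (weightAt)))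
              (independent-light ω not-bad (members I) (members-supported I) (members-independent I ind))) x col)
        Q≤8b : Q ≤ 8 * b
        Q≤8b = by-≤ 2 (*-monoʳ-≤ 4 2≤b) (e b)
          where
          e : ∀ b → 2 * (2 * suc b) + 2 + 4 * b + 2 ≡ 8 * b + 4 * 2
          e = solve-∀
        -- `ratio` takes its intended value on a successor, so `b` is generalised to `c` and the
        -- case 0 is excluded by `2 ≤ b`.
        bound : ∀ c → b ≡ c → (ℤ.+ 1 ℚ./ 128) ℚ.* ratio a c ℚ.≤ weight graph x
        bound zero b≡0 = ⊥-elim (<⇒≢ (≤-trans (s≤s z≤n) 2≤b) (sym b≡0))
        bound (suc c) b≡ = scaled-bound a c k Q R {{m^n≢0 2 Λ}} (weight graph x) (weight≥0 graph x col) a≤16k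
          (subst (λ t → Q ≤ 8 * t) b≡ Q≤8b) h
      no4 : ¬ Has4RegularSubgraph graph
      no4 (H , (v , v∈) , deg) = <⇒≢ nonempty (sym (no-regular ω not-bad (edgesOf H) (members (verts H)) (members-supported (verts H))
          (edges-sym H) (edges-arc H) (edges-members H) (edges-degree H deg)))
        where
        nonempty : 0 < card (members (verts H))
        nonempty = ≤-trans (≤-reflexive (sym (trans (cong ⟦_⟧ (ext-toℕ false (lookup (verts H)) v)) (⟦T⟧ v∈))))
          (term≤sum< n (λ u → ⟦ members (verts H) u ⟧) (toℕ v) (toℕ<n v))

    exists : Σ (Graph n) λ G →
      FracChromAtLeast G ((ℤ.+ 1 ℚ./ 128) ℚ.* ratio a b) × ¬ Has4RegularSubgraph G
    exists = witness outcome

  threshold : ∀ t → ∃ λ N → ∀ n → n ≥ N → t ≤ loglog n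
  threshold t = 2 ^ (2 ^ t) , λ n n≥ → subst (_≤ loglog n) (trans (cong ⌊log₂_⌋ (⌊log₂[2^n]⌋≡n (2 ^ t))) (⌊log₂[2^n]⌋≡n t))
    (⌊log₂⌋-mono-≤ (⌊log₂⌋-mono-≤ n≥))

  large-fractional-chromatic-number : Σ ℚ λ c → (0ℚ ℚ.< c) × (Σ ℕ λ N → ∀ n → n ≥ N →
    Σ (Graph n) λ G → FracChromAtLeast G (c ℚ.* ratio (loglog n) (logloglog n)) × ¬ Has4RegularSubgraph G)
  large-fractional-chromatic-number = ℤ.+ 1 ℚ./ 128 , from-yes (0ℚ ℚP.<? ℤ.+ 1 ℚ./ 128) ,
    proj₁ (threshold 64) , λ n n≥N →
      ParameterChoice.exists n (loglog n) refl (proj₂ (threshold 64) n n≥N)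

open import Defs
open import Data.Nat using (ℕ; _≥_)
open import Data.Rational using (ℚ; 0ℚ; _<_; _*_)
open import Data.Product using (Σ; _×_)
open import Relation.Nullary using (¬_)

theorem1p2 : Σ ℚ λ c → (0ℚ < c) × (Σ ℕ λ N → ∀ n → n ≥ N →
    Σ (Graph n) λ G →
      FracChromAtLeast G (c * ratio (loglog n) (logloglog n))
      × ¬ Has4RegularSubgraph G)
theorem1p2 = Proof.large-fractional-chromatic-number
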